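{- Let $E$ and $F$ be finite sets, let $\mathsf{A}$ be a bimatroid on $E\times F$, and set $N=|E|+|F|$. Let $RR^\updownarrow_k(\mathsf{A})$ be the number of vertical regular rectangles of $\mathsf{A}$ with $k$ columns and $RR^\leftrightarrow_k(\mathsf{A})$ the number of horizontal regular rectangles of $\mathsf{A}$ with $k$ rows. Then both sequences are ultra log-concave: for all $k\ge 1$, \[ \frac{RR_k^\updownarrow(\mathsf{A})^2}{\binom{N}{k}^2}\geq \frac{RR_{k-1}^\updownarrow(\mathsf{A})}{\binom{N}{k-1}}\cdot\frac{RR_{k+1}^\updownarrow(\mathsf{A})}{\binom{N}{k+1}} \quad\text{and}\quad \frac{RR_k^\leftrightarrow(\mathsf{A})^2}{\binom{N}{k}^2}\geq \frac{RR_{k-1}^\leftrightarrow(\mathsf{A})}{\binom{N}{k-1}}\cdot\frac{RR_{k+1}^\leftrightarrow(\mathsf{A})}{\binom{N}{k+1}}. \]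
   Context: For finite sets $E,F$ write $\binom{E}{\ast}\times\binom{F}{\ast}=\bigcup_{d\ge 0}\binom{E}{d}\times\binom{F}{d}$, and $S_{s\leftrightarrow s'}=(S-\{s\})\cup\{s'\}$. A bimatroid $\mathsf{A}$ on $E\times F$ is a subset $\mathcal{R}(\mathsf{A})\subseteq\binom{E}{\ast}\times\binom{F}{\ast}$ (regular minors) such that: (1) $(\emptyset,\emptyset)\in\mathcal{R}(\mathsf{A})$; (2) for all $(I,J),(I',J')\in\mathcal{R}(\mathsf{A})$: (a) for every $i'\in I'-I$, either some $i\in I-I'$ has $(I_{i\leftrightarrow i'},J)\in\mathcal{R}(\mathsf{A})$, or some $j'\in J'-J$ has $(I\cup\{i'\},J\cup\{j'\})\in\mathcal{R}(\mathsf{A})$; (b) for every $j\in J-J'$, either some $j'\in J'-J$ has $(I,J_{j\leftrightarrow j'})\in\mathcal{R}(\mathsf{A})$, or some $i\in I-I'$ has $(I-\{i\},J-\{j\})\in\mathcal{R}(\mathsf{A})$. The relative rank $r_{\mathsf{A}}(S,T)$ for $S\subseteq E$, $T\subseteq F$ is the largest $d$ such that some $(I,J)\in\mathcal{R}(\mathsf{A})$ with $|I|=|J|=d$ has $I\subseteq S$, $J\subseteq T$. A pair $(S,T)$ (a "rectangle" with rows $S$ and columns $T$) is a vertical regular rectangle if $r_{\mathsf{A}}(S,T)=|T|\le |S|$, and a horizontal regular rectangle if $r_{\mathsf{A}}(S,T)=|S|\le|T|$. -}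

module Defs where

open import Data.Bool using (Bool; true; false; _∧_; _∨_; not; if_then_else_)
open import Data.Nat using (ℕ; zero; suc; _⊔_; _≤_; _≡ᵇ_; _≤ᵇ_)
open import Data.Fin using (Fin)
open import Data.Fin.Subset using (Subset; ⁅_⁆; _∈_; _∉_; _⊆_; _∪_; _-_; ∣_∣; ⊥)
open import Data.Vec using (Vec; []; _∷_)
open import Data.List using (List; []; _∷_; map; concatMap; foldr; filter; length)
open import Data.Product using (_×_; _,_; Σ-syntax; ∃-syntax)
open import Data.Sum using (_⊎_)
open import Relation.Binary.PropositionalEquality using (_≡_)
open import Relation.Nullary.Decidable using (does)
open import Data.Bool.Properties using (T?)
open import Data.Bool using (T)

-- E = Fin m, F = Fin n.  A subset R ⊆ 2^E × 2^F is given by its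
-- (Bool-valued) characteristic function.

allSubsets : (n : ℕ) → List (Subset n)
allSubsets zero = [] ∷ []
allSubsets (suc n) = concatMap (λ s → (false ∷ s) ∷ (true ∷ s) ∷ []) (allSubsets n)

_⊆ᵇ_ : {n : ℕ} → Subset n → Subset n → Bool
[] ⊆ᵇ [] = true
(x ∷ xs) ⊆ᵇ (y ∷ ys) = (not x ∨ y) ∧ (xs ⊆ᵇ ys)

_[_↔_] : {n : ℕ} → Subset n → Fin n → Fin n → Subset n
S [ s ↔ s' ] = (S - s) ∪ ⁅ s' ⁆

module _ {m n : ℕ} (R : Subset m → Subset n → Bool) where

  _∈R : Subset m × Subset n → Set
  (I , J) ∈R = R I J ≡ true

  record IsBimatroid : Set where
    field
      square  : ∀ I J → (I , J) ∈R → ∣ I ∣ ≡ ∣ J ∣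
      empty   : (⊥ , ⊥) ∈R
      exchA   : ∀ I J I' J' → (I , J) ∈R → (I' , J') ∈R →
                ∀ i' → i' ∈ I' → i' ∉ I →
                (∃[ i ] (i ∈ I × i ∉ I' × ((I [ i ↔ i' ]) , J) ∈R))
                ⊎ (∃[ j' ] (j' ∈ J' × j' ∉ J × ((I ∪ ⁅ i' ⁆) , (J ∪ ⁅ j' ⁆)) ∈R))
      exchB   : ∀ I J I' J' → (I , J) ∈R → (I' , J') ∈R →
                ∀ j → j ∈ J → j ∉ J' →
                (∃[ j' ] (j' ∈ J' × j' ∉ J × (I , (J [ j ↔ j' ])) ∈R))
                ⊎ (∃[ i ] (i ∈ I × i ∉ I' × ((I - i) , (J - j)) ∈R))

  allPairs : List (Subset m × Subset n)
  allPairs = concatMap (λ I → map (λ J → (I , J)) (allSubsets n)) (allSubsets m)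

  -- relative rank r(S,T): largest |I| over (I,J) ∈ R with I ⊆ S, J ⊆ T
  -- (the maximum of the list; (∅,∅) ∈ R guarantees it is attained).
  rank : Subset m → Subset n → ℕ
  rank S T = foldr (λ p acc → f p ⊔ acc) 0 allPairs
    where
    f : Subset m × Subset n → ℕ
    f (I , J) = if R I J ∧ (I ⊆ᵇ S) ∧ (J ⊆ᵇ T) then ∣ I ∣ else 0

  isVertRR : Subset m × Subset n → Bool
  isVertRR (S , T) = (rank S T ≡ᵇ ∣ T ∣) ∧ (∣ T ∣ ≤ᵇ ∣ S ∣)

  isHorRR : Subset m × Subset n → Bool
  isHorRR (S , T) = (rank S T ≡ᵇ ∣ S ∣) ∧ (∣ S ∣ ≤ᵇ ∣ T ∣)

  RRv : ℕ → ℕ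
  RRv k = length (filter (λ p → T? (isVertRR p ∧ (∣ Data.Product.proj₂ p ∣ ≡ᵇ k))) allPairs)

  RRh : ℕ → ℕ
  RRh k = length (filter (λ p → T? (isHorRR p ∧ (∣ Data.Product.proj₁ p ∣ ≡ᵇ k))) allPairs)

module Submission where

-- The sets (E − I) ∪ J with (I, J) regular are the bases of a matroid on E ⊔ F.  The rectangle (S, T) is
-- vertical regular iff (E − S) ∪ T is independent, and horizontal regular iff S ∪ (F − T) is independent
-- in the dual matroid, so both sequences count independent sets A of a matroid on N elements by the size
-- of A ∩ F (or A ∩ E).  The polynomial Σ_A x₀^(N−|A|) x^A over all independent sets is Lorentzian; its
-- coefficients in the two directions "x₀ and the elements outside F" and "elements of F" are the counts
-- divided by binomial coefficients, and log-concavity of these is the reversed Cauchy–Schwarz inequality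
-- for the mixed derivatives.
--
-- The Lorentzian property is propagated from second-order derivatives by trickling down: if H = Σ_k w_k H^k
-- and each H^k satisfies reversed Cauchy–Schwarz at w, then ⟨v, Hv⟩ ≤ Σ_k w_k (Hv)_k² / (Hw)_k, which says
-- N ≤ N² for the normalised operator N of H.  The row of the variable x₀ dominates all others, and this
-- gives N a spectral gap below its top eigenvalue 1, so N ≤ 0 on the complement of w.  Eigenvalues are
-- avoided, which allows everything to take place over ℚ.

-- The factorial weight on x₀ makes the coefficients blind to the part of an independent set outside
-- the distinguished subset. If that part has j elements, its letters can be placed among the a
-- derivatives of the first direction in a!/(a - j)! ways, x₀ fills the other a - j places, and the
-- weight (a - j)! completes this to a!, whatever j is. The second direction contributes b!, and for
-- a + b = N the product a! b! is N! divided by the binomial coefficient of N over b: this is the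
-- "ultra" in the conclusion. Trickling down along w divides by the entries of w, and its gap is w₀
-- / Σ w; but the direction of the distinguished elements vanishes at x₀. So the property carried
-- through the induction is reversed Cauchy-Schwarz against all nonnegative vectors, a closed
-- condition: it is proved for w + ε𝟏 and survives ε → 0. The quadratic base case is tight: with ℓ
-- the exponent of x₀, the ratio of consecutive weights and the bound on the number of parallel
-- classes are the same number ℓ + 2.

open import Defs
open import Algebra.Bundles using (CommutativeRing)
open import Algebra.Structures using (IsCommutativeRing)
open import Algebra.Solver.Ring.AlmostCommutativeRing using (fromCommutativeRing; _-Raw-AlmostCommutative⟶_; Induced-equivalence)
import Algebra.Properties.CommutativeMonoid.Sum
import Algebra.Properties.Ring
import Algebra.Properties.Semiring.Mult
import Algebra.Properties.Semiring.Sum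
import Algebra.Solver.Ring
open import Data.Bool.Base using (Bool; true; false; _∧_; not; if_then_else_)
open import Data.Bool.Properties using (T?; T-≡; not-involutive; ∧-comm)
open import Data.Empty using (⊥-elim)
open import Data.Fin.Base using (Fin; zero; suc; _↑ˡ_; _↑ʳ_; splitAt)
open import Data.Fin.Properties using (_≟_; any?; splitAt⁻¹-↑ˡ; splitAt⁻¹-↑ʳ)
open import Data.Fin.Subset using (Subset; ⁅_⁆; _∈_; _∉_; _⊆_; _⊂_; _∩_; _∪_; ∁; ∣_∣; ⊥; ⊤)
open import Data.Fin.Subset.Properties
open import Data.Integer.Base as ℤ using (ℤ; -[1+_]; _⊖_)
import Data.Integer.Properties as ℤ
import Data.List.Base as List
open import Data.List.Base using (List; []; _∷_; filter; map; concatMap; length)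
open import Data.List.Membership.Propositional.Properties using (∈-map⁺; ∈-concatMap⁺)
import Data.List.Membership.Propositional as List
import Data.List.Properties as List
open import Data.List.Relation.Unary.All using (All; []; _∷_)
import Data.List.Relation.Unary.All.Properties as All
open import Data.List.Relation.Unary.Any using (here; there)
import Data.List.Relation.Unary.Any as Any
open import Data.Maybe.Base using (just; nothing)
open import Data.Nat.Base as ℕ using (ℕ; zero; suc; z≤n; s≤s; _!; _⊔_; _≡ᵇ_; _≤ᵇ_)
open import Data.Nat.Combinatorics using (_C_; nCk≡n!/k![n-k]!; k![n∸k]!∣n!)
open import Data.Nat.DivMod using (m/n*n≡m)
import Data.Nat.ListAction as ListAction
import Data.Nat.ListAction.Properties as ListAction
import Data.Nat.Properties as ℕ
open import Data.Nat.Solver using (module +-*-Solver)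
open import Data.Product using (_×_; _,_; proj₁; proj₂; ∃-syntax)
open import Data.Rational.Base as ℚ using (ℚ; 0ℚ; 1ℚ; 1/_)
import Data.Rational.Properties as ℚ
open import Data.Rational.Unnormalised.Base as ℚᵘ using (mkℚᵘ; *≡*)
import Data.Rational.Unnormalised.Properties as ℚᵘ
open import Data.Sum using (_⊎_; inj₁; inj₂)
import Data.Sum as Sum
open import Data.Vec.Base as Vec using (Vec; []; _∷_; here; there; lookup; updateAt; _[_]≔_; _++_; take; drop)
open import Data.Vec.Properties using ([]=⇒lookup; lookup⇒[]=; lookup∘updateAt; lookup∘updateAt′; []≔-commutes; []≔-updates; []≔-minimal; []≔-++-↑ˡ; []≔-++-↑ʳ; lookup-++ˡ; lookup-++ʳ; map-[]≔; map-++; take++drop≡id)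
open import Function.Base using (_∘_)
open import Function.Bundles using (Equivalence)
open import Relation.Binary.Definitions using (WeaklyDecidable)
open import Relation.Binary.PropositionalEquality
open import Relation.Nullary using (¬_; Dec; yes; no; contradiction)
open import Relation.Nullary.Decidable using (_×-dec_; ¬?)

-- Ordered fields

-- Positivity is expressed throughout as `¬ x ≤ 0#`. The field `archimedean` stands in for
-- completeness: it ends the iteration in `Gap`, which replaces the spectral theorem.
record ArchimedeanField : Set₁ where
  infix  9 -_
  infixl 7 _*_
  infixl 6 _+_
  infix  4 _≤_ _≤?_
  field
    K   : Set
    _+_ _*_ : K → K → K
    -_  : K → K
    0# 1# : K
    isCommutativeRing : IsCommutativeRing _≡_ _+_ _*_ -_ 0# 1#
    _⁻¹ : K → K
    _≤_ : K → K → Set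
    _≤?_ : ∀ x y → Dec (x ≤ y)
    *-inverse : ∀ {x} → ¬ x ≡ 0# → x * (x ⁻¹) ≡ 1#
    ≤-refl    : ∀ {x} → x ≤ x
    ≤-trans   : ∀ {x y z} → x ≤ y → y ≤ z → x ≤ z
    ≤-antisym : ∀ {x y} → x ≤ y → y ≤ x → x ≡ y
    ≰⇒≥       : ∀ {x y} → ¬ x ≤ y → y ≤ x
    +-monoʳ-≤ : ∀ z {x y} → x ≤ y → z + x ≤ z + y
    *-nonneg  : ∀ {x y} → 0# ≤ x → 0# ≤ y → 0# ≤ x * y
    0≢1       : ¬ 0# ≡ 1#

  commutativeRing : CommutativeRing _ _
  commutativeRing = record { isCommutativeRing = isCommutativeRing }

  open CommutativeRing commutativeRing public
    using (_-_; +-assoc; +-comm; +-identityˡ; +-identityʳ; -‿inverseˡ; -‿inverseʳ;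
           *-assoc; *-comm; *-identityˡ; *-identityʳ; distribˡ; distribʳ; zeroˡ; zeroʳ;
           ring; semiring; +-commutativeMonoid)

  open Algebra.Properties.Semiring.Mult semiring public
    using (×1-homo-*; ×-homo-+) renaming (_×_ to _·_)

  field
    archimedean : ∀ x y → ¬ x ≤ 0# → ∃[ n ] y ≤ n · x

  fromℕ : ℕ → K
  fromℕ n = n · 1#

module Field (𝔽 : ArchimedeanField) where

  open ArchimedeanField 𝔽 public
  open Algebra.Properties.Ring ring
    using (-0#≈0#; -‿distribˡ-*; -‿distribʳ-*; -‿involutive; -‿+-comm)

  private
    -- Integer coefficients let the ring solver cancel terms. The separate cases for 0 and 1 make
    -- its constants evaluate to `0#` and `1#` by definition, where `fromℕ 1` would be `1# + 0#`.
    fromℤ : ℤ → K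
    fromℤ (ℤ.+ 0)    = 0#
    fromℤ (ℤ.+ 1)    = 1#
    fromℤ (ℤ.+ n@(suc (suc _))) = fromℕ n
    fromℤ -[1+ n ] = - fromℕ (suc n)

    fromℤ-+ : ∀ n → fromℤ (ℤ.+ n) ≡ fromℕ n
    fromℤ-+ 0 = refl
    fromℤ-+ 1 = sym (+-identityʳ 1#)
    fromℤ-+ (suc (suc n)) = refl

    fromℤ-neg : ∀ n → fromℤ (ℤ.- (ℤ.+ n)) ≡ - fromℕ n
    fromℤ-neg zero    = sym -0#≈0#
    fromℤ-neg (suc n) = refl

    cancel-1 : ∀ a b → (1# + a) + - (1# + b) ≡ a + - b
    cancel-1 a b = begin
      (1# + a) + - (1# + b)      ≡⟨ cong₂ _+_ (+-comm 1# a) (sym (-‿+-comm 1# b)) ⟩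
      (a + 1#) + (- 1# + - b)    ≡⟨ +-assoc a 1# _ ⟩
      a + (1# + (- 1# + - b))    ≡⟨ cong (a +_) (sym (+-assoc 1# _ _)) ⟩
      a + ((1# + - 1#) + - b)    ≡⟨ cong (λ z → a + (z + - b)) (-‿inverseʳ 1#) ⟩
      a + (0# + - b)             ≡⟨ cong (a +_) (+-identityˡ _) ⟩
      a + - b                    ∎
      where open ≡-Reasoning

    fromℤ-⊖ : ∀ m n → fromℤ (m ⊖ n) ≡ fromℕ m + - fromℕ n
    fromℤ-⊖ m       zero    = trans (fromℤ-+ m) (sym (trans (cong (fromℕ m +_) -0#≈0#) (+-identityʳ _)))
    fromℤ-⊖ zero    (suc n) = sym (+-identityˡ _)
    fromℤ-⊖ (suc m) (suc n) = begin
      fromℤ (suc m ⊖ suc n)          ≡⟨ cong fromℤ (ℤ.[1+m]⊖[1+n]≡m⊖n m n) ⟩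
      fromℤ (m ⊖ n)                  ≡⟨ fromℤ-⊖ m n ⟩
      fromℕ m + - fromℕ n            ≡⟨ cancel-1 (fromℕ m) (fromℕ n) ⟨
      fromℕ (suc m) + - fromℕ (suc n) ∎
      where open ≡-Reasoning

    fromℤ-homo-+ : ∀ i j → fromℤ (i ℤ.+ j) ≡ fromℤ i + fromℤ j
    fromℤ-homo-+ (ℤ.+ m) (ℤ.+ n) = begin
      fromℤ (ℤ.+ (m ℕ.+ n))     ≡⟨ fromℤ-+ (m ℕ.+ n) ⟩
      fromℕ (m ℕ.+ n)         ≡⟨ ×-homo-+ 1# m n ⟩
      fromℕ m + fromℕ n       ≡⟨ cong₂ _+_ (fromℤ-+ m) (fromℤ-+ n) ⟨
      fromℤ (ℤ.+ m) + fromℤ (ℤ.+ n) ∎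
      where open ≡-Reasoning
    fromℤ-homo-+ (ℤ.+ m) -[1+ n ] =
      trans (fromℤ-⊖ m (suc n)) (cong (_+ - fromℕ (suc n)) (sym (fromℤ-+ m)))
    fromℤ-homo-+ -[1+ m ] (ℤ.+ n) =
      trans (fromℤ-⊖ n (suc m)) (trans (+-comm _ _) (cong (- fromℕ (suc m) +_) (sym (fromℤ-+ n))))
    fromℤ-homo-+ -[1+ m ] -[1+ n ] = begin
      - fromℕ (suc (suc (m ℕ.+ n)))        ≡⟨ cong (λ k → - fromℕ (suc k)) (ℕ.+-suc m n) ⟨
      - fromℕ (suc m ℕ.+ suc n)            ≡⟨ cong -_ (×-homo-+ 1# (suc m) (suc n)) ⟩
      - (fromℕ (suc m) + fromℕ (suc n))    ≡⟨ -‿+-comm _ _ ⟨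
      - fromℕ (suc m) + - fromℕ (suc n)    ∎
      where open ≡-Reasoning

    fromℤ-homo-neg : ∀ i → fromℤ (ℤ.- i) ≡ - fromℤ i
    fromℤ-homo-neg (ℤ.+ n)    = trans (fromℤ-neg n) (cong -_ (sym (fromℤ-+ n)))
    fromℤ-homo-neg -[1+ n ] = trans (fromℤ-+ (suc n)) (sym (-‿involutive _))

    fromℤ-homo-pos-* : ∀ m j → fromℤ (ℤ.+ m ℤ.* j) ≡ fromℕ m * fromℤ j
    fromℤ-homo-pos-* m (ℤ.+ n) = begin
      fromℤ (ℤ.+ m ℤ.* ℤ.+ n)     ≡⟨ cong fromℤ (ℤ.pos-* m n) ⟨
      fromℤ (ℤ.+ (m ℕ.* n))       ≡⟨ fromℤ-+ (m ℕ.* n) ⟩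
      fromℕ (m ℕ.* n)             ≡⟨ ×1-homo-* m n ⟩
      fromℕ m * fromℕ n           ≡⟨ cong (fromℕ m *_) (fromℤ-+ n) ⟨
      fromℕ m * fromℤ (ℤ.+ n)     ∎
      where open ≡-Reasoning
    fromℤ-homo-pos-* m -[1+ n ] = begin
      fromℤ (ℤ.+ m ℤ.* -[1+ n ])            ≡⟨ cong fromℤ (ℤ.neg-distribʳ-* (ℤ.+ m) (ℤ.+ suc n)) ⟨
      fromℤ (ℤ.- (ℤ.+ m ℤ.* ℤ.+ suc n))     ≡⟨ fromℤ-homo-neg (ℤ.+ m ℤ.* ℤ.+ suc n) ⟩
      - fromℤ (ℤ.+ m ℤ.* ℤ.+ suc n)         ≡⟨ cong -_ (fromℤ-homo-pos-* m (ℤ.+ suc n)) ⟩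
      - (fromℕ m * fromℤ (ℤ.+ suc n))       ≡⟨ -‿distribʳ-* _ _ ⟩
      fromℕ m * - fromℤ (ℤ.+ suc n)         ≡⟨ cong (λ z → fromℕ m * - z) (fromℤ-+ (suc n)) ⟩
      fromℕ m * - fromℕ (suc n)             ∎
      where open ≡-Reasoning

    fromℤ-homo-* : ∀ i j → fromℤ (i ℤ.* j) ≡ fromℤ i * fromℤ j
    fromℤ-homo-* (ℤ.+ m) j = trans (fromℤ-homo-pos-* m j) (cong (_* fromℤ j) (sym (fromℤ-+ m)))
    fromℤ-homo-* -[1+ m ] j = begin
      fromℤ (-[1+ m ] ℤ.* j)            ≡⟨ cong fromℤ (ℤ.neg-distribˡ-* (ℤ.+ suc m) j) ⟨
      fromℤ (ℤ.- (ℤ.+ suc m ℤ.* j))     ≡⟨ fromℤ-homo-neg (ℤ.+ suc m ℤ.* j) ⟩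
      - fromℤ (ℤ.+ suc m ℤ.* j)         ≡⟨ cong -_ (fromℤ-homo-pos-* (suc m) j) ⟩
      - (fromℕ (suc m) * fromℤ j)       ≡⟨ -‿distribˡ-* _ _ ⟩
      - fromℕ (suc m) * fromℤ j         ∎
      where open ≡-Reasoning

    ℤ⟶𝔽 : ℤ.+-*-rawRing -Raw-AlmostCommutative⟶ fromCommutativeRing commutativeRing
    ℤ⟶𝔽 = record
      { ⟦_⟧ = fromℤ ; +-homo = fromℤ-homo-+ ; *-homo = fromℤ-homo-* ; -‿homo = fromℤ-homo-neg
      ; 0-homo = refl ; 1-homo = refl }

    _coeff≟_ : WeaklyDecidable (Induced-equivalence ℤ⟶𝔽)
    i coeff≟ j with i ℤ.≟ j
    ... | yes i≡j = just (cong fromℤ i≡j)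
    ... | no  _   = nothing

  open Algebra.Solver.Ring ℤ.+-*-rawRing (fromCommutativeRing commutativeRing) ℤ⟶𝔽 _coeff≟_ public
    using (solve; _:=_; _:+_; _:*_; _:-_; :-_; con; Polynomial)

  𝟘 𝟙 𝟚 : ∀ {n} → Polynomial n
  𝟘 = con (ℤ.+ 0)
  𝟙 = con (ℤ.+ 1)
  𝟚 = 𝟙 :+ 𝟙

  2# : K
  2# = 1# + 1#

  ≡⇒≤ : ∀ {x y} → x ≡ y → x ≤ y
  ≡⇒≤ refl = ≤-refl

  ≤⇒0≤- : ∀ {x y} → x ≤ y → 0# ≤ y - x
  ≤⇒0≤- {x} {y} x≤y = subst₂ _≤_ (-‿inverseˡ x) (+-comm _ _) (+-monoʳ-≤ (- x) x≤y)

  0≤-⇒≤ : ∀ {x y} → 0# ≤ y - x → x ≤ y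
  0≤-⇒≤ {x} {y} p = subst₂ _≤_ (+-identityʳ x)
    (solve 2 (λ x y → x :+ (y :- x) := y) refl x y) (+-monoʳ-≤ x p)

  -- The working form of most inequalities below: a visibly nonnegative certificate, and a ring
  -- identity that is left to the solver.
  ≤-by : ∀ {x y z} → 0# ≤ z → z ≡ y - x → x ≤ y
  ≤-by p eq = 0≤-⇒≤ (subst (0# ≤_) eq p)

  +-nonneg : ∀ {x y} → 0# ≤ x → 0# ≤ y → 0# ≤ x + y
  +-nonneg {x} p q = ≤-trans p (subst (_≤ x + _) (+-identityʳ x) (+-monoʳ-≤ x q))

  +-mono-≤ : ∀ {x y z w} → x ≤ y → z ≤ w → x + z ≤ y + w
  +-mono-≤ {x} {y} {z} {w} p q = ≤-by (+-nonneg (≤⇒0≤- p) (≤⇒0≤- q))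
    (solve 4 (λ x y z w → (y :- x) :+ (w :- z) := (y :+ w) :- (x :+ z)) refl x y z w)

  *-monoˡ-≤ : ∀ {c x y} → 0# ≤ c → x ≤ y → c * x ≤ c * y
  *-monoˡ-≤ {c} {x} {y} p q = ≤-by (*-nonneg p (≤⇒0≤- q))
    (solve 3 (λ c x y → c :* (y :- x) := c :* y :- c :* x) refl c x y)

  ≤0⇒0≤- : ∀ {x} → x ≤ 0# → 0# ≤ - x
  ≤0⇒0≤- {x} p = subst (0# ≤_) (+-identityˡ (- x)) (≤⇒0≤- p)

  sq-nonneg : ∀ x → 0# ≤ x * x
  sq-nonneg x with 0# ≤? x
  ... | yes p = *-nonneg p p
  ... | no ¬p = subst (0# ≤_) (solve 1 (λ x → :- x :* :- x := x :* x) refl x) (*-nonneg q q)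
    where q = ≤0⇒0≤- (≰⇒≥ ¬p)

  0≤1 : 0# ≤ 1#
  0≤1 = subst (0# ≤_) (*-identityˡ 1#) (sq-nonneg 1#)

  1≰0 : ¬ 1# ≤ 0#
  1≰0 p = 0≢1 (≤-antisym 0≤1 p)

  *-pos : ∀ {x y} → ¬ x ≤ 0# → ¬ y ≤ 0# → ¬ x * y ≤ 0#
  *-pos {x} {y} x≰0 y≰0 xy≤0 = y≰0 (subst (_≤ 0#) y≡0 ≤-refl)
    where
    x≢0 : ¬ x ≡ 0#
    x≢0 x≡0 = x≰0 (≡⇒≤ x≡0)
    xy≡0 : x * y ≡ 0#
    xy≡0 = ≤-antisym xy≤0 (*-nonneg (≰⇒≥ x≰0) (≰⇒≥ y≰0))
    y≡0 : 0# ≡ y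
    y≡0 = begin
      0#                ≡⟨ zeroʳ (x ⁻¹) ⟨
      x ⁻¹ * 0#         ≡⟨ cong (x ⁻¹ *_) xy≡0 ⟨
      x ⁻¹ * (x * y)    ≡⟨ solve 3 (λ a x y → a :* (x :* y) := (x :* a) :* y) refl (x ⁻¹) x y ⟩
      (x * x ⁻¹) * y    ≡⟨ cong (_* y) (*-inverse x≢0) ⟩
      1# * y            ≡⟨ *-identityˡ y ⟩
      y                 ∎
      where open ≡-Reasoning

  *-cancelˡ-≤ : ∀ {c x y} → ¬ c ≤ 0# → c * x ≤ c * y → x ≤ y
  *-cancelˡ-≤ {c} {x} {y} c>0 p with x ≤? y
  ... | yes q = q
  ... | no ¬q = contradiction (≤-by (≤⇒0≤- p)
      (solve 3 (λ c x y → c :* y :- c :* x := 𝟘 :- c :* (x :- y)) refl c x y))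
    (*-pos c>0 (λ r → ¬q (≤-by (≤0⇒0≤- r) (solve 2 (λ x y → :- (x :- y) := y :- x) refl x y))))

  +-pos : ∀ {x y} → ¬ x ≤ 0# → 0# ≤ y → ¬ x + y ≤ 0#
  +-pos {x} {y} x>0 0≤y p = x>0 (≤-trans (≤-by 0≤y (solve 2 (λ x y → y := (x :+ y) :- x) refl x y)) p)

  *-inverse⁺ : ∀ {x} → ¬ x ≤ 0# → x * x ⁻¹ ≡ 1#
  *-inverse⁺ x>0 = *-inverse (λ x≡0 → x>0 (≡⇒≤ x≡0))

  ⁻¹-pos : ∀ {x} → ¬ x ≤ 0# → ¬ x ⁻¹ ≤ 0#
  ⁻¹-pos {x} x>0 p = 1≰0 (≤-trans (≡⇒≤ (sym (*-inverse⁺ x>0))) (≤-by (*-nonneg (≰⇒≥ x>0) (≤0⇒0≤- p))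
    (solve 2 (λ x y → x :* :- y := 𝟘 :- x :* y) refl x (x ⁻¹))))

  ⁻¹-nonneg : ∀ {x} → ¬ x ≤ 0# → 0# ≤ x ⁻¹
  ⁻¹-nonneg x>0 = ≰⇒≥ (⁻¹-pos x>0)

  2>0 : ¬ 2# ≤ 0#
  2>0 = +-pos 1≰0 0≤1

  ½ : K
  ½ = 2# ⁻¹

  2*½ : 2# * ½ ≡ 1#
  2*½ = *-inverse⁺ 2>0

  fromℕ-nonneg : ∀ n → 0# ≤ fromℕ n
  fromℕ-nonneg zero    = ≤-refl
  fromℕ-nonneg (suc n) = +-nonneg 0≤1 (fromℕ-nonneg n)

  fromℕ-pos : ∀ n → ¬ fromℕ (suc n) ≤ 0#
  fromℕ-pos n = +-pos 1≰0 (fromℕ-nonneg n)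

  fromℕ-mono : ∀ {m n} → m ℕ.≤ n → fromℕ m ≤ fromℕ n
  fromℕ-mono {n = n} z≤n = fromℕ-nonneg n
  fromℕ-mono {suc m} {suc n} (s≤s p) = +-monoʳ-≤ 1# (fromℕ-mono {m} {n} p)

  fromℕ-cancel-≤ : ∀ {m n} → fromℕ m ≤ fromℕ n → m ℕ.≤ n
  fromℕ-cancel-≤ {m} {n} p with m ℕ.≤? n
  ... | yes q = q
  ... | no ¬q = contradiction (≤-by (≤⇒0≤- (≤-trans (fromℕ-mono {suc n} {m} (ℕ.≰⇒> ¬q)) p))
      (solve 1 (λ x → x :- (𝟙 :+ x) := 𝟘 :- 𝟙) refl (fromℕ n))) 1≰0

-- Symmetric forms and the spectral gap

module Forms (𝔽 : ArchimedeanField) where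

  open Field 𝔽
  open Algebra.Properties.Semiring.Sum semiring public using (sum; sum-cong-≗; *-distribˡ-sum)
  open Algebra.Properties.CommutativeMonoid.Sum +-commutativeMonoid public using (∑-distrib-+; ∑-comm)

  sum-lin : ∀ {n} x y (f g : Fin n → K) →
            sum (λ i → x * f i + y * g i) ≡ x * sum f + y * sum g
  sum-lin x y f g = trans (∑-distrib-+ (λ i → x * f i) (λ i → y * g i))
    (sym (cong₂ _+_ (*-distribˡ-sum x f) (*-distribˡ-sum y g)))

  sum-mono : ∀ {n} {f g : Fin n → K} → (∀ i → f i ≤ g i) → sum f ≤ sum g
  sum-mono {zero}  p = ≤-refl
  sum-mono {suc n} p = +-mono-≤ (p zero) (sum-mono (λ i → p (suc i)))

  sum-nonneg : ∀ {n} {f : Fin n → K} → (∀ i → 0# ≤ f i) → 0# ≤ sum f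
  sum-nonneg {zero}  p = ≤-refl
  sum-nonneg {suc n} p = +-nonneg (p zero) (sum-nonneg (λ i → p (suc i)))

  term≤sum : ∀ {n} {f : Fin n → K} → (∀ i → 0# ≤ f i) → ∀ i → f i ≤ sum f
  term≤sum {f = f} p zero = ≤-by (sum-nonneg (λ i → p (suc i)))
    (solve 2 (λ x y → y := (x :+ y) :- x) refl (f zero) (sum (λ i → f (suc i))))
  term≤sum {f = f} p (suc i) = ≤-trans (term≤sum (λ i → p (suc i)) i) (≤-by (p zero)
    (solve 2 (λ x y → x := (x :+ y) :- y) refl (f zero) (sum (λ i → f (suc i)))))

  sum≡0⇒term≡0 : ∀ {n} {f : Fin n → K} → (∀ i → 0# ≤ f i) → sum f ≡ 0# → ∀ i → f i ≡ 0#
  sum≡0⇒term≡0 p s i = ≤-antisym (≤-trans (term≤sum p i) (≡⇒≤ s)) (p i)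

  sum-zero : ∀ {n} {f : Fin n → K} → (∀ i → f i ≡ 0#) → sum f ≡ 0#
  sum-zero {zero}  p = refl
  sum-zero {suc n} p = trans (cong₂ _+_ (p zero) (sum-zero (λ i → p (suc i)))) (+-identityˡ 0#)

  Vec# : ℕ → Set
  Vec# n = Fin n → K

  lin : ∀ {n} → K → Vec# n → K → Vec# n → Vec# n
  lin x a y b i = x * a i + y * b i

  record SymForm (n : ℕ) : Set where
    field
      form : Vec# n → Vec# n → K
      form-sym : ∀ a b → form a b ≡ form b a
      form-linˡ : ∀ x a y b c → form (lin x a y b) c ≡ x * form a c + y * form b c

    form-square : ∀ x a y b → form (lin x a y b) (lin x a y b)
                  ≡ x * x * form a a + 2# * x * y * form a b + y * y * form b b
    form-square x a y b = begin
      form l l                                              ≡⟨ form-linˡ x a y b l ⟩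
      x * form a l + y * form b l                           ≡⟨ cong₂ (λ s t → x * s + y * t) (form-sym a l) (form-sym b l) ⟩
      x * form l a + y * form l b                           ≡⟨ cong₂ (λ s t → x * s + y * t) (form-linˡ x a y b a) (form-linˡ x a y b b) ⟩
      x * (x * form a a + y * form b a) + y * (x * form a b + y * form b b)
                                                            ≡⟨ cong (λ s → x * (x * form a a + y * s) + y * (x * form a b + y * form b b)) (form-sym b a) ⟩
      x * (x * form a a + y * form a b) + y * (x * form a b + y * form b b)
                                                            ≡⟨ solve 5 (λ x y p q r → x :* (x :* p :+ y :* q) :+ y :* (x :* q :+ y :* r)
                                                               := x :* x :* p :+ 𝟚 :* x :* y :* q :+ y :* y :* r) refl x y (form a a) (form a b) (form b b) ⟩
      x * x * form a a + 2# * x * y * form a b + y * y * form b b ∎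
      where
      open ≡-Reasoning
      l = lin x a y b

  open SymForm

  -- The vector B(v,w) u − B(u,w) v is orthogonal to w.
  reverse-cauchy-schwarz : ∀ {n} (B : SymForm n) w →
    (∀ a → form B a w ≡ 0# → form B a a ≤ 0#) →
    ∀ u v → 0# ≤ form B v v → form B u u * form B v v ≤ form B u v * form B u v
  reverse-cauchy-schwarz B w neg u v 0≤vv with form B v v ≤? 0#
  ... | yes vv≤0 = ≤-by (sq-nonneg (form B u v)) (trans
      (solve 2 (λ x y → y :* y := y :* y :- x :* 𝟘) refl (form B u u) (form B u v))
      (cong (λ z → form B u v * form B u v - form B u u * z) (≤-antisym 0≤vv vv≤0)))
  -- Completing the square: β²(y² - xz) = (βy - αz)² - z B(βu - αv, βu - αv), where z ≥ 0 and the
  -- last value of B is nonpositive by `key`.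
  ... | no vv≰0 = *-cancelˡ-≤ ββ>0 (≤-by
      (+-nonneg (sq-nonneg (β * y - α * z)) (*-nonneg 0≤vv (≤⇒0≤- key)))
      (solve 5 (λ α β x y z → (β :* y :- α :* z) :* (β :* y :- α :* z)
          :+ z :* (𝟘 :- (β :* β :* x :+ 𝟚 :* β :* (:- α) :* y :+ (:- α) :* (:- α) :* z))
        := β :* β :* (y :* y) :- β :* β :* (x :* z)) refl α β x y z))
    where
    α = form B u w
    β = form B v w
    x = form B u u
    y = form B u v
    z = form B v v
    key : β * β * x + 2# * β * (- α) * y + (- α) * (- α) * z ≤ 0#
    key = subst (_≤ 0#) (form-square B β u (- α) v) (neg (lin β u (- α) v)
      (trans (form-linˡ B β u (- α) v w) (solve 2 (λ α β → β :* α :+ :- α :* β := 𝟘) refl α β)))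
    β≢0 : ¬ β ≡ 0#
    β≢0 β≡0 = vv≰0 (neg v β≡0)
    ββ>0 : ¬ β * β ≤ 0#
    ββ>0 p with β ≤? 0#
    ... | no β≰0 = *-pos β≰0 β≰0 p
    ... | yes β≤0 = *-pos -β>0 -β>0 (subst (_≤ 0#) (solve 1 (λ x → x :* x := :- x :* :- x) refl β) p)
      where
      -β>0 : ¬ - β ≤ 0#
      -β>0 q = β≢0 (≤-antisym β≤0 (subst (0# ≤_) (solve 1 (λ x → :- :- x := x) refl β) (≤0⇒0≤- q)))

  pow1+ : K → ℕ → K
  pow1+ x zero    = 1#
  pow1+ x (suc t) = pow1+ x t * (1# + x)

  bernoulli : ∀ {x} → 0# ≤ x → ∀ t → 1# + fromℕ t * x ≤ pow1+ x t
  bernoulli {x} 0≤x zero = ≡⇒≤ (solve 1 (λ x → 𝟙 :+ 𝟘 :* x := 𝟙) refl x)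
  bernoulli {x} 0≤x (suc t) = ≤-by
    (+-nonneg (*-nonneg (+-nonneg 0≤1 0≤x) (≤⇒0≤- (bernoulli 0≤x t))) (*-nonneg (fromℕ-nonneg t) (*-nonneg 0≤x 0≤x)))
    (solve 3 (λ x n p → (𝟙 :+ x) :* (p :- (𝟙 :+ n :* x)) :+ n :* (x :* x)
       := p :* (𝟙 :+ x) :- (𝟙 :+ (𝟙 :+ n) :* x)) refl x (fromℕ t) (pow1+ x t))

  ·-fromℕ : ∀ n x → n · x ≡ fromℕ n * x
  ·-fromℕ zero    x = sym (zeroˡ x)
  ·-fromℕ (suc n) x = trans (cong (x +_) (·-fromℕ n x))
    (solve 2 (λ x n → x :+ n :* x := (𝟙 :+ n) :* x) refl x (fromℕ n))

  -- A self-adjoint N with N ≤ N² has no spectrum in (0,1); a spectral gap below 1 therefore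
  -- pushes the spectrum on the orthogonal complement of the top eigenvector below 0.
  -- Without eigenvalues: a bound N ≤ c < 1 improves to N ≤ c / (1 + η) with η independent of c.
  module Gap {n} (G Q : SymForm n) (N : Vec# n → Vec# n) (Orth : Vec# n → Set)
    (Orth-lin : ∀ x a y b → Orth a → Orth b → Orth (lin x a y b))
    (Orth-N   : ∀ a → Orth a → Orth (N a))
    (G-nonneg : ∀ a → 0# ≤ form G a a)
    (GN≡Q     : ∀ a b → form G (N a) b ≡ form Q a b)
    (Q≤GNN    : ∀ a → form Q a a ≤ form G (N a) (N a))
    (0≤Q+G    : ∀ a → 0# ≤ form Q a a + form G a a)
    (ε : K) (ε>0 : ¬ ε ≤ 0#) (ε≤1 : ε ≤ 1#)
    (gap : ∀ a → Orth a → form Q a a ≤ (1# - ε) * form G a a)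
    where

    private
      η : K
      η = ½ * (ε * ε)

      2*η : 2# * η ≡ ε * ε
      2*η = trans (sym (*-assoc _ _ _)) (trans (cong (_* (ε * ε)) 2*½) (*-identityˡ _))

      η>0 : ¬ η ≤ 0#
      η>0 = *-pos (⁻¹-pos 2>0) (*-pos ε>0 ε>0)

      0≤ε : 0# ≤ ε
      0≤ε = ≰⇒≥ ε>0

      0≤γ : 0# ≤ 1# - ε
      0≤γ = ≤⇒0≤- ε≤1

      1≤pow1+ : ∀ t → 1# ≤ pow1+ η t
      1≤pow1+ t = ≤-trans (≤-by (*-nonneg (fromℕ-nonneg t) (≰⇒≥ η>0))
        (solve 1 (λ x → x := (𝟙 :+ x) :- 𝟙) refl (fromℕ t * η))) (bernoulli (≰⇒≥ η>0) t)

      -- Test the bound on b = 2a + εNa and write mᵢ = ⟨a, Nⁱa⟩, γ = 1 - ε. The first-order terms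
      -- gain 4ε(κm₂ - γm₁) ≥ 4ε(κ - γ)m₂, because m₁ ≤ m₂; the second-order terms lose at most ε²(κ
      -- + γ)m₂, because m₃ ≥ -m₂. As κ - γ ≥ ε, this pays for the increment 4κηm₁ = 2κε²m₁, which
      -- is why η = ε²/2. The surplus is εm₂((1 + 3γ)(κ - 1) + ε²).
      improve : ∀ κ → 1# ≤ κ → (∀ a → Orth a → κ * form Q a a ≤ (1# - ε) * form G a a) →
                ∀ a → Orth a → κ * (1# + η) * form Q a a ≤ (1# - ε) * form G a a
      improve κ 1≤κ bound a oa = *-cancelˡ-≤ 4>0 (≤-by certificate (begin
        _ ≡⟨ solve 6 (λ ε κ m0 m1 m2 m3 → let γ = 𝟙 :- ε in
               γ :* (𝟚 :* 𝟚 :* m0 :+ 𝟚 :* 𝟚 :* ε :* m1 :+ ε :* ε :* m2)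
               :- κ :* (𝟚 :* 𝟚 :* m1 :+ 𝟚 :* 𝟚 :* ε :* m2 :+ ε :* ε :* m3)
               :+ ε :* ε :* κ :* (m3 :+ m2)
               :+ 𝟚 :* ε :* ε :* κ :* (m2 :- m1)
               :+ 𝟚 :* 𝟚 :* ε :* γ :* (m2 :- m1)
               :+ m2 :* (ε :* ((𝟙 :+ (𝟙 :+ 𝟚) :* γ) :* (κ :- 𝟙) :+ ε :* ε))
               := 𝟚 :* 𝟚 :* (γ :* m0) :- 𝟚 :* 𝟚 :* κ :* m1 :- 𝟚 :* κ :* m1 :* (ε :* ε))
             refl ε κ m0 m1 m2 m3 ⟩
        4# * (γ * m0) - 4# * κ * m1 - 2# * κ * m1 * (ε * ε) ≡⟨ cong (λ z → 4# * (γ * m0) - 4# * κ * m1 - 2# * κ * m1 * z) 2*η ⟨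
        4# * (γ * m0) - 4# * κ * m1 - 2# * κ * m1 * (2# * η)
             ≡⟨ solve 4 (λ γm κ m1 η → 𝟚 :* 𝟚 :* γm :- 𝟚 :* 𝟚 :* κ :* m1 :- 𝟚 :* κ :* m1 :* (𝟚 :* η)
                  := 𝟚 :* 𝟚 :* γm :- 𝟚 :* 𝟚 :* (κ :* (𝟙 :+ η) :* m1)) refl (γ * m0) κ m1 η ⟩
        4# * (γ * m0) - 4# * (κ * (1# + η) * m1) ∎))
        where
        open ≡-Reasoning
        γ = 1# - ε
        4# = 2# * 2#
        4>0 : ¬ 4# ≤ 0#
        4>0 = *-pos 2>0 2>0
        m0 = form G a a
        m1 = form Q a a
        m2 = form G (N a) (N a)
        m3 = form Q (N a) (N a)
        b = lin 2# a ε (N a)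
        0≤κ : 0# ≤ κ
        0≤κ = ≤-trans 0≤1 1≤κ
        m1≤m2 : 0# ≤ m2 - m1
        m1≤m2 = ≤⇒0≤- (Q≤GNN a)
        0≤m3+m2 : 0# ≤ m3 + m2
        0≤m3+m2 = 0≤Q+G (N a)
        GaNa : form G a (N a) ≡ m1
        GaNa = trans (form-sym G a (N a)) (GN≡Q a a)
        QaNa : form Q a (N a) ≡ m2
        QaNa = sym (GN≡Q a (N a))
        at-b : κ * (2# * 2# * m1 + 2# * 2# * ε * m2 + ε * ε * m3)
             ≤ (1# - ε) * (2# * 2# * m0 + 2# * 2# * ε * m1 + ε * ε * m2)
        at-b = subst₂ (λ p q → κ * p ≤ (1# - ε) * q)
          (trans (form-square Q 2# a ε (N a)) (cong (λ z → 2# * 2# * m1 + 2# * 2# * ε * z + ε * ε * m3) QaNa))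
          (trans (form-square G 2# a ε (N a)) (cong (λ z → 2# * 2# * m0 + 2# * 2# * ε * z + ε * ε * m2) GaNa))
          (bound b (Orth-lin 2# a ε (N a) oa (Orth-N a oa)))

        0≤2εεκ : 0# ≤ 2# * ε * ε * κ
        0≤2εεκ = *-nonneg (*-nonneg (*-nonneg (≰⇒≥ 2>0) 0≤ε) 0≤ε) 0≤κ
        certificate : 0# ≤ γ * (2# * 2# * m0 + 2# * 2# * ε * m1 + ε * ε * m2)
                         - κ * (2# * 2# * m1 + 2# * 2# * ε * m2 + ε * ε * m3)
                         + ε * ε * κ * (m3 + m2) + 2# * ε * ε * κ * (m2 - m1) + 2# * 2# * ε * γ * (m2 - m1)
                         + m2 * (ε * ((1# + (1# + 2#) * γ) * (κ - 1#) + ε * ε))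
        certificate =
          +-nonneg (+-nonneg (+-nonneg (+-nonneg (≤⇒0≤- at-b)
            (*-nonneg (*-nonneg (*-nonneg 0≤ε 0≤ε) 0≤κ) 0≤m3+m2))
            (*-nonneg 0≤2εεκ m1≤m2))
            (*-nonneg (*-nonneg (*-nonneg (≰⇒≥ 4>0) 0≤ε) 0≤γ) m1≤m2))
            (*-nonneg (G-nonneg (N a)) (*-nonneg 0≤ε (+-nonneg
              (*-nonneg (+-nonneg 0≤1 (*-nonneg (+-nonneg 0≤1 (≰⇒≥ 2>0)) 0≤γ)) (≤⇒0≤- 1≤κ))
              (*-nonneg 0≤ε 0≤ε))))

      bounds : ∀ t a → Orth a → pow1+ η t * form Q a a ≤ (1# - ε) * form G a a
      bounds zero    a oa = subst (_≤ (1# - ε) * form G a a) (sym (*-identityˡ _)) (gap a oa)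
      bounds (suc t) = improve (pow1+ η t) (1≤pow1+ t) (bounds t)

    -- A positive value q would keep (1 + η)^t q below a fixed number for every t, while by
    -- Bernoulli it is at least (1 + tη) q.
    Q-nonpos : ∀ a → Orth a → form Q a a ≤ 0#
    Q-nonpos a oa with form Q a a ≤? 0#
    ... | yes p = p
    ... | no q>0 with archimedean (η * form Q a a) ((1# - ε) * form G a a) (*-pos η>0 q>0)
    ...   | t , p = ≤-by
      (+-nonneg (+-nonneg (≤⇒0≤- p) (*-nonneg (≰⇒≥ q>0) (≤⇒0≤- (bernoulli (≰⇒≥ η>0) t)))) (≤⇒0≤- (bounds t a oa)))
      (trans (cong (λ z → ((z - r) + q * (P - (1# + fromℕ t * η))) + (r - P * q)) (·-fromℕ t (η * q)))
       (solve 5 (λ q P n η r → ((n :* (η :* q) :- r) :+ q :* (P :- (𝟙 :+ n :* η))) :+ (r :- P :* q)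
           := 𝟘 :- q) refl q P (fromℕ t) η r))
      where
      q = form Q a a
      P = pow1+ η t
      r = (1# - ε) * form G a a

-- Bilinear forms of matrices, and trickling down along the all-ones vector

module Matrices (𝔽 : ArchimedeanField) where

  open Field 𝔽
  open Forms 𝔽
  open SymForm

  Mat : ℕ → Set
  Mat n = Fin n → Fin n → K

  sum² : ∀ {m n} → (Fin m → Fin n → K) → K
  sum² f = sum (λ i → sum (f i))

  sum²-cong : ∀ {m n} {f g : Fin m → Fin n → K} → (∀ i j → f i j ≡ g i j) → sum² f ≡ sum² g
  sum²-cong p = sum-cong-≗ (λ i → sum-cong-≗ (p i))

  sum²-lin : ∀ {m n} x y (f g : Fin m → Fin n → K) →
             sum² (λ i j → x * f i j + y * g i j) ≡ x * sum² f + y * sum² g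
  sum²-lin x y f g = trans (sum-cong-≗ (λ i → sum-lin x y (f i) (g i)))
                           (sum-lin x y (λ i → sum (f i)) (λ i → sum (g i)))

  bil : ∀ {n} → Mat n → Vec# n → Vec# n → K
  bil A u v = sum² (λ i j → A i j * (u i * v j))

  matForm : ∀ {n} (A : Mat n) → (∀ i j → A i j ≡ A j i) → SymForm n
  matForm A A-sym = record
    { form = bil A
    ; form-sym = λ a b → trans (∑-comm (λ i j → A i j * (a i * b j)))
        (sum²-cong (λ i j → cong₂ _*_ (A-sym j i) (*-comm (a j) (b i))))
    ; form-linˡ = λ x a y b c → trans
        (sum²-cong (λ i j → solve 6 (λ A x a y b c → A :* ((x :* a :+ y :* b) :* c)
          := x :* (A :* (a :* c)) :+ y :* (A :* (b :* c))) refl (A i j) x (a i) y (b i) (c j)))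
        (sum²-lin x y (λ i j → A i j * (a i * c j)) (λ i j → A i j * (b i * c j)))
    }

  bil-nonneg : ∀ {n} {A : Mat n} {u v} → (∀ i j → 0# ≤ A i j) → (∀ i → 0# ≤ u i) → (∀ i → 0# ≤ v i) →
               0# ≤ bil A u v
  bil-nonneg pA pu pv = sum-nonneg (λ i → sum-nonneg (λ j → *-nonneg (pA i j) (*-nonneg (pu i) (pv j))))

  bil-cong : ∀ {n} {A B : Mat n} {u u′ v v′} → (∀ i j → A i j ≡ B i j) → (∀ i → u i ≡ u′ i) → (∀ i → v i ≡ v′ i) →
             bil A u v ≡ bil B u′ v′
  bil-cong pA pu pv = sum²-cong (λ i j → cong₂ _*_ (pA i j) (cong₂ _*_ (pu i) (pv j)))

  sum-bil : ∀ {m n} (c : Fin m → K) (T : Fin m → Mat n) u v →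
            bil (λ i j → sum (λ k → c k * T k i j)) u v ≡ sum (λ k → c k * bil (T k) u v)
  sum-bil c T u v = begin
    sum² (λ i j → sum (λ k → c k * T k i j) * (u i * v j))
      ≡⟨ sum²-cong (λ i j → trans (*-comm _ _) (trans (*-distribˡ-sum (u i * v j) (λ k → c k * T k i j))
           (sum-cong-≗ (λ k → solve 3 (λ c t x → x :* (c :* t) := c :* (t :* x)) refl (c k) (T k i j) (u i * v j))))) ⟩
    sum (λ i → sum² (λ j k → c k * (T k i j * (u i * v j))))
      ≡⟨ sum-cong-≗ (λ i → ∑-comm (λ j k → c k * (T k i j * (u i * v j)))) ⟩
    sum² (λ i k → sum (λ j → c k * (T k i j * (u i * v j))))
      ≡⟨ ∑-comm (λ i k → sum (λ j → c k * (T k i j * (u i * v j)))) ⟩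
    sum² (λ k i → sum (λ j → c k * (T k i j * (u i * v j))))
      ≡⟨ sum²-cong (λ k i → sym (*-distribˡ-sum (c k) (λ j → T k i j * (u i * v j)))) ⟩
    sum² (λ k i → c k * sum (λ j → T k i j * (u i * v j)))
      ≡⟨ sum-cong-≗ (λ k → sym (*-distribˡ-sum (c k) (λ i → sum (λ j → T k i j * (u i * v j))))) ⟩
    sum (λ k → c k * bil (T k) u v) ∎
    where open ≡-Reasoning

  -- Conjugation by diag(w). The substitution u → wu reduces trickling down along a positive w to
  -- the all-ones direction.
  scale : ∀ {n} → Vec# n → Mat n → Mat n
  scale w A i j = w i * w j * A i j

  bil-scale : ∀ {n} (w : Vec# n) A u v → bil (scale w A) u v ≡ bil A (λ i → w i * u i) (λ j → w j * v j)
  bil-scale w A u v = sum²-cong (λ i j → solve 5 (λ w w′ a u v → w :* w′ :* a :* (u :* v)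
    := a :* ((w :* u) :* (w′ :* v))) refl (w i) (w j) (A i j) (u i) (v j))

  𝟏 : ∀ {n} → Vec# n
  𝟏 _ = 1#

  -- `T` is a totally symmetric tensor, to be thought of as third derivatives, and `A` is its
  -- contraction with the all-ones vector. With `d` the row sums of `A`, the operator `N` = D⁻¹A is
  -- the random walk on the weighted graph `A`: it is self-adjoint for the inner product `G`
  -- weighted by `d`, and fixes the all-ones vector up to coordinates of weight 0. The hypothesis
  -- `gap` is a Doeblin condition: from each vertex of positive weight the walk moves to vertex 0
  -- with probability at least ε.
  module TrickleUnit {n} (T : Fin (suc n) → Mat (suc n))
    (T-sym : ∀ k i j → T k i j ≡ T k j i) (T-sym′ : ∀ k i j → T k i j ≡ T i k j)
    (T-nonneg : ∀ k i j → 0# ≤ T k i j)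
    (T-hyp : ∀ k u → bil (T k) u u * bil (T k) 𝟏 𝟏 ≤ bil (T k) u 𝟏 * bil (T k) u 𝟏)
    (ε : K) (ε>0 : ¬ ε ≤ 0#) (ε≤1 : ε ≤ 1#)
    (gap : ∀ i → ε * bil (T i) 𝟏 𝟏 ≤ sum (λ k → T k i zero))
    where

    private
      A : Mat (suc n)
      A i j = sum (λ k → T k i j)

      A-sym : ∀ i j → A i j ≡ A j i
      A-sym i j = sum-cong-≗ (λ k → T-sym k i j)

      A-nonneg : ∀ i j → 0# ≤ A i j
      A-nonneg i j = sum-nonneg (λ k → T-nonneg k i j)

      Q : SymForm (suc n)
      Q = matForm A A-sym

      apply : Vec# (suc n) → Vec# (suc n)
      apply a k = sum (λ j → A k j * a j)

      d : Vec# (suc n)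
      d k = bil (T k) 𝟏 𝟏

      -- Total symmetry allows the index paired with the all-ones vector to be the one contracted in
      -- `A`. This links the single forms `T k` of `T-hyp` to the operator `N`.
      apply-T : ∀ a k → bil (T k) a 𝟏 ≡ apply a k
      apply-T a k = sum-cong-≗ (λ i → begin
        sum (λ j → T k i j * (a i * 1#)) ≡⟨ sum-cong-≗ (λ j → trans (cong (_* (a i * 1#))
           (trans (T-sym k i j) (T-sym′ k j i))) (solve 2 (λ t a → t :* (a :* 𝟙) := a :* t) refl (T j k i) (a i))) ⟩
        sum (λ j → a i * T j k i) ≡⟨ *-distribˡ-sum (a i) (λ j → T j k i) ⟨
        a i * A k i               ≡⟨ *-comm (a i) (A k i) ⟩
        A k i * a i               ∎)
        where open ≡-Reasoning

      d-sum : ∀ k → d k ≡ sum (A k)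
      d-sum k = trans (apply-T 𝟏 k) (sum-cong-≗ (λ j → *-identityʳ (A k j)))

      d-nonneg : ∀ k → 0# ≤ d k
      d-nonneg k = bil-nonneg (T-nonneg k) (λ _ → 0≤1) (λ _ → 0≤1)

      T-zero : ∀ k → d k ≡ 0# → ∀ i j → T k i j ≡ 0#
      T-zero k dk≡0 i j = trans (sym (trans (cong (T k i j *_) (*-identityˡ 1#)) (*-identityʳ _)))
        (sum≡0⇒term≡0 (λ j → term j) (sum≡0⇒term≡0 (λ i → sum-nonneg (λ j → *-nonneg (T-nonneg k i j) (*-nonneg 0≤1 0≤1))) dk≡0 i) j)
        where
        term : ∀ j → 0# ≤ T k i j * (1# * 1#)
        term j = *-nonneg (T-nonneg k i j) (*-nonneg 0≤1 0≤1)

      bil-zero : ∀ k → d k ≡ 0# → ∀ u v → bil (T k) u v ≡ 0#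
      bil-zero k dk≡0 u v = sum-zero (λ i → sum-zero (λ j →
        trans (cong (_* (u i * v j)) (T-zero k dk≡0 i j)) (zeroˡ _)))

      N : Vec# (suc n) → Vec# (suc n)
      N a k = d k ⁻¹ * apply a k

      zero-or-pos : ∀ k → d k ≡ 0# ⊎ ¬ d k ≤ 0#
      zero-or-pos k with d k ≤? 0#
      ... | yes p = inj₁ (≤-antisym p (d-nonneg k))
      ... | no ¬p = inj₂ ¬p

      -- At a vertex of weight 0 the whole matrix `T k` vanishes, hence so do both sides, whatever
      -- value the inverse of 0 has.
      d*N : ∀ a k → d k * N a k ≡ apply a k
      d*N a k with zero-or-pos k
      ... | inj₁ dk≡0 = trans (trans (cong (_* N a k) dk≡0) (zeroˡ _)) (trans (sym (bil-zero k dk≡0 a 𝟏)) (apply-T a k))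
      ... | inj₂ dk>0 = trans (sym (*-assoc _ _ _))
        (trans (cong (_* apply a k) (*-inverse⁺ dk>0)) (*-identityˡ _))

      G : SymForm (suc n)
      G = record
        { form = λ a b → sum (λ k → d k * (a k * b k))
        ; form-sym = λ a b → sum-cong-≗ (λ k → cong (d k *_) (*-comm (a k) (b k)))
        ; form-linˡ = λ x a y b c → trans
            (sum-cong-≗ (λ k → solve 6 (λ d x a y b c → d :* ((x :* a :+ y :* b) :* c)
              := x :* (d :* (a :* c)) :+ y :* (d :* (b :* c))) refl (d k) x (a k) y (b k) (c k)))
            (sum-lin x y (λ k → d k * (a k * c k)) (λ k → d k * (b k * c k)))
        }

      apply-dot : ∀ a b → sum (λ k → apply a k * b k) ≡ bil A b a
      apply-dot a b = sum-cong-≗ (λ k → trans (*-comm _ _) (trans (*-distribˡ-sum (b k) (λ j → A k j * a j))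
        (sum-cong-≗ (λ j → solve 3 (λ b A a → b :* (A :* a) := A :* (b :* a)) refl (b k) (A k j) (a j)))))

      GN≡Q : ∀ a b → form G (N a) b ≡ bil A a b
      GN≡Q a b = trans (sum-cong-≗ (λ k → trans (sym (*-assoc (d k) (N a k) (b k))) (cong (_* b k) (d*N a k))))
                       (trans (apply-dot a b) (form-sym Q b a))

      G-nonneg : ∀ a → 0# ≤ form G a a
      G-nonneg a = sum-nonneg (λ k → *-nonneg (d-nonneg k) (sq-nonneg (a k)))

      A-bil : ∀ u v → bil A u v ≡ sum (λ k → bil (T k) u v)
      A-bil u v = trans (bil-cong {u = u} {v = v} (λ i j → sum-cong-≗ (λ k → sym (*-identityˡ (T k i j)))) (λ _ → refl) (λ _ → refl))
        (trans (sum-bil 𝟏 T u v) (sum-cong-≗ (λ k → *-identityˡ (bil (T k) u v))))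

      -- Summand by summand this is `T-hyp` divided by d_k, since T_k(a, 𝟏) = d_k (Na)_k.
      Q≤GNN : ∀ a → bil A a a ≤ form G (N a) (N a)
      Q≤GNN a = ≤-trans (≡⇒≤ (A-bil a a)) (sum-mono term)
        where
        term : ∀ k → bil (T k) a a ≤ d k * (N a k * N a k)
        term k with zero-or-pos k
        ... | inj₁ dk≡0 = subst (_≤ d k * (N a k * N a k)) (sym (bil-zero k dk≡0 a a))
                            (*-nonneg (d-nonneg k) (sq-nonneg (N a k)))
        ... | inj₂ dk>0 = *-cancelˡ-≤ dk>0 (subst₂ _≤_ (*-comm _ _) (begin
            bil (T k) a 𝟏 * bil (T k) a 𝟏 ≡⟨ cong (λ z → z * z) (trans (apply-T a k) (sym (d*N a k))) ⟩
            (d k * N a k) * (d k * N a k) ≡⟨ solve 2 (λ d n → (d :* n) :* (d :* n) := d :* (d :* (n :* n))) refl (d k) (N a k) ⟩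
            d k * (d k * (N a k * N a k)) ∎) (T-hyp k a))
          where open ≡-Reasoning

      Orth : Vec# (suc n) → Set
      Orth a = form G a 𝟏 ≡ 0#

      Orth-lin : ∀ x a y b → Orth a → Orth b → Orth (lin x a y b)
      Orth-lin x a y b oa ob = trans (form-linˡ G x a y b 𝟏) (trans (cong₂ (λ s t → x * s + y * t) oa ob)
        (solve 2 (λ x y → x :* 𝟘 :+ y :* 𝟘 := 𝟘) refl x y))

      A-𝟏 : ∀ a → bil A a 𝟏 ≡ form G a 𝟏
      A-𝟏 a = sum-cong-≗ (λ i → trans (sum-cong-≗ (λ j → *-comm (A i j) (a i * 1#)))
        (trans (sym (*-distribˡ-sum (a i * 1#) (A i))) (trans (*-comm _ _) (cong (_* (a i * 1#)) (sym (d-sum i))))))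

      Orth-N : ∀ a → Orth a → Orth (N a)
      Orth-N a oa = trans (GN≡Q a 𝟏) (trans (A-𝟏 a) oa)

      -- Both diagonal parts collapse to G because the row sums of `A` are `d`. At s = 1
      -- nonnegativity gives N ≥ -1; at s = -1 the left side is the Dirichlet energy 2(G - Q), which
      -- is bounded below in `half-gap`.
      dirichlet : ∀ s a → sum² (λ i j → A i j * ((a i + s * a j) * (a i + s * a j)))
                  ≡ (1# + s * s) * form G a a + 2# * s * bil A a a
      dirichlet s a = begin
        sum² (λ i j → A i j * ((a i + s * a j) * (a i + s * a j)))
          ≡⟨ sum²-cong (λ i j → solve 4 (λ A a b s → A :* ((a :+ s :* b) :* (a :+ s :* b))
               := 𝟙 :* (A :* (a :* a)) :+ s :* (𝟙 :* (s :* (A :* (b :* b))) :+ 𝟚 :* (A :* (a :* b)))) refl (A i j) (a i) (a j) s) ⟩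
        sum² (λ i j → 1# * (A i j * (a i * a i)) + s * (1# * (s * (A i j * (a j * a j))) + 2# * (A i j * (a i * a j))))
          ≡⟨ sum²-lin 1# s (λ i j → A i j * (a i * a i)) (λ i j → 1# * (s * (A i j * (a j * a j))) + 2# * (A i j * (a i * a j))) ⟩
        1# * R + s * sum² (λ i j → 1# * (s * (A i j * (a j * a j))) + 2# * (A i j * (a i * a j)))
          ≡⟨ cong (λ z → 1# * R + s * z) (sum²-lin 1# 2# (λ i j → s * (A i j * (a j * a j))) (λ i j → A i j * (a i * a j))) ⟩
        1# * R + s * (1# * sum² (λ i j → s * (A i j * (a j * a j))) + 2# * q)
          ≡⟨ cong (λ z → 1# * R + s * (1# * z + 2# * q)) (begin
               sum² (λ i j → s * (A i j * (a j * a j))) ≡⟨ sum-cong-≗ (λ i → sym (*-distribˡ-sum s (λ j → A i j * (a j * a j)))) ⟩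
               sum (λ i → s * sum (λ j → A i j * (a j * a j))) ≡⟨ *-distribˡ-sum s (λ i → sum (λ j → A i j * (a j * a j))) ⟨
               s * sum² (λ i j → A i j * (a j * a j)) ≡⟨ cong (s *_) (∑-comm (λ i j → A i j * (a j * a j))) ⟩
               s * sum² (λ j i → A i j * (a j * a j)) ≡⟨ cong (s *_) (sum²-cong (λ j i → cong (_* (a j * a j)) (A-sym i j))) ⟩
               s * R ∎) ⟩
        1# * R + s * (1# * (s * R) + 2# * q) ≡⟨ cong (λ z → 1# * z + s * (1# * (s * z) + 2# * q)) R≡G ⟩
        1# * g + s * (1# * (s * g) + 2# * q)
          ≡⟨ solve 3 (λ g q s → 𝟙 :* g :+ s :* (𝟙 :* (s :* g) :+ 𝟚 :* q) := (𝟙 :+ s :* s) :* g :+ 𝟚 :* s :* q) refl g q s ⟩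
        (1# + s * s) * g + 2# * s * q ∎
        where
        open ≡-Reasoning
        g = form G a a
        q = bil A a a
        R = sum² (λ i j → A i j * (a i * a i))
        R≡G : R ≡ g
        R≡G = sum-cong-≗ (λ i → trans (sum-cong-≗ (λ j → *-comm (A i j) (a i * a i)))
          (trans (sym (*-distribˡ-sum (a i * a i) (A i))) (trans (*-comm _ _) (cong (_* (a i * a i)) (sym (d-sum i))))))

      0≤Q+G : ∀ a → 0# ≤ bil A a a + form G a a
      0≤Q+G a = *-cancelˡ-≤ 2>0 (subst₂ _≤_ (sym (zeroʳ 2#))
        (trans (dirichlet 1# a) (solve 2 (λ g q → (𝟙 :+ 𝟙 :* 𝟙) :* g :+ 𝟚 :* 𝟙 :* q := 𝟚 :* (q :+ g)) refl (form G a a) (bil A a a)))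
        (sum-nonneg (λ i → sum-nonneg (λ j → *-nonneg (A-nonneg i j) (sq-nonneg (a i + 1# * a j))))))

      -- Only the edges to the vertex 0 are used, and these alone give the gap ε / 2.
      half-gap : ∀ a → Orth a → bil A a a ≤ (1# - ½ * ε) * form G a a
      half-gap a oa = *-cancelˡ-≤ 2>0 (≤-by (+-nonneg (≤⇒0≤- below) (*-nonneg (≰⇒≥ ε>0) 0≤a₀²D)) (begin
        ((1# + - 1# * - 1#) * g + 2# * - 1# * q - ε * (1# * g + s * (2# * form G a 𝟏 + s * D))) + ε * (s * s * D)
          ≡⟨ cong (λ z → ((1# + - 1# * - 1#) * g + 2# * - 1# * q - ε * (1# * g + s * (2# * z + s * D))) + ε * (s * s * D)) oa ⟩
        ((1# + - 1# * - 1#) * g + 2# * - 1# * q - ε * (1# * g + s * (2# * 0# + s * D))) + ε * (s * s * D)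
          ≡⟨ solve 5 (λ g q ε s D → ((𝟙 :+ :- 𝟙 :* :- 𝟙) :* g :+ 𝟚 :* :- 𝟙 :* q :- ε :* (𝟙 :* g :+ s :* (𝟚 :* 𝟘 :+ s :* D))) :+ ε :* (s :* s :* D)
               := 𝟚 :* g :- 𝟙 :* ε :* g :- 𝟚 :* q) refl g q ε s D ⟩
        2# * g - 1# * ε * g - 2# * q
          ≡⟨ cong (λ z → 2# * g - z * ε * g - 2# * q) (sym 2*½) ⟩
        2# * g - (2# * ½) * ε * g - 2# * q
          ≡⟨ solve 4 (λ h g q ε → 𝟚 :* g :- (𝟚 :* h) :* ε :* g :- 𝟚 :* q := 𝟚 :* ((𝟙 :- h :* ε) :* g) :- 𝟚 :* q) refl (½) g q ε ⟩
        2# * ((1# - ½ * ε) * g) - 2# * q ∎))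
        where
        open ≡-Reasoning
        g = form G a a
        q = bil A a a
        s = - a zero
        D = form G 𝟏 𝟏
        0≤a₀²D : 0# ≤ s * s * D
        0≤a₀²D = *-nonneg (sq-nonneg s) (G-nonneg 𝟏)
        column : ∀ i → ε * (d i * ((a i + s) * (a i + s))) ≤ sum (λ j → A i j * ((a i + - 1# * a j) * (a i + - 1# * a j)))
        column i = ≤-trans
          (≤-by (*-nonneg (sq-nonneg (a i + s)) (≤⇒0≤- (gap i)))
            (solve 5 (λ d ε x y A → (x :+ :- y) :* (x :+ :- y) :* (A :- ε :* d)
              := A :* ((x :+ :- 𝟙 :* y) :* (x :+ :- 𝟙 :* y)) :- ε :* (d :* ((x :+ :- y) :* (x :+ :- y)))) refl (d i) ε (a i) (a zero) (A i zero)))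
          (term≤sum (λ j → *-nonneg (A-nonneg i j) (sq-nonneg (a i + - 1# * a j))) zero)
        -- Since `a` is orthogonal to the all-ones vector, Σ dᵢ(aᵢ - a₀)² = G(a, a) + a₀²D ≥ G(a,
        -- a), so the energy 2(G - Q) is at least εG.
        below : ε * (1# * g + s * (2# * form G a 𝟏 + s * D)) ≤ (1# + - 1# * - 1#) * g + 2# * - 1# * q
        below = subst₂ _≤_
          (trans (sym (*-distribˡ-sum ε (λ i → d i * ((a i + s) * (a i + s))))) (cong (ε *_) (begin
            sum (λ i → d i * ((a i + s) * (a i + s)))
              ≡⟨ sum-cong-≗ (λ i → solve 3 (λ d a s → d :* ((a :+ s) :* (a :+ s))
                   := 𝟙 :* (d :* (a :* a)) :+ s :* (𝟚 :* (d :* (a :* 𝟙)) :+ s :* (d :* (𝟙 :* 𝟙)))) refl (d i) (a i) s) ⟩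
            _ ≡⟨ sum-lin 1# s (λ i → d i * (a i * a i)) (λ i → 2# * (d i * (a i * 1#)) + s * (d i * (1# * 1#))) ⟩
            _ ≡⟨ cong (λ z → 1# * g + s * z) (sum-lin 2# s (λ i → d i * (a i * 1#)) (λ i → d i * (1# * 1#))) ⟩
            1# * g + s * (2# * form G a 𝟏 + s * D) ∎)))
          (dirichlet (- 1#) a)
          (sum-mono column)

      ½ε≤1 : ½ * ε ≤ 1#
      ½ε≤1 = *-cancelˡ-≤ 2>0 (≤-trans (≡⇒≤ (trans (sym (*-assoc _ _ _)) (cong (_* ε) 2*½)))
        (≤-by (+-nonneg (≤⇒0≤- ε≤1) 0≤1) (solve 1 (λ ε → (𝟙 :- ε) :+ 𝟙 := 𝟚 :* 𝟙 :- 𝟙 :* ε) refl ε)))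

    nonpos-on-orth : ∀ a → bil A a 𝟏 ≡ 0# → bil A a a ≤ 0#
    nonpos-on-orth a oa = Q-nonpos a (trans (sym (A-𝟏 a)) oa)
      where open Gap G Q N Orth Orth-lin Orth-N G-nonneg GN≡Q Q≤GNN 0≤Q+G
                     (½ * ε) (*-pos (⁻¹-pos 2>0) ε>0) ½ε≤1 half-gap

-- Trickling down of the Lorentzian property

module Lorentzian (𝔽 : ArchimedeanField) where

  open Field 𝔽
  open Forms 𝔽
  open Matrices 𝔽
  open SymForm

  bil-* : ∀ {n} c (A : Mat n) u v → bil (λ i j → c * A i j) u v ≡ c * bil A u v
  bil-* c A u v = trans (sum²-cong (λ i j → *-assoc c (A i j) (u i * v j)))
    (trans (sum-cong-≗ (λ i → sym (*-distribˡ-sum c (λ j → A i j * (u i * v j)))))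
      (sym (*-distribˡ-sum c (λ i → sum (λ j → A i j * (u i * v j))))))

  -- The rescaled tensor with entries w_k w_i w_j T_kij is again totally symmetric and nonnegative,
  -- which reduces the claim to `TrickleUnit`.
  module Trickle {n} (T : Fin (suc n) → Mat (suc n))
    (T-sym : ∀ k i j → T k i j ≡ T k j i) (T-sym′ : ∀ k i j → T k i j ≡ T i k j)
    (T-nonneg : ∀ k i j → 0# ≤ T k i j)
    (T-dom : ∀ k i j → T k i j ≤ T k zero j)
    (w : Vec# (suc n)) (w>0 : ∀ i → ¬ w i ≤ 0#)
    (T-hyp : ∀ k u → bil (T k) u u * bil (T k) w w ≤ bil (T k) u w * bil (T k) u w)
    where

    private
      H : Mat (suc n)
      H i j = sum (λ k → w k * T k i j)

      S : Fin (suc n) → Mat (suc n)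
      S k i j = w k * scale w (T k) i j

      0≤w : ∀ i → 0# ≤ w i
      0≤w i = ≰⇒≥ (w>0 i)

      bil-S : ∀ k u v → bil (S k) u v ≡ w k * bil (T k) (λ i → w i * u i) (λ j → w j * v j)
      bil-S k u v = trans (bil-* (w k) (scale w (T k)) u v) (cong (w k *_) (bil-scale w (T k) u v))

      w𝟏 : ∀ i → w i * 1# ≡ w i
      w𝟏 i = *-identityʳ (w i)

      S-hyp : ∀ k u → bil (S k) u u * bil (S k) 𝟏 𝟏 ≤ bil (S k) u 𝟏 * bil (S k) u 𝟏
      S-hyp k u = subst₂ _≤_
        (trans (solve 3 (λ w x y → w :* w :* (x :* y) := (w :* x) :* (w :* y)) refl (w k) (bil (T k) u′ u′) (bil (T k) w w))
          (sym (cong₂ _*_ (bil-S k u u) (trans (bil-S k 𝟏 𝟏) (cong (w k *_) (bil-cong {A = T k} (λ _ _ → refl) w𝟏 w𝟏))))))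
        (trans (solve 2 (λ w x → w :* w :* (x :* x) := (w :* x) :* (w :* x)) refl (w k) (bil (T k) u′ w))
          (sym (cong (λ z → z * z) (trans (bil-S k u 𝟏) (cong (w k *_) (bil-cong {A = T k} {u = u′} (λ _ _ → refl) (λ _ → refl) w𝟏))))))
        (*-monoˡ-≤ (*-nonneg (0≤w k) (0≤w k)) (T-hyp k u′))
        where
        u′ : Vec# (suc n)
        u′ i = w i * u i

      W : K
      W = sum w

      W>0 : ¬ W ≤ 0#
      W>0 p = w>0 zero (≤-trans (term≤sum 0≤w zero) p)

      W*W⁻¹ : W * W ⁻¹ ≡ 1#
      W*W⁻¹ = *-inverse⁺ W>0

      W⁻¹>0 : ¬ W ⁻¹ ≤ 0#
      W⁻¹>0 = ⁻¹-pos W>0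

      -- By `T-dom` the total weight at i is at most (Σ w) c, where w₀c is the weight of the edge
      -- from i to vertex 0; the ratio of the two is w₀ / Σ w.
      ε : K
      ε = w zero * W ⁻¹

      ε≤1 : ε ≤ 1#
      ε≤1 = subst₂ _≤_ (*-comm _ _) (trans (*-comm _ _) W*W⁻¹) (*-monoˡ-≤ (≰⇒≥ W⁻¹>0) (term≤sum 0≤w zero))

      gap : ∀ i → ε * bil (S i) 𝟏 𝟏 ≤ sum (λ k → S k i zero)
      gap i = subst (ε * bil (S i) 𝟏 𝟏 ≤_) (begin
          ε * (W * c)         ≡⟨ solve 4 (λ w v W c → (w :* v) :* (W :* c) := (W :* v) :* (w :* c)) refl (w zero) (W ⁻¹) W c ⟩
          (W * W ⁻¹) * (w zero * c) ≡⟨ cong (_* (w zero * c)) W*W⁻¹ ⟩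
          1# * (w zero * c)   ≡⟨ *-identityˡ _ ⟩
          w zero * c          ≡⟨ *-distribˡ-sum (w zero) (λ k → w i * w k * T i zero k) ⟩
          sum (λ k → w zero * (w i * w k * T i zero k))
            ≡⟨ sum-cong-≗ (λ k → trans (solve 4 (λ w₀ x y t → w₀ :* (x :* y :* t) := y :* (x :* w₀ :* t)) refl (w zero) (w i) (w k) (T i zero k))
                 (cong (λ z → w k * (w i * w zero * z)) (trans (T-sym i zero k) (T-sym′ i k zero)))) ⟩
          sum (λ k → S k i zero) ∎)
        (*-monoˡ-≤ (*-nonneg (0≤w zero) (≰⇒≥ W⁻¹>0)) (≤-trans (sum-mono row) (≡⇒≤ (begin
          sum (λ j → w j * c) ≡⟨ sum-cong-≗ (λ j → *-comm (w j) c) ⟩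
          sum (λ j → c * w j) ≡⟨ *-distribˡ-sum c w ⟨
          c * W               ≡⟨ *-comm c W ⟩
          W * c               ∎))))
        where
        open ≡-Reasoning
        c : K
        c = sum (λ k → w i * w k * T i zero k)
        row : ∀ j → sum (λ k → S i j k * (1# * 1#)) ≤ w j * c
        row j = ≤-trans (sum-mono (λ k → ≤-by
            (*-nonneg (*-nonneg (*-nonneg (0≤w i) (0≤w j)) (0≤w k)) (≤⇒0≤- (T-dom i j k)))
            (solve 5 (λ wi wj wk t t₀ → wi :* wj :* wk :* (t₀ :- t)
              := wj :* (wi :* wk :* t₀) :- (wi :* (wj :* wk :* t)) :* (𝟙 :* 𝟙)) refl (w i) (w j) (w k) (T i j k) (T i zero k))))
          (≡⇒≤ (sym (*-distribˡ-sum (w j) (λ k → w i * w k * T i zero k))))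

      module U = TrickleUnit S
        (λ k i j → cong (w k *_) (cong₂ _*_ (*-comm (w i) (w j)) (T-sym k i j)))
        (λ k i j → trans (solve 4 (λ x y z t → x :* (y :* z :* t) := y :* (x :* z :* t)) refl (w k) (w i) (w j) (T k i j))
                         (cong (λ t → w i * (w k * w j * t)) (T-sym′ k i j)))
        (λ k i j → *-nonneg (0≤w k) (*-nonneg (*-nonneg (0≤w i) (0≤w j)) (T-nonneg k i j)))
        S-hyp ε (*-pos (w>0 zero) W⁻¹>0) ε≤1 gap

      sum-S : ∀ i j → sum (λ k → S k i j) ≡ scale w H i j
      sum-S i j = trans (sum-cong-≗ (λ k → solve 4 (λ x y z t → x :* (y :* z :* t) := y :* z :* (x :* t)) refl (w k) (w i) (w j) (T k i j)))
        (sym (*-distribˡ-sum (w i * w j) (λ k → w k * T k i j)))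

    nonpos-on-orth : ∀ a → bil H a w ≡ 0# → bil H a a ≤ 0#
    nonpos-on-orth a oa = subst (_≤ 0#) (convert a′ a wa′) (U.nonpos-on-orth a′ (trans (convert 𝟏 w w𝟏) oa))
      where
      a′ : Vec# (suc n)
      a′ i = w i ⁻¹ * a i
      wa′ : ∀ i → w i * a′ i ≡ a i
      wa′ i = trans (sym (*-assoc _ _ _)) (trans (cong (_* a i) (*-inverse⁺ (w>0 i))) (*-identityˡ (a i)))
      convert : ∀ v v′ → (∀ i → w i * v i ≡ v′ i) → bil (λ i j → sum (λ k → S k i j)) a′ v ≡ bil H a v′
      convert v v′ p = trans (bil-cong {u = a′} {v = v} sum-S (λ _ → refl) (λ _ → refl))
        (trans (bil-scale w H a′ v) (bil-cong {A = H} (λ _ _ → refl) wa′ p))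

  -- The limit ε → 0 at one explicit ε. If δ = bc - a² is positive, the hypothesis reads δ ≤ εX +
  -- ε²Y. At ε = δ/(δ + R) with R = 2 + X² + Y² this gives 2δ ≤ εR = δ - εδ, which is absurd.
  ≤-limit : ∀ a b c a′ b′ c′ →
    (∀ ε → ¬ ε ≤ 0# → (b + ε * b′) * (c + ε * c′) ≤ (a + ε * a′) * (a + ε * a′)) → b * c ≤ a * a
  ≤-limit a b c a′ b′ c′ p with b * c ≤? a * a
  ... | yes q = q
  ... | no ¬q = contradiction δ+εδ≤0 (+-pos δ>0 (*-nonneg 0≤ε (≰⇒≥ δ>0)))
    where
    δ = b * c - a * a
    δ>0 : ¬ δ ≤ 0#
    δ>0 r = ¬q (≤-by (≤0⇒0≤- r) (solve 3 (λ a b c → :- (b :* c :- a :* a) := a :* a :- b :* c) refl a b c))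
    X = 2# * a * a′ - b * c′ - b′ * c
    Y = a′ * a′ - b′ * c′
    R = 1# + 1# + X * X + Y * Y
    0≤R : 0# ≤ R
    0≤R = +-nonneg (+-nonneg (+-nonneg 0≤1 0≤1) (sq-nonneg X)) (sq-nonneg Y)
    M = δ + R
    M>0 : ¬ M ≤ 0#
    M>0 = +-pos δ>0 0≤R
    m = M ⁻¹
    M*m : M * m ≡ 1#
    M*m = *-inverse⁺ M>0
    m>0 : ¬ m ≤ 0#
    m>0 = ⁻¹-pos M>0
    ε = δ * m
    Mε : M * ε ≡ δ
    Mε = trans (solve 3 (λ M δ m → M :* (δ :* m) := (M :* m) :* δ) refl M δ m)
      (trans (cong (_* δ) M*m) (*-identityˡ δ))
    δ≤ : 0# ≤ ε * X + ε * ε * Y - δ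
    δ≤ = subst (0# ≤_) (solve 7 (λ a b c a′ b′ c′ ε →
        (a :+ ε :* a′) :* (a :+ ε :* a′) :- (b :+ ε :* b′) :* (c :+ ε :* c′)
        := ε :* (𝟚 :* a :* a′ :- b :* c′ :- b′ :* c) :+ ε :* ε :* (a′ :* a′ :- b′ :* c′) :- (b :* c :- a :* a)) refl a b c a′ b′ c′ ε)
      (≤⇒0≤- (p ε (*-pos δ>0 m>0)))
    0≤ε : 0# ≤ ε
    0≤ε = *-nonneg (≰⇒≥ δ>0) (≰⇒≥ m>0)
    0≤1-ε : 0# ≤ 1# - ε
    0≤1-ε = subst (0# ≤_) (trans (solve 3 (λ δ r m → r :* m := (δ :+ r) :* m :- δ :* m) refl δ R m) (cong (_- ε) M*m))
      (*-nonneg 0≤R (≰⇒≥ m>0))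
    -- 2X ≤ 1 + X² and 2εY ≤ ε² + Y² ≤ 1 + Y²
    δ+εδ≤0 : δ + ε * δ ≤ 0#
    δ+εδ≤0 = ≤-by
      (+-nonneg (+-nonneg (+-nonneg (+-nonneg δ≤ δ≤) (*-nonneg 0≤ε (sq-nonneg (1# - X)))) (*-nonneg 0≤ε (sq-nonneg (ε - Y))))
        (*-nonneg 0≤ε (*-nonneg 0≤1-ε (+-nonneg 0≤1 0≤ε))))
      (trans (solve 4 (λ δ ε X Y →
          let e = ε :* X :+ ε :* ε :* Y :- δ in
          e :+ e :+ ε :* ((𝟙 :- X) :* (𝟙 :- X)) :+ ε :* ((ε :- Y) :* (ε :- Y)) :+ ε :* ((𝟙 :- ε) :* (𝟙 :+ ε))
          := (δ :+ (𝟙 :+ 𝟙 :+ X :* X :+ Y :* Y)) :* ε :- 𝟚 :* δ :- ε :* δ) refl δ ε X Y)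
        (trans (cong (λ z → z - 2# * δ - ε * δ) Mε)
          (solve 2 (λ δ ε → δ :- 𝟚 :* δ :- ε :* δ := 𝟘 :- (δ :+ ε :* δ)) refl δ ε)))

  -- Φ vs σ is the iterated directional derivative along vs, at the state (monomial) σ, of the
  -- polynomial whose normalised coefficients are φ; mat vs σ is its Hessian.
  module Trickling {X : Set} {n} (act : Fin (suc n) → X → X)
    (act-comm : ∀ i j σ → act i (act j σ) ≡ act j (act i σ))
    (φ : X → K) (φ-nonneg : ∀ σ → 0# ≤ φ σ)
    (φ-dom : ∀ j σ → φ (act j σ) ≤ φ (act zero σ))
    where

    Φ : List (Vec# (suc n)) → X → K
    Φ []       σ = φ σ
    Φ (v ∷ vs) σ = sum (λ k → v k * Φ vs (act k σ))

    mat : List (Vec# (suc n)) → X → Mat (suc n)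
    mat vs σ i j = Φ vs (act i (act j σ))

    mat-sym : ∀ vs σ i j → mat vs σ i j ≡ mat vs σ j i
    mat-sym vs σ i j = cong (Φ vs) (act-comm i j σ)

    bil-mat : ∀ vs σ u v → bil (mat vs σ) u v ≡ Φ (u ∷ v ∷ vs) σ
    bil-mat vs σ u v = sum-cong-≗ (λ i → trans
      (sum-cong-≗ (λ j → trans (cong (_* (u i * v j)) (mat-sym vs σ i j))
        (solve 3 (λ m x y → m :* (x :* y) := x :* (y :* m)) refl (mat vs σ j i) (u i) (v j))))
      (sym (*-distribˡ-sum (u i) (λ j → v j * mat vs σ j i))))

    Nonneg : Vec# (suc n) → Set
    Nonneg v = ∀ i → 0# ≤ v i

    Φ-nonneg : ∀ {vs} → All Nonneg vs → ∀ σ → 0# ≤ Φ vs σ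
    Φ-nonneg []       σ = φ-nonneg σ
    Φ-nonneg (p ∷ ps) σ = sum-nonneg (λ k → *-nonneg (p k) (Φ-nonneg ps (act k σ)))

    Φ-dom : ∀ {vs} → All Nonneg vs → ∀ j σ → Φ vs (act j σ) ≤ Φ vs (act zero σ)
    Φ-dom []                j σ = φ-dom j σ
    Φ-dom {_ ∷ vs} (p ∷ ps) j σ = sum-mono (λ k → *-monoˡ-≤ (p k)
      (subst₂ (λ s t → Φ vs s ≤ Φ vs t) (act-comm j k σ) (act-comm zero k σ) (Φ-dom ps j (act k σ))))

    Lorentz : Mat (suc n) → Set
    Lorentz A = ∀ u v → Nonneg v → bil A u u * bil A v v ≤ bil A u v * bil A u v

    -- The slices `T k` of the third derivative at σ are the Hessians at the states `act k σ`, so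
    -- the hypothesis of `Trickle` is the induction hypothesis tested against `w`. Nonpositivity on
    -- the complement of `w` then yields the inequality for every nonnegative `v`, as the next
    -- induction step requires.
    step-pos : ∀ {vs w} → All Nonneg vs → (∀ i → ¬ w i ≤ 0#) → ∀ σ →
               (∀ k → Lorentz (mat vs (act k σ))) → Lorentz (mat (w ∷ vs) σ)
    step-pos {vs} {w} ps w>0 σ ih u v pv =
      reverse-cauchy-schwarz (matForm (mat (w ∷ vs) σ) (mat-sym (w ∷ vs) σ)) w
        (λ a oa → subst (_≤ 0#) (bil-H a a) (nonpos-on-orth a (trans (bil-H a w) oa))) u v
        (bil-nonneg (λ i j → Φ-nonneg ps′ (act i (act j σ))) pv pv)
      where
      0≤w : Nonneg w
      0≤w i = ≰⇒≥ (w>0 i)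
      ps′ : All Nonneg (w ∷ vs)
      ps′ = 0≤w ∷ ps
      T : Fin (suc n) → Mat (suc n)
      T k = mat vs (act k σ)
      open Trickle T (λ k → mat-sym vs (act k σ))
        (λ k i j → trans (mat-sym vs (act k σ) i j) (trans (cong (λ s → Φ vs (act j s)) (act-comm i k σ)) (mat-sym vs (act i σ) j k)))
        (λ k i j → Φ-nonneg ps (act i (act j (act k σ))))
        (λ k i j → Φ-dom ps i (act j (act k σ)))
        w w>0 (λ k u → ih k u w 0≤w)
      bil-H : ∀ u v → bil (λ i j → sum (λ k → w k * T k i j)) u v ≡ bil (mat (w ∷ vs) σ) u v
      bil-H u v = bil-cong {u = u} {v = v} (λ i j → sum-cong-≗ (λ k → cong (λ s → w k * Φ vs s)
        (trans (cong (act i) (act-comm j k σ)) (act-comm i k (act j σ))))) (λ _ → refl) (λ _ → refl)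

    mat-lin : ∀ w ε vs σ u v → bil (mat (lin 1# w ε 𝟏 ∷ vs) σ) u v ≡ bil (mat (w ∷ vs) σ) u v + ε * bil (mat (𝟏 ∷ vs) σ) u v
    mat-lin w ε vs σ u v = trans
      (sum²-cong (λ i j → trans (cong (_* (u i * v j)) (trans
          (sum-cong-≗ (λ k → solve 3 (λ w ε f → (𝟙 :* w :+ ε :* 𝟙) :* f := 𝟙 :* (w :* f) :+ ε :* (𝟙 :* f)) refl (w k) ε (Φ vs (act k (act i (act j σ))))))
          (sum-lin 1# ε (λ k → w k * Φ vs (act k (act i (act j σ)))) (λ k → 1# * Φ vs (act k (act i (act j σ)))))))
        (solve 4 (λ a b ε x → (𝟙 :* a :+ ε :* b) :* x := 𝟙 :* (a :* x) :+ ε :* (b :* x)) refl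
          (mat (w ∷ vs) σ i j) (mat (𝟏 ∷ vs) σ i j) ε (u i * v j))))
      (trans (sum²-lin 1# ε (λ i j → mat (w ∷ vs) σ i j * (u i * v j)) (λ i j → mat (𝟏 ∷ vs) σ i j * (u i * v j)))
        (cong (_+ ε * bil (mat (𝟏 ∷ vs) σ) u v) (*-identityˡ _)))

    -- For ε > 0 the direction w + ε𝟏 is strictly positive, and the Hessian is affine in ε; let ε
    -- tend to 0.
    step : ∀ {vs w} → All Nonneg vs → Nonneg w → ∀ σ →
           (∀ k → Lorentz (mat vs (act k σ))) → Lorentz (mat (w ∷ vs) σ)
    step {vs} {w} ps pw σ ih u v pv = ≤-limit _ _ _ (bil (mat (𝟏 ∷ vs) σ) u v) (bil (mat (𝟏 ∷ vs) σ) u u) (bil (mat (𝟏 ∷ vs) σ) v v)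
      (λ ε ε>0 → subst₂ _≤_ (cong₂ _*_ (mat-lin w ε vs σ u u) (mat-lin w ε vs σ v v))
                            (cong (λ z → z * z) (mat-lin w ε vs σ u v))
        (step-pos {w = lin 1# w ε 𝟏} ps (λ i p → +-pos (*-pos ε>0 1≰0) (*-nonneg 0≤1 (pw i)) (subst (_≤ 0#) (+-comm _ _) p)) σ ih u v pv))

    module _ (size : X → ℕ) (size-act : ∀ k σ → size (act k σ) ≡ suc (size σ))
      (d : ℕ) (base : ∀ σ → d ℕ.≤ 2 ℕ.+ size σ → Lorentz (mat [] σ)) where

      -- Each removed direction is paid for by one unit of `size`, so the bound persists until no
      -- direction is left and the remaining degree is at most two.
      lorentzian : ∀ {vs} → All Nonneg vs → ∀ σ → d ℕ.≤ 2 ℕ.+ (length vs ℕ.+ size σ) → Lorentz (mat vs σ)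
      lorentzian []                σ p = base σ p
      lorentzian {_ ∷ vs} (pw ∷ ps) σ p = step ps pw σ (λ k → lorentzian ps (act k σ)
        (subst (λ s → d ℕ.≤ 2 ℕ.+ s) (trans (sym (ℕ.+-suc (length vs) (size σ))) (cong (length vs ℕ.+_) (sym (size-act k σ)))) p))

    Φ-swap : ∀ u v vs σ → Φ (u ∷ v ∷ vs) σ ≡ Φ (v ∷ u ∷ vs) σ
    Φ-swap u v vs σ = trans (sym (bil-mat vs σ u v)) (trans (form-sym (matForm (mat vs σ) (mat-sym vs σ)) u v) (bil-mat vs σ v u))

-- Quadratic base case for matroids

module Quadratics (𝔽 : ArchimedeanField) where

  open Field 𝔽
  open Forms 𝔽
  open Matrices 𝔽
  open Lorentzian 𝔽
  open SymForm

  ind : Bool → K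
  ind true  = 1#
  ind false = 0#

  ind-nonneg : ∀ b → 0# ≤ ind b
  ind-nonneg true  = 0≤1
  ind-nonneg false = ≤-refl

  coefficient : {Y : Set} → (Y → Bool) → ℕ × Y → K
  coefficient ψ (ℓ , y) = fromℕ (ℓ !) * ind (ψ y)

  -- For a partial equivalence relation e, weight each element by the inverse size of its class.
  module Classes {n} (e : Fin n → Fin n → Bool)
    (e-sym : ∀ i j → e i j ≡ e j i)
    (e-trans : ∀ i j k → e i j ≡ true → e j k ≡ true → e i k ≡ true)
    (u : Vec# n) (L : K) (L>0 : ¬ L ≤ 0#) (count : sum (λ i → ind (e i i)) ≤ L)
    where

    private
      p : Fin n → Bool
      p i = e i i

      s U c : Vec# n
      s i = sum (λ j → ind (e i j))
      U i = sum (λ j → ind (e i j) * u j)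
      c i = ind (p i) * s i ⁻¹

      S E : K
      S = sum (λ i → ind (p i) * u i)
      E = sum² (λ i j → ind (e i j) * (u i * u j))

      row-eq : ∀ i j → e i j ≡ true → ∀ k → e i k ≡ e j k
      row-eq i j eij k with e i k in eik | e j k in ejk
      ... | true  | true  = refl
      ... | false | false = refl
      ... | true  | false = trans (sym (e-trans j i k (trans (e-sym j i) eij) eik)) ejk
      ... | false | true  = trans (sym eik) (e-trans i j k eij ejk)

      related⇒p : ∀ i j → e i j ≡ true → p i ≡ true
      related⇒p i j eij = e-trans i j i eij (trans (e-sym j i) eij)

      s≥1 : ∀ i → p i ≡ true → 1# ≤ s i
      s≥1 i pi = subst (_≤ s i) (cong ind pi) (term≤sum (λ j → ind-nonneg (e i j)) i)

      s>0 : ∀ i → p i ≡ true → ¬ s i ≤ 0#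
      s>0 i pi q = 1≰0 (≤-trans (s≥1 i pi) q)

      c≤p : ∀ i → c i ≤ ind (p i)
      c≤p i with p i in pi
      ... | false = ≡⇒≤ (zeroˡ _)
      ... | true = *-cancelˡ-≤ (s>0 i pi) (subst₂ _≤_
          (trans (sym (*-inverse⁺ (s>0 i pi))) (cong (s i *_) (sym (*-identityˡ _))))
          (sym (*-identityʳ _)) (s≥1 i pi))

      c-nonneg : ∀ i → 0# ≤ c i
      c-nonneg i with p i in pi
      ... | false = ≡⇒≤ (sym (zeroˡ _))
      ... | true  = *-nonneg 0≤1 (⁻¹-nonneg (s>0 i pi))

      c-transfer : ∀ i j → c i * ind (e i j) ≡ s j ⁻¹ * ind (e i j)
      c-transfer i j with e i j in eij
      ... | false = trans (zeroʳ _) (sym (zeroʳ _))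
      ... | true  = cong (_* 1#) (trans (cong₂ (λ b t → ind b * t ⁻¹) (related⇒p i j eij)
          (sum-cong-≗ (λ k → cong ind (row-eq i j eij k)))) (*-identityˡ _))

      -- On a class, `c` is constantly the inverse of the number of its elements, so each class has
      -- total weight 1.
      c-column : ∀ j → sum (λ i → c i * ind (e i j)) ≡ ind (p j)
      c-column j with p j in pj
      ... | true = begin
        sum (λ i → c i * ind (e i j))      ≡⟨ sum-cong-≗ (λ i → trans (c-transfer i j) (cong (λ b → s j ⁻¹ * ind b) (e-sym i j))) ⟩
        sum (λ i → s j ⁻¹ * ind (e j i))   ≡⟨ *-distribˡ-sum (s j ⁻¹) (λ i → ind (e j i)) ⟨
        s j ⁻¹ * s j                       ≡⟨ trans (*-comm _ _) (*-inverse⁺ (s>0 j pj)) ⟩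
        1#                                 ∎
        where open ≡-Reasoning
      ... | false = sum-zero (λ i → trans (cong (λ b → c i * ind b) (unrelated i)) (zeroʳ _))
        where
        unrelated : ∀ i → e i j ≡ false
        unrelated i with e i j in eij
        ... | false = refl
        ... | true  = trans (sym (related⇒p j i (trans (e-sym j i) eij))) pj

      weighted : ∀ (f : Vec# n) → (∀ i j → e i j ≡ true → f i ≡ f j) →
                 sum (λ i → c i * (f i * U i)) ≡ sum (λ j → ind (p j) * (f j * u j))
      weighted f const = begin
        sum (λ i → c i * (f i * U i))
          ≡⟨ sum-cong-≗ (λ i → trans (sym (*-assoc (c i) (f i) (U i))) (*-distribˡ-sum (c i * f i) (λ j → ind (e i j) * u j))) ⟩
        sum² (λ i j → (c i * f i) * (ind (e i j) * u j))
          ≡⟨ ∑-comm (λ i j → (c i * f i) * (ind (e i j) * u j)) ⟩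
        sum² (λ j i → (c i * f i) * (ind (e i j) * u j))
          ≡⟨ sum²-cong (λ j i → transfer i j) ⟩
        sum² (λ j i → (f j * u j) * (c i * ind (e i j)))
          ≡⟨ sum-cong-≗ (λ j → trans (sym (*-distribˡ-sum (f j * u j) (λ i → c i * ind (e i j)))) (trans (*-comm _ _) (cong (_* (f j * u j)) (c-column j)))) ⟩
        sum (λ j → ind (p j) * (f j * u j)) ∎
        where
        open ≡-Reasoning
        transfer : ∀ i j → (c i * f i) * (ind (e i j) * u j) ≡ (f j * u j) * (c i * ind (e i j))
        transfer i j with e i j in eij
        ... | false = solve 4 (λ c f f′ u → (c :* f) :* (𝟘 :* u) := (f′ :* u) :* (c :* 𝟘)) refl (c i) (f i) (f j) (u j)
        ... | true = trans (cong (λ z → (c i * z) * (1# * u j)) (const i j eij))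
          (solve 3 (λ c f u → (c :* f) :* (𝟙 :* u) := (f :* u) :* (c :* 𝟙)) refl (c i) (f j) (u j))

      ΣcU : sum (λ i → c i * U i) ≡ S
      ΣcU = trans (sum-cong-≗ (λ i → cong (c i *_) (sym (*-identityˡ (U i)))))
        (trans (weighted 𝟏 (λ _ _ _ → refl)) (sum-cong-≗ (λ j → cong (ind (p j) *_) (*-identityˡ (u j)))))

      ΣcUU : sum (λ i → c i * (U i * U i)) ≡ E
      ΣcUU = trans (weighted U (λ i j eij → sum-cong-≗ (λ k → cong (λ b → ind b * u k) (row-eq i j eij k))))
        (sum-cong-≗ (λ j → trans (trans (cong (ind (p j) *_) (*-comm (U j) (u j)))
            (trans (sym (*-assoc _ _ _)) (*-distribˡ-sum (ind (p j) * u j) (λ k → ind (e j k) * u k))))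
          (sum-cong-≗ (λ k → absorb j k))))
        where
        absorb : ∀ j k → (ind (p j) * u j) * (ind (e j k) * u k) ≡ ind (e j k) * (u j * u k)
        absorb j k with e j k in ejk
        ... | false = solve 3 (λ x y z → (x :* y) :* (𝟘 :* z) := 𝟘 :* (y :* z)) refl (ind (p j)) (u j) (u k)
        ... | true = trans (cong (λ b → (ind b * u j) * (1# * u k)) (related⇒p j k ejk))
          (solve 2 (λ y z → (𝟙 :* y) :* (𝟙 :* z) := 𝟙 :* (y :* z)) refl (u j) (u k))

      Σc≤L : sum c ≤ L
      Σc≤L = ≤-trans (sum-mono c≤p) count

    -- Cauchy-Schwarz over the classes. The `U i` are class sums, Σ cᵢ is the number of classes, Σ
    -- cᵢUᵢ = S and Σ cᵢUᵢ² = E; the certificate is Σ cᵢ(LUᵢ - S)² ≥ 0 together with Σ cᵢ ≤ L.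
    sq-sum≤ : S * S ≤ L * E
    sq-sum≤ = *-cancelˡ-≤ L>0 (≤-by
      (+-nonneg (sum-nonneg (λ i → *-nonneg (c-nonneg i) (sq-nonneg (L * U i - S)))) (*-nonneg (sq-nonneg S) (≤⇒0≤- Σc≤L)))
      (begin
        sum (λ i → c i * ((L * U i - S) * (L * U i - S))) + S * S * (L - sum c)
          ≡⟨ cong (_+ S * S * (L - sum c)) (begin
             sum (λ i → c i * ((L * U i - S) * (L * U i - S)))
               ≡⟨ sum-cong-≗ (λ i → solve 4 (λ c L U S → c :* ((L :* U :- S) :* (L :* U :- S))
                   := L :* (L :* (c :* (U :* U)) :+ (:- 𝟚 :* S) :* (c :* U)) :+ (S :* S) :* c) refl (c i) L (U i) S) ⟩
             sum (λ i → L * (L * (c i * (U i * U i)) + (- 2# * S) * (c i * U i)) + (S * S) * c i)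
               ≡⟨ sum-lin L (S * S) (λ i → L * (c i * (U i * U i)) + (- 2# * S) * (c i * U i)) c ⟩
             L * sum (λ i → L * (c i * (U i * U i)) + (- 2# * S) * (c i * U i)) + (S * S) * sum c
               ≡⟨ cong (λ z → L * z + (S * S) * sum c) (sum-lin L (- 2# * S) (λ i → c i * (U i * U i)) (λ i → c i * U i)) ⟩
             L * (L * sum (λ i → c i * (U i * U i)) + (- 2# * S) * sum (λ i → c i * U i)) + (S * S) * sum c
               ≡⟨ cong₂ (λ x y → L * (L * x + (- 2# * S) * y) + (S * S) * sum c) ΣcUU ΣcU ⟩
             L * (L * E + (- 2# * S) * S) + (S * S) * sum c ∎) ⟩
        L * (L * E + (- 2# * S) * S) + (S * S) * sum c + S * S * (L - sum c)
          ≡⟨ solve 4 (λ L E S C → L :* (L :* E :+ (:- 𝟚 :* S) :* S) :+ (S :* S) :* C :+ S :* S :* (L :- C)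
               := L :* (L :* E) :- L :* (S :* S)) refl L E S (sum c) ⟩
        L * (L * E) - L * (S * S) ∎))
      where open ≡-Reasoning

  -- The homogenised independence polynomial Σ_A x₀^{N−|A|} x^A of a matroid: its normalised
  -- coefficient at x₀^ℓ y is ℓ! if y is the indicator of an independent set, and 0 otherwise.
  module Independence {N} {Y : Set} (T : Fin N → Y → Y) (T-comm : ∀ i j y → T i (T j y) ≡ T j (T i y))
    (ψ : Y → Bool)
    (ψ-down : ∀ i y → ψ (T i y) ≡ true → ψ y ≡ true)
    (ψ-sq   : ∀ i y → ψ (T i (T i y)) ≡ false)
    (ψ-exch : ∀ i j k y → ψ (T i (T k y)) ≡ true → ψ (T j y) ≡ true →
              ψ (T i (T j y)) ≡ true ⊎ ψ (T j (T k y)) ≡ true)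
    (size : Y → ℕ)
    (size-T : ∀ i y → size (T i y) ≡ suc (size y))
    (few : ∀ y L → ψ y ≡ true → N ℕ.≤ L ℕ.+ size y → sum (λ i → ind (ψ (T i y))) ≤ fromℕ L)
    where

    X : Set
    X = ℕ × Y

    act : Fin (suc N) → X → X
    act zero    (ℓ , y) = suc ℓ , y
    act (suc i) (ℓ , y) = ℓ , T i y

    act-comm : ∀ i j σ → act i (act j σ) ≡ act j (act i σ)
    act-comm zero    zero    σ = refl
    act-comm zero    (suc j) σ = refl
    act-comm (suc i) zero    σ = refl
    act-comm (suc i) (suc j) (ℓ , y) = cong (ℓ ,_) (T-comm i j y)

    φ : X → K
    φ = coefficient ψ

    φ-nonneg : ∀ σ → 0# ≤ φ σ
    φ-nonneg (ℓ , y) = *-nonneg (fromℕ-nonneg (ℓ !)) (ind-nonneg (ψ y))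

    ind-mono : ∀ b b′ → (b ≡ true → b′ ≡ true) → ind b ≤ ind b′
    ind-mono false b′ p = ind-nonneg b′
    ind-mono true  b′ p = ≡⇒≤ (cong ind (sym (p refl)))

    φ-dom : ∀ j σ → φ (act j σ) ≤ φ (act zero σ)
    φ-dom zero    σ = ≤-refl
    φ-dom (suc j) (ℓ , y) = ≤-trans (*-monoˡ-≤ (fromℕ-nonneg (ℓ !)) (ind-mono _ _ (ψ-down j y)))
      (subst₂ _≤_ (*-comm _ _) (*-comm _ _)
        (*-monoˡ-≤ (ind-nonneg (ψ y)) (fromℕ-mono {ℓ !} {suc ℓ !} (ℕ.m≤m+n (ℓ !) (ℓ ℕ.* ℓ !)))))

    open Trickling act act-comm φ φ-nonneg φ-dom public

    total : X → ℕ
    total (ℓ , y) = ℓ ℕ.+ size y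

    total-act : ∀ k σ → total (act k σ) ≡ suc (total σ)
    total-act zero    (ℓ , y) = refl
    total-act (suc k) (ℓ , y) = trans (cong (ℓ ℕ.+_) (size-T k y)) (ℕ.+-suc ℓ (size y))

    private
      module Base (ℓ : ℕ) (y : Y) (ψy : ψ y ≡ true) (enough : N ℕ.≤ 2 ℕ.+ (ℓ ℕ.+ size y)) where

        L : K
        L = fromℕ (2 ℕ.+ ℓ)

        -- Parallelism in the contraction by `y`: both elements are nonloops, and together they are
        -- dependent.
        e : Fin N → Fin N → Bool
        e i j = ψ (T i y) ∧ ψ (T j y) ∧ not (ψ (T i (T j y)))

        e⇒ : ∀ i j → e i j ≡ true → ψ (T i y) ≡ true × ψ (T j y) ≡ true × ψ (T i (T j y)) ≡ false
        e⇒ i j eij with ψ (T i y) | ψ (T j y) | ψ (T i (T j y))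
        e⇒ i j eij | true  | true  | false = refl , refl , refl
        e⇒ i j ()  | true  | true  | true
        e⇒ i j ()  | true  | false | _
        e⇒ i j ()  | false | _     | _

        e-diag : ∀ i → e i i ≡ ψ (T i y)
        e-diag i rewrite ψ-sq i y with ψ (T i y)
        ... | true  = refl
        ... | false = refl

        e-sym : ∀ i j → e i j ≡ e j i
        e-sym i j rewrite T-comm i j y with ψ (T i y) | ψ (T j y)
        ... | true  | true  = refl
        ... | true  | false = refl
        ... | false | true  = refl
        ... | false | false = refl

        -- If i and k were independent over `y`, exchanging with the nonloop j would make it
        -- independent of i or of k.
        e-trans : ∀ i j k → e i j ≡ true → e j k ≡ true → e i k ≡ true
        e-trans i j k eij ejk with e⇒ i j eij | e⇒ j k ejk
        ... | ψi , ψj , ¬ψij | _ , ψk , ¬ψjk rewrite ψi | ψk with ψ (T i (T k y)) in ψik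
        ...   | false = refl
        ...   | true with ψ-exch i j k y ψik ψj
        ...     | inj₁ ψij = trans (sym ¬ψij) ψij
        ...     | inj₂ ψjk = trans (sym ¬ψjk) ψjk

        -- A pair of nonloops is either independent or parallel, and a pair containing a loop is
        -- neither. Hence the part of the form without x₀ is a multiple of S² - E.
        pair : ∀ i j → ind (ψ (T i (T j y))) ≡ ind (ψ (T i y)) * ind (ψ (T j y)) - ind (e i j)
        pair i j with ψ (T i (T j y)) in ψij
        ... | true rewrite ψ-down i (T j y) ψij | ψ-down j (T i y) (trans (cong ψ (T-comm j i y)) ψij) =
          solve 0 (𝟙 := 𝟙 :* 𝟙 :- 𝟘) refl
        ... | false with ψ (T i y) | ψ (T j y)
        ...   | true  | true  = solve 0 (𝟘 := 𝟙 :* 𝟙 :- 𝟙) refl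
        ...   | true  | false = solve 0 (𝟘 := 𝟙 :* 𝟘 :- 𝟘) refl
        ...   | false | true  = solve 0 (𝟘 := 𝟘 :* 𝟙 :- 𝟘) refl
        ...   | false | false = solve 0 (𝟘 := 𝟘 :* 𝟘 :- 𝟘) refl

        module _ (a : Vec# (suc N)) where

          u : Vec# N
          u i = a (suc i)

          a₀ f l S E : K
          a₀ = a zero
          f = fromℕ (ℓ !)
          l = fromℕ (1 ℕ.+ ℓ)
          S = sum (λ i → ind (ψ (T i y)) * u i)
          E = sum² (λ i j → ind (e i j) * (u i * u j))

          -- `few` bounds the number of nonloops by L = ℓ + 2, which is also the ratio (ℓ + 2)!/(ℓ +
          -- 1)! of the weights in the row of x₀. This coincidence makes the inequality exactly what
          -- `nonpos` asks for.
          S²≤LE : S * S ≤ L * E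
          S²≤LE = subst (λ s → s * s ≤ L * E) (sum-cong-≗ (λ i → cong (λ b → ind b * u i) (e-diag i)))
            (Classes.sq-sum≤ e e-sym e-trans u L (fromℕ-pos (suc ℓ))
              (≤-trans (≡⇒≤ (sum-cong-≗ (λ i → cong ind (e-diag i))))
                (few y (2 ℕ.+ ℓ) ψy (subst (N ℕ.≤_) (sym (ℕ.+-assoc 2 ℓ (size y))) enough))))

          lf : fromℕ (suc ℓ !) ≡ l * f
          lf = ×1-homo-* (suc ℓ) (ℓ !)

          Llf : fromℕ ((2 ℕ.+ ℓ) !) ≡ L * (l * f)
          Llf = trans (×1-homo-* (2 ℕ.+ ℓ) (suc ℓ !)) (cong (L *_) lf)

          M : Mat (suc N)
          M = mat [] (ℓ , y)

          M₀₀ : M zero zero ≡ L * (l * f)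
          M₀₀ = trans (cong (λ b → fromℕ ((2 ℕ.+ ℓ) !) * ind b) ψy) (trans (*-identityʳ _) Llf)

          M₀ᵢ : sum (λ i → M zero (suc i) * (a₀ * u i)) ≡ l * f * a₀ * S
          M₀ᵢ = trans (sum-cong-≗ (λ i → trans (cong (λ z → z * ind (ψ (T i y)) * (a₀ * u i)) lf)
              (solve 4 (λ lf b a u → lf :* b :* (a :* u) := lf :* a :* (b :* u)) refl (l * f) (ind (ψ (T i y))) a₀ (u i))))
            (sym (*-distribˡ-sum (l * f * a₀) (λ i → ind (ψ (T i y)) * u i)))

          Mᵢⱼ : sum² (λ i j → M (suc i) (suc j) * (u i * u j)) ≡ f * (S * S - E)
          Mᵢⱼ = begin
            sum² (λ i j → f * ind (ψ (T i (T j y))) * (u i * u j))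
              ≡⟨ sum²-cong (λ i j → trans (cong (λ z → f * z * (u i * u j)) (pair i j))
                   (solve 6 (λ f p q e x y → f :* (p :* q :- e) :* (x :* y) := f :* ((p :* x) :* (q :* y)) :+ (:- f) :* (e :* (x :* y))) refl
                     f (ind (ψ (T i y))) (ind (ψ (T j y))) (ind (e i j)) (u i) (u j))) ⟩
            sum² (λ i j → f * (s i * s j) + (- f) * (ind (e i j) * (u i * u j)))
              ≡⟨ sum²-lin f (- f) (λ i j → s i * s j) (λ i j → ind (e i j) * (u i * u j)) ⟩
            f * sum² (λ i j → s i * s j) + (- f) * E
              ≡⟨ cong (λ z → f * z + (- f) * E) (trans (sum-cong-≗ (λ i → trans (sym (*-distribˡ-sum (s i) s)) (*-comm (s i) S))) (sym (*-distribˡ-sum S s))) ⟩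
            f * (S * S) + (- f) * E
              ≡⟨ solve 3 (λ f s e → f :* s :+ (:- f) :* e := f :* (s :- e)) refl f (S * S) E ⟩
            f * (S * S - E) ∎
            where
            open ≡-Reasoning
            s : Vec# N
            s i = ind (ψ (T i y)) * u i

          form-aa : bil M a a ≡ L * (l * f) * (a₀ * a₀) + l * f * a₀ * S + (l * f * a₀ * S + f * (S * S - E))
          form-aa = cong₂ _+_ (cong₂ _+_ (cong (_* (a₀ * a₀)) M₀₀) M₀ᵢ)
            (trans (∑-distrib-+ (λ i → M (suc i) zero * (u i * a₀)) (λ i → sum (λ j → M (suc i) (suc j) * (u i * u j))))
              (cong₂ _+_ (trans (sum-cong-≗ (λ i → cong (M (suc i) zero *_) (*-comm (u i) a₀))) M₀ᵢ) Mᵢⱼ))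

          e₀ : Vec# (suc N)
          e₀ zero    = 1#
          e₀ (suc _) = 0#

          form-ae₀ : bil M a e₀ ≡ l * f * (L * a₀ + S)
          form-ae₀ = trans (cong₂ _+_ (trans (cong (M zero zero * (a₀ * 1#) +_)
                (sum-zero (λ j → trans (cong (M zero (suc j) *_) (zeroʳ a₀)) (zeroʳ _)))) (cong (λ z → z * (a₀ * 1#) + 0#) M₀₀))
              (trans (sum-cong-≗ (λ i → trans (cong₂ _+_
                    (trans (cong (λ z → z * ind (ψ (T i y)) * (u i * 1#)) lf)
                      (solve 3 (λ lf b u → lf :* b :* (u :* 𝟙) := lf :* (b :* u)) refl (l * f) (ind (ψ (T i y))) (u i)))
                    (sum-zero (λ j → trans (cong (M (suc i) (suc j) *_) (zeroʳ (u i))) (zeroʳ _))))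
                  (+-identityʳ _)))
                (sym (*-distribˡ-sum (l * f) (λ i → ind (ψ (T i y)) * u i)))))
            (solve 4 (λ L lf a s → L :* lf :* (a :* 𝟙) :+ 𝟘 :+ lf :* s := lf :* (L :* a :+ s)) refl L (l * f) a₀ S)

          f≥0 : 0# ≤ f
          f≥0 = fromℕ-nonneg (ℓ !)

          -- On the orthogonal complement of e₀ one has L a₀ = −S, and the form is (ℓ!/L) (S² − L E).
          nonpos : bil M a e₀ ≡ 0# → bil M a a ≤ 0#
          nonpos orth = *-cancelˡ-≤ {L} (fromℕ-pos (suc ℓ)) (≤-by (*-nonneg f≥0 (≤⇒0≤- S²≤LE)) (begin
            f * (L * E - S * S)
              ≡⟨ solve 6 (λ L l f a s e →
                   f :* ((𝟙 :+ l) :* e :- s :* s)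
                   := (𝟙 :+ l) :* 𝟘 :- (𝟙 :+ l) :* ((𝟙 :+ l) :* (l :* f) :* (a :* a) :+ l :* f :* a :* s :+ (l :* f :* a :* s :+ f :* (s :* s :- e)))
                      :+ (l :* f :* ((𝟙 :+ l) :* a :+ s)) :* ((𝟙 :+ l) :* a :+ s)) refl L l f a₀ S E ⟩
            L * 0# - L * (L * (l * f) * (a₀ * a₀) + l * f * a₀ * S + (l * f * a₀ * S + f * (S * S - E)))
              + (l * f * (L * a₀ + S)) * (L * a₀ + S)
              ≡⟨ cong₂ (λ x y → L * 0# - L * x + y * (L * a₀ + S)) (sym form-aa) (trans (sym form-ae₀) orth) ⟩
            L * 0# - L * bil M a a + 0# * (L * a₀ + S)
              ≡⟨ solve 3 (λ L b r → L :* 𝟘 :- L :* b :+ 𝟘 :* r := L :* 𝟘 :- L :* b) refl L (bil M a a) (L * a₀ + S) ⟩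
            L * 0# - L * bil M a a ∎))
            where open ≡-Reasoning

      -- Replacing both letters by x₀ can only increase φ, and φ vanishes at every power of x₀ times
      -- a dependent `y`.
      φ-zero : ∀ ℓ y → ψ y ≡ false → ∀ j k → φ (act j (act k (ℓ , y))) ≡ 0#
      φ-zero ℓ y ψy j k = ≤-antisym (≤-trans (φ-dom j (act k (ℓ , y)))
          (≤-trans (subst (λ σ → φ σ ≤ φ (2 ℕ.+ ℓ , y)) (act-comm k zero (ℓ , y)) (φ-dom k (suc ℓ , y)))
            (≡⇒≤ (trans (cong (λ b → fromℕ ((2 ℕ.+ ℓ) !) * ind b) ψy) (zeroʳ (fromℕ ((2 ℕ.+ ℓ) !)))))))
        (φ-nonneg (act j (act k (ℓ , y))))

    dichotomy : ∀ b → b ≡ true ⊎ b ≡ false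
    dichotomy true  = inj₁ refl
    dichotomy false = inj₂ refl

    base : ∀ σ → N ℕ.≤ 2 ℕ.+ total σ → Lorentz (mat [] σ)
    base (ℓ , y) enough u v pv with dichotomy (ψ y)
    ... | inj₁ ψy = reverse-cauchy-schwarz (matForm (mat [] (ℓ , y)) (mat-sym [] (ℓ , y))) (B.e₀ 𝟏) (λ a → B.nonpos a) u v
        (bil-nonneg (λ i j → φ-nonneg (act i (act j (ℓ , y)))) pv pv)
      where module B = Base ℓ y ψy enough
    ... | inj₂ ψy = ≤-trans (≡⇒≤ (trans (cong (_* bil (mat [] (ℓ , y)) v v)
        (sum-zero (λ i → sum-zero (λ j → trans (cong (_* (u i * u j)) (φ-zero ℓ y ψy i j)) (zeroˡ _))))) (zeroˡ _)))
      (sq-nonneg (bil (mat [] (ℓ , y)) u v))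

-- Coefficients along two directions

bit : Bool → ℕ
bit true  = 1
bit false = 0

sumOver : ∀ {n} → (Subset n → ℕ) → ℕ
sumOver {zero}  f = f []
sumOver {suc n} f = sumOver (f ∘ (false ∷_)) ℕ.+ sumOver (f ∘ (true ∷_))

sumOver-cong : ∀ {n} {f g : Subset n → ℕ} → (∀ B → f B ≡ g B) → sumOver f ≡ sumOver g
sumOver-cong {zero}  p = p []
sumOver-cong {suc n} p = cong₂ ℕ._+_ (sumOver-cong (λ B → p (false ∷ B))) (sumOver-cong (λ B → p (true ∷ B)))

count : ∀ {n} → (Subset n → Bool) → ℕ
count g = sumOver (bit ∘ g)

count-none : ∀ {n} {g : Subset n → Bool} → (∀ B → g B ≡ false) → count g ≡ 0
count-none {zero}  p = cong bit (p [])
count-none {suc n} p = cong₂ ℕ._+_ (count-none (λ B → p (false ∷ B))) (count-none (λ B → p (true ∷ B)))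

insertAll : ∀ {N} {Y : Set} → (Fin N → Y → Y) → Subset N → Y → Y
insertAll T []          y = y
insertAll T (false ∷ B) y = insertAll (T ∘ suc) B y
insertAll T (true  ∷ B) y = insertAll (T ∘ suc) B (T zero y)

module Peeling (𝔽 : ArchimedeanField) where

  open Field 𝔽
  open Forms 𝔽
  open Matrices 𝔽
  open Quadratics 𝔽

  module _ {Y : Set} (ψ : Y → Bool) where

    -- Ψ T F a b applies (∂₀ + Σ_{i ∉ F} ∂ᵢ)ᵃ (Σ_{i ∈ F} ∂ᵢ)ᵇ.
    Ψ : ∀ {N} → (Fin N → Y → Y) → Subset N → ℕ → ℕ → ℕ × Y → K
    Ψ T F zero    zero    σ = coefficient ψ σ
    Ψ T F zero    (suc b) (ℓ , y) = sum (λ i → ind (lookup F i) * Ψ T F zero b (ℓ , T i y))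
    Ψ T F (suc a) b       (ℓ , y) = Ψ T F a b (suc ℓ , y) + sum (λ i → ind (not (lookup F i)) * Ψ T F a b (ℓ , T i y))

    module _ {N} (T⁺ : Fin (suc N) → Y → Y) (T-comm : ∀ i j y → T⁺ i (T⁺ j y) ≡ T⁺ j (T⁺ i y))
             (ψ-sq : ∀ i y → ψ (T⁺ i (T⁺ i y)) ≡ false) where

      private
        t : Y → Y
        t = T⁺ zero

        T : Fin N → Y → Y
        T i = T⁺ (suc i)

        tT : ∀ i y → t (T i y) ≡ T i (t y)
        tT i = T-comm zero (suc i)

      -- A repeated letter stays repeated under further derivatives, so every coefficient reached
      -- from here is 0.
      Ψ-kill : ∀ F a b ℓ y → Ψ T F a b (ℓ , t (t y)) ≡ 0#
      Ψ-kill F zero    zero    ℓ y = trans (cong (λ c → fromℕ (ℓ !) * ind c) (ψ-sq zero y)) (zeroʳ _)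
      Ψ-kill F zero    (suc b) ℓ y = sum-zero (λ i → trans (cong (ind (lookup F i) *_)
        (trans (cong (λ s → Ψ T F zero b (ℓ , s)) (sym (trans (cong t (tT i y)) (tT i (t y))))) (Ψ-kill F zero b ℓ (T i y)))) (zeroʳ _))
      Ψ-kill F (suc a) b ℓ y = trans (cong₂ _+_ (Ψ-kill F a b (suc ℓ) y) (sum-zero (λ i → trans (cong (ind (not (lookup F i)) *_)
        (trans (cong (λ s → Ψ T F a b (ℓ , s)) (sym (trans (cong t (tT i y)) (tT i (t y))))) (Ψ-kill F a b ℓ (T i y)))) (zeroʳ _))))
        (+-identityˡ 0#)

      peel-∉₀ : ∀ F b ℓ y → Ψ T⁺ (false ∷ F) 0 b (ℓ , y) ≡ Ψ T F 0 b (ℓ , y)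
      peel-∉₀ F zero    ℓ y = refl
      peel-∉₀ F (suc b) ℓ y = trans (cong₂ _+_ (zeroˡ _)
        (sum-cong-≗ (λ i → cong (ind (lookup F i) *_) (peel-∉₀ F b ℓ (T i y))))) (+-identityˡ _)

      -- The binomial expansion of (∂ + D)^(a+1), with ∂ the derivative by the first letter: since
      -- ∂² = 0, it occurs at most once, in any of a + 1 positions.
      peel-∉ : ∀ F a b ℓ y → Ψ T⁺ (false ∷ F) (suc a) b (ℓ , y)
               ≡ Ψ T F (suc a) b (ℓ , y) + fromℕ (suc a) * Ψ T F a b (ℓ , t y)
      peel-∉ F zero b ℓ y = trans
        (cong₂ _+_ (peel-∉₀ F b (suc ℓ) y) (cong₂ (λ x s → 1# * x + s) (peel-∉₀ F b ℓ (t y))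
          (sum-cong-≗ (λ i → cong (ind (not (lookup F i)) *_) (peel-∉₀ F b ℓ (T i y))))))
        (solve 3 (λ x y z → x :+ (𝟙 :* y :+ z) := x :+ z :+ (𝟙 :+ 𝟘) :* y) refl (Ψ T F 0 b (suc ℓ , y)) (Ψ T F 0 b (ℓ , t y))
          (sum (λ i → ind (not (lookup F i)) * Ψ T F 0 b (ℓ , T i y))))
      peel-∉ F (suc a) b ℓ y = begin
        Ψ T⁺ F⁺ (suc a) b (suc ℓ , y) + (1# * Ψ T⁺ F⁺ (suc a) b (ℓ , t y) + sum (λ i → c i * Ψ T⁺ F⁺ (suc a) b (ℓ , T i y)))
          ≡⟨ cong₂ _+_ (peel-∉ F a b (suc ℓ) y) (cong₂ (λ x s → 1# * x + s)
               (trans (peel-∉ F a b ℓ (t y)) (cong (λ z → B + n * z) (Ψ-kill F a b ℓ y)))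
               (trans (sum-cong-≗ (λ i → trans (cong (c i *_) (trans (peel-∉ F a b ℓ (T i y)) (cong (λ s → Ψ T F (suc a) b (ℓ , T i y) + n * Ψ T F a b (ℓ , s)) (tT i y))))
                   (solve 4 (λ c n x y → c :* (x :+ n :* y) := 𝟙 :* (c :* x) :+ n :* (c :* y)) refl (c i) n (Ψ T F (suc a) b (ℓ , T i y)) (Ψ T F a b (ℓ , T i (t y))))))
                 (sum-lin 1# n (λ i → c i * Ψ T F (suc a) b (ℓ , T i y)) (λ i → c i * Ψ T F a b (ℓ , T i (t y)))))) ⟩
        (A + n * A′) + (1# * (B + n * 0#) + (1# * D + n * D′))
          ≡⟨ solve 6 (λ A A′ B n D D′ → (A :+ n :* A′) :+ (𝟙 :* (B :+ n :* 𝟘) :+ (𝟙 :* D :+ n :* D′)) := (A :+ D) :+ (B :+ n :* (A′ :+ D′))) refl A A′ B n D D′ ⟩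
        (A + D) + (B + n * B)
          ≡⟨ solve 3 (λ x b n → x :+ (b :+ n :* b) := x :+ (𝟙 :+ n) :* b) refl (A + D) B n ⟩
        (A + D) + (1# + n) * B ∎
        where
        open ≡-Reasoning
        F⁺ = false ∷ F
        n = fromℕ (suc a)
        c : Vec# N
        c i = ind (not (lookup F i))
        A  = Ψ T F (suc a) b (suc ℓ , y)
        A′ = Ψ T F a b (suc ℓ , t y)
        B  = Ψ T F (suc a) b (ℓ , t y)
        D  = sum (λ i → c i * Ψ T F (suc a) b (ℓ , T i y))
        D′ = sum (λ i → c i * Ψ T F a b (ℓ , T i (t y)))

      peel-∈₀ : ∀ F a ℓ y → Ψ T⁺ (true ∷ F) a 0 (ℓ , y) ≡ Ψ T F a 0 (ℓ , y)
      peel-∈₀ F zero    ℓ y = refl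
      peel-∈₀ F (suc a) ℓ y = cong₂ _+_ (peel-∈₀ F a (suc ℓ) y) (trans (cong₂ _+_ (zeroˡ _)
        (sum-cong-≗ (λ i → cong (ind (not (lookup F i)) *_) (peel-∈₀ F a ℓ (T i y))))) (+-identityˡ _))

      -- The same expansion in the second direction, where the first letter has b + 1 possible
      -- positions; the derivatives of the first direction commute with it.
      peel-∈ : ∀ F a b ℓ y → Ψ T⁺ (true ∷ F) a (suc b) (ℓ , y)
               ≡ Ψ T F a (suc b) (ℓ , y) + fromℕ (suc b) * Ψ T F a b (ℓ , t y)
      peel-∈ F zero zero ℓ y = solve 2 (λ x y → 𝟙 :* x :+ y := y :+ (𝟙 :+ 𝟘) :* x) refl (coefficient ψ (ℓ , t y))
        (sum (λ i → ind (lookup F i) * coefficient ψ (ℓ , T i y)))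
      peel-∈ F zero (suc b) ℓ y = begin
        1# * Ψ T⁺ F⁺ 0 (suc b) (ℓ , t y) + sum (λ i → c i * Ψ T⁺ F⁺ 0 (suc b) (ℓ , T i y))
          ≡⟨ cong₂ (λ x s → 1# * x + s)
               (trans (peel-∈ F 0 b ℓ (t y)) (cong (λ z → B + n * z) (Ψ-kill F 0 b ℓ y)))
               (trans (sum-cong-≗ (λ i → trans (cong (c i *_) (trans (peel-∈ F 0 b ℓ (T i y)) (cong (λ s → Ψ T F 0 (suc b) (ℓ , T i y) + n * Ψ T F 0 b (ℓ , s)) (tT i y))))
                   (solve 4 (λ c n x y → c :* (x :+ n :* y) := 𝟙 :* (c :* x) :+ n :* (c :* y)) refl (c i) n (Ψ T F 0 (suc b) (ℓ , T i y)) (Ψ T F 0 b (ℓ , T i (t y))))))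
                 (sum-lin 1# n (λ i → c i * Ψ T F 0 (suc b) (ℓ , T i y)) (λ i → c i * Ψ T F 0 b (ℓ , T i (t y))))) ⟩
        1# * (B + n * 0#) + (1# * D + n * B)
          ≡⟨ solve 3 (λ B n D → 𝟙 :* (B :+ n :* 𝟘) :+ (𝟙 :* D :+ n :* B) := D :+ (𝟙 :+ n) :* B) refl B n D ⟩
        D + (1# + n) * B ∎
        where
        open ≡-Reasoning
        F⁺ = true ∷ F
        n = fromℕ (suc b)
        c : Vec# N
        c i = ind (lookup F i)
        B = Ψ T F 0 (suc b) (ℓ , t y)
        D = sum (λ i → c i * Ψ T F 0 (suc b) (ℓ , T i y))
      peel-∈ F (suc a) b ℓ y = begin
        Ψ T⁺ F⁺ a (suc b) (suc ℓ , y) + (0# * Ψ T⁺ F⁺ a (suc b) (ℓ , t y) + sum (λ i → c i * Ψ T⁺ F⁺ a (suc b) (ℓ , T i y)))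
          ≡⟨ cong₂ (λ x s → x + (0# * Ψ T⁺ F⁺ a (suc b) (ℓ , t y) + s)) (peel-∈ F a b (suc ℓ) y)
               (trans (sum-cong-≗ (λ i → trans (cong (c i *_) (trans (peel-∈ F a b ℓ (T i y)) (cong (λ s → Ψ T F a (suc b) (ℓ , T i y) + n * Ψ T F a b (ℓ , s)) (tT i y))))
                   (solve 4 (λ c n x y → c :* (x :+ n :* y) := 𝟙 :* (c :* x) :+ n :* (c :* y)) refl (c i) n (Ψ T F a (suc b) (ℓ , T i y)) (Ψ T F a b (ℓ , T i (t y))))))
                 (sum-lin 1# n (λ i → c i * Ψ T F a (suc b) (ℓ , T i y)) (λ i → c i * Ψ T F a b (ℓ , T i (t y))))) ⟩
        (A + n * A′) + (0# * Z + (1# * D + n * D′))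
          ≡⟨ solve 6 (λ A A′ Z n D D′ → (A :+ n :* A′) :+ (𝟘 :* Z :+ (𝟙 :* D :+ n :* D′)) := (A :+ D) :+ n :* (A′ :+ D′)) refl A A′ Z n D D′ ⟩
        (A + D) + n * (A′ + D′) ∎
        where
        open ≡-Reasoning
        F⁺ = true ∷ F
        n = fromℕ (suc b)
        c : Vec# N
        c i = ind (not (lookup F i))
        Z  = Ψ T⁺ F⁺ a (suc b) (ℓ , t y)
        A  = Ψ T F a (suc b) (suc ℓ , y)
        A′ = Ψ T F a b (suc ℓ , t y)
        D  = sum (λ i → c i * Ψ T F a (suc b) (ℓ , T i y))
        D′ = sum (λ i → c i * Ψ T F a b (ℓ , T i (t y)))

    Ψ-nil₀ : ∀ (T : Fin 0 → Y → Y) a ℓ y → Ψ T [] a 0 (ℓ , y) ≡ fromℕ ((a ℕ.+ ℓ) !) * ind (ψ y)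
    Ψ-nil₀ T zero    ℓ y = refl
    Ψ-nil₀ T (suc a) ℓ y = trans (+-identityʳ _) (trans (Ψ-nil₀ T a (suc ℓ) y)
      (cong (λ k → fromℕ (k !) * ind (ψ y)) (ℕ.+-suc a ℓ)))

    Ψ-nil : ∀ (T : Fin 0 → Y → Y) a b ℓ y → Ψ T [] a (suc b) (ℓ , y) ≡ 0#
    Ψ-nil T zero    b ℓ y = refl
    Ψ-nil T (suc a) b ℓ y = trans (+-identityʳ _) (Ψ-nil T a b (suc ℓ) y)

    fromℕ-+ : ∀ m n → fromℕ (m ℕ.+ n) ≡ fromℕ m + fromℕ n
    fromℕ-+ = ×-homo-+ 1#

    -- Each independent set B with |B ∩ F| = b arises from b! orderings of B ∩ F and a! orderings of the
    -- remaining letters; the factor (multiplicity of x₀)! in φ compensates for the repetitions of x₀.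
    Ψ-count : ∀ {N} (T : Fin N → Y → Y) → (∀ i j y → T i (T j y) ≡ T j (T i y)) → (∀ i y → ψ (T i (T i y)) ≡ false) →
              ∀ F a b y → ∣ ∁ F ∣ ℕ.≤ a →
              Ψ T F a b (0 , y) ≡ fromℕ (a ! ℕ.* b ! ℕ.* count (λ B → (∣ B ∩ F ∣ ≡ᵇ b) ∧ ψ (insertAll T B y)))
    Ψ-count T comm sq [] a zero y _ with ψ y in ψy
    ... | true  = trans (Ψ-nil₀ T a 0 y) (trans (cong₂ (λ k c → fromℕ (k !) * ind c) (ℕ.+-identityʳ a) ψy)
      (trans (*-identityʳ _) (cong fromℕ (sym (trans (ℕ.*-identityʳ _) (ℕ.*-identityʳ (a !)))))))
    ... | false = trans (Ψ-nil₀ T a 0 y) (trans (cong (λ c → fromℕ ((a ℕ.+ 0) !) * ind c) ψy)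
      (trans (zeroʳ _) (cong fromℕ (sym (ℕ.*-zeroʳ (a ! ℕ.* 1))))))
    Ψ-count T comm sq [] a (suc b) y _ = trans (Ψ-nil T a b 0 y) (cong fromℕ (sym (ℕ.*-zeroʳ (a ! ℕ.* suc b !))))
    -- The bound on `∣ ∁ F ∣` excludes exponent 0 here: there must be room for every letter outside
    -- `F`, or independent sets would be missed.
    Ψ-count T comm sq (false ∷ F) (suc a) b y (s≤s p) = begin
      Ψ T (false ∷ F) (suc a) b (0 , y)
        ≡⟨ peel-∉ T comm sq F a b 0 y ⟩
      Ψ (T ∘ suc) F (suc a) b (0 , y) + fromℕ (suc a) * Ψ (T ∘ suc) F a b (0 , T zero y)
        ≡⟨ cong₂ (λ u v → u + fromℕ (suc a) * v) (ih (suc a) y (ℕ.m≤n⇒m≤1+n p)) (ih a (T zero y) p) ⟩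
      fromℕ (suc a ! ℕ.* b ! ℕ.* c₁) + fromℕ (suc a) * fromℕ (a ! ℕ.* b ! ℕ.* c₂)
        ≡⟨ cong (fromℕ (suc a ! ℕ.* b ! ℕ.* c₁) +_) (×1-homo-* (suc a) (a ! ℕ.* b ! ℕ.* c₂)) ⟨
      fromℕ (suc a ! ℕ.* b ! ℕ.* c₁) + fromℕ (suc a ℕ.* (a ! ℕ.* b ! ℕ.* c₂))
        ≡⟨ fromℕ-+ (suc a ! ℕ.* b ! ℕ.* c₁) _ ⟨
      fromℕ (suc a ! ℕ.* b ! ℕ.* c₁ ℕ.+ suc a ℕ.* (a ! ℕ.* b ! ℕ.* c₂))
        ≡⟨ cong fromℕ (S.solve 5 (λ a f g c d → (a S.:* f) S.:* g S.:* c S.:+ a S.:* (f S.:* g S.:* d) S.:= (a S.:* f) S.:* g S.:* (c S.:+ d))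
             refl (suc a) (a !) (b !) c₁ c₂) ⟩
      fromℕ (suc a ! ℕ.* b ! ℕ.* (c₁ ℕ.+ c₂)) ∎
      where
      open ≡-Reasoning
      module S = +-*-Solver
      c : Y → ℕ
      c z = count (λ B → (∣ B ∩ F ∣ ≡ᵇ b) ∧ ψ (insertAll (T ∘ suc) B z))
      c₁ = c y
      c₂ = c (T zero y)
      ih : ∀ a z → ∣ ∁ F ∣ ℕ.≤ a → Ψ (T ∘ suc) F a b (0 , z) ≡ fromℕ (a ! ℕ.* b ! ℕ.* c z)
      ih a z = Ψ-count (T ∘ suc) (λ i j → comm (suc i) (suc j)) (λ i → sq (suc i)) F a b z
    Ψ-count {suc N} T comm sq (true ∷ F) a zero y p = begin
      Ψ T (true ∷ F) a 0 (0 , y)       ≡⟨ peel-∈₀ T comm sq F a 0 y ⟩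
      Ψ (T ∘ suc) F a 0 (0 , y)        ≡⟨ Ψ-count (T ∘ suc) (λ i j → comm (suc i) (suc j)) (λ i → sq (suc i)) F a 0 y p ⟩
      fromℕ (a ! ℕ.* 1 ℕ.* c₁)         ≡⟨ cong (λ k → fromℕ (a ! ℕ.* 1 ℕ.* k)) (sym (trans (cong (c₁ ℕ.+_) (count-none {N} (λ B → refl))) (ℕ.+-identityʳ c₁))) ⟩
      fromℕ (a ! ℕ.* 1 ℕ.* (c₁ ℕ.+ _)) ∎
      where
      open ≡-Reasoning
      c₁ = count (λ B → (∣ B ∩ F ∣ ≡ᵇ 0) ∧ ψ (insertAll (T ∘ suc) B y))
    Ψ-count T comm sq (true ∷ F) a (suc b) y p = begin
      Ψ T (true ∷ F) a (suc b) (0 , y)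
        ≡⟨ peel-∈ T comm sq F a b 0 y ⟩
      Ψ (T ∘ suc) F a (suc b) (0 , y) + fromℕ (suc b) * Ψ (T ∘ suc) F a b (0 , T zero y)
        ≡⟨ cong₂ (λ u v → u + fromℕ (suc b) * v) (ih (suc b) y) (ih b (T zero y)) ⟩
      fromℕ (a ! ℕ.* suc b ! ℕ.* c₁) + fromℕ (suc b) * fromℕ (a ! ℕ.* b ! ℕ.* c₂)
        ≡⟨ cong (fromℕ (a ! ℕ.* suc b ! ℕ.* c₁) +_) (×1-homo-* (suc b) (a ! ℕ.* b ! ℕ.* c₂)) ⟨
      fromℕ (a ! ℕ.* suc b ! ℕ.* c₁) + fromℕ (suc b ℕ.* (a ! ℕ.* b ! ℕ.* c₂))
        ≡⟨ fromℕ-+ (a ! ℕ.* suc b ! ℕ.* c₁) _ ⟨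
      fromℕ (a ! ℕ.* suc b ! ℕ.* c₁ ℕ.+ suc b ℕ.* (a ! ℕ.* b ! ℕ.* c₂))
        ≡⟨ cong fromℕ (S.solve 5 (λ b f g c d → f S.:* (b S.:* g) S.:* c S.:+ b S.:* (f S.:* g S.:* d) S.:= f S.:* (b S.:* g) S.:* (c S.:+ d))
             refl (suc b) (a !) (b !) c₁ c₂) ⟩
      fromℕ (a ! ℕ.* suc b ! ℕ.* (c₁ ℕ.+ c₂)) ∎
      where
      open ≡-Reasoning
      module S = +-*-Solver
      c : ℕ → Y → ℕ
      c b z = count (λ B → (∣ B ∩ F ∣ ≡ᵇ b) ∧ ψ (insertAll (T ∘ suc) B z))
      c₁ = c (suc b) y
      c₂ = c b (T zero y)
      ih : ∀ b z → Ψ (T ∘ suc) F a b (0 , z) ≡ fromℕ (a ! ℕ.* b ! ℕ.* c b z)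
      ih b z = Ψ-count (T ∘ suc) (λ i j → comm (suc i) (suc j)) (λ i → sq (suc i)) F a b z p

-- Ultra log-concavity for a matroid relative to a subset

bump : ∀ {N} → Fin N → Vec ℕ N → Vec ℕ N
bump i y = updateAt y i suc

bump-comm : ∀ {N} (i j : Fin N) y → bump i (bump j y) ≡ bump j (bump i y)
bump-comm zero    zero    y       = refl
bump-comm zero    (suc j) (x ∷ y) = refl
bump-comm (suc i) zero    (x ∷ y) = refl
bump-comm (suc i) (suc j) (x ∷ y) = cong (x ∷_) (bump-comm i j y)

sum-bump : ∀ {N} (i : Fin N) y → Vec.sum (bump i y) ≡ suc (Vec.sum y)
sum-bump zero    (x ∷ y) = refl
sum-bump (suc i) (x ∷ y) = trans (cong (x ℕ.+_) (sum-bump i y)) (ℕ.+-suc x (Vec.sum y))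

-- whether y is the 0/1-vector of a member of Ind
squarefree : ∀ {N} → (Subset N → Bool) → Vec ℕ N → Bool
squarefree Ind []                = Ind []
squarefree Ind (0 ∷ y)           = squarefree (Ind ∘ (false ∷_)) y
squarefree Ind (1 ∷ y)           = squarefree (Ind ∘ (true ∷_)) y
squarefree Ind (suc (suc _) ∷ y) = false

exponents : ∀ {N} → Subset N → Vec ℕ N
exponents = Vec.map bit

squarefree-sq : ∀ {N} Ind i (y : Vec ℕ N) → squarefree Ind (bump i (bump i y)) ≡ false
squarefree-sq Ind zero    (x ∷ y)           = refl
squarefree-sq Ind (suc i) (0 ∷ y)           = squarefree-sq (Ind ∘ (false ∷_)) i y
squarefree-sq Ind (suc i) (1 ∷ y)           = squarefree-sq (Ind ∘ (true ∷_)) i y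
squarefree-sq Ind (suc i) (suc (suc _) ∷ y) = refl

squarefree-mono : ∀ {N} {Ind Ind′ : Subset N → Bool} → (∀ A → Ind A ≡ true → Ind′ A ≡ true) →
                  ∀ y → squarefree Ind y ≡ true → squarefree Ind′ y ≡ true
squarefree-mono p []      q = p [] q
squarefree-mono p (0 ∷ y) q = squarefree-mono (λ A → p (false ∷ A)) y q
squarefree-mono p (1 ∷ y) q = squarefree-mono (λ A → p (true ∷ A)) y q

DownClosed : ∀ {N} → (Subset N → Bool) → Set
DownClosed Ind = ∀ A B → A ⊆ B → Ind B ≡ true → Ind A ≡ true

squarefree-down : ∀ {N} {Ind : Subset N → Bool} → DownClosed Ind →
                  ∀ i y → squarefree Ind (bump i y) ≡ true → squarefree Ind y ≡ true
squarefree-down d zero    (0 ∷ y) q = squarefree-mono (λ A → d (false ∷ A) (true ∷ A) (out⊆ ⊆-refl)) y q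
squarefree-down d (suc i) (0 ∷ y) q = squarefree-down (λ A B s → d (false ∷ A) (false ∷ B) (s⊆s s)) i y q
squarefree-down d (suc i) (1 ∷ y) q = squarefree-down (λ A B s → d (true ∷ A) (true ∷ B) (s⊆s s)) i y q

squarefree-exponents : ∀ {N} (Ind : Subset N → Bool) A → squarefree Ind (exponents A) ≡ Ind A
squarefree-exponents Ind []          = refl
squarefree-exponents Ind (false ∷ A) = squarefree-exponents (Ind ∘ (false ∷_)) A
squarefree-exponents Ind (true  ∷ A) = squarefree-exponents (Ind ∘ (true ∷_)) A

squarefree⇒exponents : ∀ {N} (Ind : Subset N → Bool) y → squarefree Ind y ≡ true → ∃[ A ] y ≡ exponents A
squarefree⇒exponents Ind []      q = [] , refl
squarefree⇒exponents Ind (0 ∷ y) q with squarefree⇒exponents (Ind ∘ (false ∷_)) y q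
... | A , eq = false ∷ A , cong (0 ∷_) eq
squarefree⇒exponents Ind (1 ∷ y) q with squarefree⇒exponents (Ind ∘ (true ∷_)) y q
... | A , eq = true ∷ A , cong (1 ∷_) eq

bump-exponents : ∀ {N} i (A : Subset N) → lookup A i ≡ false → bump i (exponents A) ≡ exponents (A [ i ]≔ true)
bump-exponents zero    (false ∷ A) q = refl
bump-exponents (suc i) (x ∷ A)     q = cong (bit x ∷_) (bump-exponents i A q)

squarefree-bump⇒∉ : ∀ {N} Ind i (A : Subset N) → squarefree Ind (bump i (exponents A)) ≡ true → lookup A i ≡ false
squarefree-bump⇒∉ Ind zero    (false ∷ A) q = refl
squarefree-bump⇒∉ Ind (suc i) (false ∷ A) q = squarefree-bump⇒∉ (Ind ∘ (false ∷_)) i A q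
squarefree-bump⇒∉ Ind (suc i) (true ∷ A)  q = squarefree-bump⇒∉ (Ind ∘ (true ∷_)) i A q

-- The part of matroid augmentation that the quadratic base case consumes. For nonloops over `A` it
-- is transitivity of parallelism in contrapositive form: if i and k are not parallel, j cannot be
-- parallel to both.
Augments : ∀ {N} → (Subset N → Bool) → Set
Augments Ind = ∀ i j k A → i ≢ j → j ≢ k → i ≢ k →
  Ind (A [ k ]≔ true [ i ]≔ true) ≡ true → Ind (A [ j ]≔ true) ≡ true →
  Ind (A [ j ]≔ true [ i ]≔ true) ≡ true ⊎ Ind (A [ k ]≔ true [ j ]≔ true) ≡ true

squarefree-exch-distinct : ∀ {N} {Ind : Subset N → Bool} → DownClosed Ind → Augments Ind →
  ∀ i j k A → i ≢ j → j ≢ k →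
  squarefree Ind (bump i (bump k (exponents A))) ≡ true → squarefree Ind (bump j (exponents A)) ≡ true →
  squarefree Ind (bump i (bump j (exponents A))) ≡ true ⊎ squarefree Ind (bump j (bump k (exponents A))) ≡ true
squarefree-exch-distinct {Ind = Ind} d aug i j k A i≢j j≢k p q =
  Sum.map (from i j i∉A+j j∉A) (from j k j∉A+k k∉A) (aug i j k A i≢j j≢k i≢k (to i k i∉A+k k∉A p)
    (trans (sym (trans (cong (squarefree Ind) (bump-exponents j A j∉A)) (squarefree-exponents Ind _))) q))
  where
  eq : ∀ i k → lookup (A [ k ]≔ true) i ≡ false → lookup A k ≡ false →
       squarefree Ind (bump i (bump k (exponents A))) ≡ Ind (A [ k ]≔ true [ i ]≔ true)
  eq i k i∉ k∉ = trans (cong (squarefree Ind ∘ bump i) (bump-exponents k A k∉))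
    (trans (cong (squarefree Ind) (bump-exponents i (A [ k ]≔ true) i∉)) (squarefree-exponents Ind _))
  from : ∀ i k → lookup (A [ k ]≔ true) i ≡ false → lookup A k ≡ false →
         Ind (A [ k ]≔ true [ i ]≔ true) ≡ true → squarefree Ind (bump i (bump k (exponents A))) ≡ true
  from i k i∉ k∉ r = trans (eq i k i∉ k∉) r
  to : ∀ i k → lookup (A [ k ]≔ true) i ≡ false → lookup A k ≡ false →
       squarefree Ind (bump i (bump k (exponents A))) ≡ true → Ind (A [ k ]≔ true [ i ]≔ true) ≡ true
  to i k i∉ k∉ r = trans (sym (eq i k i∉ k∉)) r
  k∉A : lookup A k ≡ false
  k∉A = squarefree-bump⇒∉ Ind k A (squarefree-down d i (bump k (exponents A)) p)
  i∉A : lookup A i ≡ false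
  i∉A = squarefree-bump⇒∉ Ind i A (squarefree-down d k (bump i (exponents A)) (trans (cong (squarefree Ind) (bump-comm k i (exponents A))) p))
  j∉A : lookup A j ≡ false
  j∉A = squarefree-bump⇒∉ Ind j A q
  i∉A+k : lookup (A [ k ]≔ true) i ≡ false
  i∉A+k = squarefree-bump⇒∉ Ind i (A [ k ]≔ true) (trans (cong (squarefree Ind ∘ bump i) (sym (bump-exponents k A k∉A))) p)
  i≢k : i ≢ k
  i≢k refl with trans (sym (lookup∘updateAt i {f = λ _ → true} A)) i∉A+k
  ... | ()
  i∉A+j : lookup (A [ j ]≔ true) i ≡ false
  i∉A+j = trans (lookup∘updateAt′ i j {f = λ _ → true} i≢j A) i∉A
  j∉A+k : lookup (A [ k ]≔ true) j ≡ false
  j∉A+k = trans (lookup∘updateAt′ j k {f = λ _ → true} j≢k A) j∉A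

squarefree-exch : ∀ {N} {Ind : Subset N → Bool} → DownClosed Ind → Augments Ind →
  ∀ i j k y → squarefree Ind (bump i (bump k y)) ≡ true → squarefree Ind (bump j y) ≡ true →
  squarefree Ind (bump i (bump j y)) ≡ true ⊎ squarefree Ind (bump j (bump k y)) ≡ true
squarefree-exch {Ind = Ind} d aug i j k y p q with i ≟ j | j ≟ k
... | yes refl | _        = inj₂ p
... | no _     | yes refl = inj₁ p
... | no i≢j   | no j≢k with squarefree⇒exponents Ind y (squarefree-down d j y q)
...   | A , refl = squarefree-exch-distinct d aug i j k A i≢j j≢k p q

insertAll-∷ : ∀ {M N} (T : Fin M → Vec ℕ N → Vec ℕ N) (T′ : Fin M → Vec ℕ (suc N) → Vec ℕ (suc N)) →
              (∀ i x y → T′ i (x ∷ y) ≡ x ∷ T i y) → ∀ B x y → insertAll T′ B (x ∷ y) ≡ x ∷ insertAll T B y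
insertAll-∷ T T′ p []          x y = refl
insertAll-∷ T T′ p (false ∷ B) x y = insertAll-∷ (T ∘ suc) (T′ ∘ suc) (λ i → p (suc i)) B x y
insertAll-∷ T T′ p (true  ∷ B) x y = trans (cong (insertAll (T′ ∘ suc) B) (p zero x y))
  (insertAll-∷ (T ∘ suc) (T′ ∘ suc) (λ i → p (suc i)) B x (T zero y))

insertAll-bump : ∀ {N} (B : Subset N) → insertAll bump B (Vec.replicate N 0) ≡ exponents B
insertAll-bump []          = refl
insertAll-bump (false ∷ B) = trans (insertAll-∷ bump (bump ∘ suc) (λ _ _ _ → refl) B 0 _) (cong (0 ∷_) (insertAll-bump B))
insertAll-bump (true  ∷ B) = trans (insertAll-∷ bump (bump ∘ suc) (λ _ _ _ → refl) B 1 _) (cong (1 ∷_) (insertAll-bump B))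

sum-replicate-0 : ∀ N → Vec.sum (Vec.replicate N 0) ≡ 0
sum-replicate-0 zero    = refl
sum-replicate-0 (suc N) = sum-replicate-0 N

C-factorials : ∀ n k a → n ≡ k ℕ.+ a → (n C k) ℕ.* (k ! ℕ.* a !) ≡ n !
C-factorials n k a refl = begin
  (n C k) ℕ.* (k ! ℕ.* a !)              ≡⟨ cong (λ b → (n C k) ℕ.* (k ! ℕ.* b !)) (sym (ℕ.m+n∸m≡n k a)) ⟩
  (n C k) ℕ.* (k ! ℕ.* (n ℕ.∸ k) !)      ≡⟨ cong (ℕ._* (k ! ℕ.* (n ℕ.∸ k) !)) (nCk≡n!/k![n-k]! k≤n) ⟩
  ((n !) ℕ./ (k ! ℕ.* (n ℕ.∸ k) !)) {{nz}} ℕ.* (k ! ℕ.* (n ℕ.∸ k) !) ≡⟨ m/n*n≡m {{nz}} (k![n∸k]!∣n! k≤n) ⟩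
  n ! ∎
  where
  open ≡-Reasoning
  k≤n : k ℕ.≤ k ℕ.+ a
  k≤n = ℕ.m≤m+n k a
  nz = k ℕ.!* (n ℕ.∸ k) !≢0

!>0 : ∀ n → 0 ℕ.< n !
!>0 n = ℕ.>-nonZero⁻¹ (n !) {{n ℕ.!≢0}}

-- Multiply the claim by the factorials P₀ P₂ P₁² to clear the binomial coefficients.
clear-binomials : ∀ {c₀ c₁ c₂ C₀ C₁ C₂ P₀ P₁ P₂ n!} → 0 ℕ.< P₀ → 0 ℕ.< P₁ → 0 ℕ.< P₂ →
  C₀ ℕ.* P₀ ≡ n! → C₁ ℕ.* P₁ ≡ n! → C₂ ℕ.* P₂ ≡ n! →
  (P₀ ℕ.* c₀) ℕ.* (P₂ ℕ.* c₂) ℕ.≤ (P₁ ℕ.* c₁) ℕ.* (P₁ ℕ.* c₁) →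
  c₀ ℕ.* c₂ ℕ.* C₁ ℕ.* C₁ ℕ.≤ c₁ ℕ.* c₁ ℕ.* C₀ ℕ.* C₂
clear-binomials {c₀} {c₁} {c₂} {C₀} {C₁} {C₂} {P₀} {P₁} {P₂} {n!} 0<P₀ 0<P₁ 0<P₂ e₀ e₁ e₂ h =
  ℕ.*-cancelʳ-≤ _ _ M {{ℕ.>-nonZero (ℕ.*-mono-< (ℕ.*-mono-< 0<P₀ 0<P₂) (ℕ.*-mono-< 0<P₁ 0<P₁))}} (begin
    c₀ ℕ.* c₂ ℕ.* C₁ ℕ.* C₁ ℕ.* M
      ≡⟨ S.solve 6 (λ c₀ c₂ C₁ P₀ P₁ P₂ → c₀ S.:* c₂ S.:* C₁ S.:* C₁ S.:* (P₀ S.:* P₂ S.:* (P₁ S.:* P₁))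
           S.:= (P₀ S.:* c₀) S.:* (P₂ S.:* c₂) S.:* ((C₁ S.:* P₁) S.:* (C₁ S.:* P₁))) refl c₀ c₂ C₁ P₀ P₁ P₂ ⟩
    (P₀ ℕ.* c₀) ℕ.* (P₂ ℕ.* c₂) ℕ.* ((C₁ ℕ.* P₁) ℕ.* (C₁ ℕ.* P₁))
      ≡⟨ cong₂ (λ x y → (P₀ ℕ.* c₀) ℕ.* (P₂ ℕ.* c₂) ℕ.* (x ℕ.* y)) (trans e₁ (sym e₀)) (trans e₁ (sym e₂)) ⟩
    (P₀ ℕ.* c₀) ℕ.* (P₂ ℕ.* c₂) ℕ.* ((C₀ ℕ.* P₀) ℕ.* (C₂ ℕ.* P₂))
      ≤⟨ ℕ.*-monoˡ-≤ ((C₀ ℕ.* P₀) ℕ.* (C₂ ℕ.* P₂)) h ⟩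
    (P₁ ℕ.* c₁) ℕ.* (P₁ ℕ.* c₁) ℕ.* ((C₀ ℕ.* P₀) ℕ.* (C₂ ℕ.* P₂))
      ≡⟨ S.solve 6 (λ c₁ C₀ C₂ P₀ P₁ P₂ → (P₁ S.:* c₁) S.:* (P₁ S.:* c₁) S.:* ((C₀ S.:* P₀) S.:* (C₂ S.:* P₂))
           S.:= c₁ S.:* c₁ S.:* C₀ S.:* C₂ S.:* (P₀ S.:* P₂ S.:* (P₁ S.:* P₁))) refl c₁ C₀ C₂ P₀ P₁ P₂ ⟩
    c₁ ℕ.* c₁ ℕ.* C₀ ℕ.* C₂ ℕ.* M ∎)
  where
  open ℕ.≤-Reasoning
  module S = +-*-Solver
  M = P₀ ℕ.* P₂ ℕ.* (P₁ ℕ.* P₁)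

module RelativeMason (𝔽 : ArchimedeanField) {N} (Ind : Subset N → Bool) (down : DownClosed Ind) (aug : Augments Ind)
                     (F : Subset N) where

  open Field 𝔽
  open Forms 𝔽
  open Matrices 𝔽
  open Quadratics 𝔽
  open Peeling 𝔽

  c : ℕ → ℕ
  c k = count (λ B → (∣ B ∩ F ∣ ≡ᵇ k) ∧ Ind B)

  private
    ψ : Vec ℕ N → Bool
    ψ = squarefree Ind

    -- A coordinate with entry 1 counts towards the size and cannot be inserted again; a coordinate
    -- with entry 0 counts at most once, as an insertion.
    few+size : ∀ {M} (Ind : Subset M → Bool) y → squarefree Ind y ≡ true →
               sum (λ i → ind (squarefree Ind (bump i y))) + fromℕ (Vec.sum y) ≤ fromℕ M
    few+size Ind []      q = ≡⇒≤ (+-identityˡ 0#)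
    few+size Ind (0 ∷ y) q = ≤-trans (≡⇒≤ (+-assoc _ _ _))
      (+-mono-≤ (ind≤1 (squarefree Ind (1 ∷ y))) (few+size (Ind ∘ (false ∷_)) y q))
      where
      ind≤1 : ∀ b → ind b ≤ 1#
      ind≤1 true  = ≤-refl
      ind≤1 false = 0≤1
    few+size {suc M} Ind (1 ∷ y) q = ≤-trans
      (≡⇒≤ (solve 2 (λ x s → 𝟘 :+ x :+ (𝟙 :+ s) := 𝟙 :+ (x :+ s)) refl (sum (λ i → ind (squarefree Ind (1 ∷ bump i y)))) (fromℕ (Vec.sum y))))
      (+-monoʳ-≤ 1# (few+size (Ind ∘ (true ∷_)) y q))

    few : ∀ y L → ψ y ≡ true → N ℕ.≤ L ℕ.+ Vec.sum y → sum (λ i → ind (ψ (bump i y))) ≤ fromℕ L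
    few y L ψy N≤ = ≤-by (≤⇒0≤- (≤-trans (few+size Ind y ψy) (fromℕ-mono N≤)))
      (trans (cong (_- (s + fromℕ (Vec.sum y))) (×-homo-+ 1# L (Vec.sum y)))
        (solve 3 (λ s y L → (L :+ y) :- (s :+ y) := L :- s) refl s (fromℕ (Vec.sum y)) (fromℕ L)))
      where
      s : K
      s = sum (λ i → ind (ψ (bump i y)))

    open Independence bump bump-comm ψ (squarefree-down down) (squarefree-sq Ind) (squarefree-exch down aug) Vec.sum sum-bump few

    p q : Vec# (suc N)
    p zero    = 1#
    p (suc i) = ind (not (lookup F i))
    q zero    = 0#
    q (suc i) = ind (lookup F i)

    dirs : ℕ → ℕ → List.List (Vec# (suc N))
    dirs a b = List.replicate a p List.++ List.replicate b q

    Φ-Ψ : ∀ a b ℓ y → Φ (dirs a b) (ℓ , y) ≡ Ψ ψ bump F a b (ℓ , y)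
    Φ-Ψ zero    zero    ℓ y = refl
    Φ-Ψ zero    (suc b) ℓ y = trans (cong₂ _+_ (zeroˡ _) (sum-cong-≗ (λ i → cong (ind (lookup F i) *_) (Φ-Ψ zero b ℓ (bump i y)))))
      (+-identityˡ _)
    Φ-Ψ (suc a) b       ℓ y = cong₂ _+_ (trans (*-identityˡ _) (Φ-Ψ a b (suc ℓ) y))
      (sum-cong-≗ (λ i → cong (ind (not (lookup F i)) *_) (Φ-Ψ a b ℓ (bump i y))))

    Φ-q-last : ∀ a b σ → Φ (q ∷ dirs a b) σ ≡ Φ (dirs a (suc b)) σ
    Φ-q-last zero    b σ = refl
    Φ-q-last (suc a) b σ = trans (Φ-swap q p (dirs a b) σ) (sum-cong-≗ (λ k → cong (p k *_) (Φ-q-last a b (act k σ))))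

    y₀ : Vec ℕ N
    y₀ = Vec.replicate N 0

    value : ∀ a b → ∣ ∁ F ∣ ℕ.≤ a → Φ (dirs a b) (0 , y₀) ≡ fromℕ (b ! ℕ.* a ! ℕ.* c b)
    value a b ∁F≤a = trans (Φ-Ψ a b 0 y₀) (trans (Ψ-count ψ bump bump-comm (squarefree-sq Ind) F a b y₀ ∁F≤a)
      (cong₂ (λ x y → fromℕ (x ℕ.* y)) (ℕ.*-comm (a !) (b !)) (sumOver-cong (λ B → cong (λ e → bit ((∣ B ∩ F ∣ ≡ᵇ b) ∧ e))
        (trans (cong ψ (insertAll-bump B)) (squarefree-exponents Ind B))))))

    p-nonneg : Nonneg p
    p-nonneg zero    = 0≤1
    p-nonneg (suc i) = ind-nonneg (not (lookup F i))

    q-nonneg : Nonneg q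
    q-nonneg zero    = ≤-refl
    q-nonneg (suc i) = ind-nonneg (lookup F i)

    dirs-nonneg : ∀ a b → All Nonneg (dirs a b)
    dirs-nonneg a b = All.++⁺ (All.replicate⁺ a p-nonneg) (All.replicate⁺ b q-nonneg)

    -- Reversed Cauchy-Schwarz for `p` against `q` on the Hessian left after a derivatives along `p`
    -- and b along `q`; as a + b = N - 2, the remaining degree is two. The factor with b + 2
    -- derivatives along `q` has only a along `p`, so it is a that has to accommodate the elements
    -- outside `F`.
    normalised : ∀ a b → N ≡ 2 ℕ.+ (a ℕ.+ b) → ∣ ∁ F ∣ ℕ.≤ a →
      (b ! ℕ.* (2 ℕ.+ a) ! ℕ.* c b) ℕ.* ((2 ℕ.+ b) ! ℕ.* a ! ℕ.* c (2 ℕ.+ b))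
      ℕ.≤ ((1 ℕ.+ b) ! ℕ.* (1 ℕ.+ a) ! ℕ.* c (1 ℕ.+ b)) ℕ.* ((1 ℕ.+ b) ! ℕ.* (1 ℕ.+ a) ! ℕ.* c (1 ℕ.+ b))
    normalised a b N≡ ∁F≤a = fromℕ-cancel-≤ (subst₂ _≤_
        (trans (cong₂ _*_ (trans (bil-mat (dirs a b) σ p p) (value (2 ℕ.+ a) b (ℕ.m≤n⇒m≤o+n 2 ∁F≤a)))
                          (trans (bil-mat (dirs a b) σ q q) (trans (sum-cong-≗ (λ k → cong (q k *_) (Φ-q-last a b (act k σ))))
                             (trans (Φ-q-last a (suc b) σ) (value a (2 ℕ.+ b) ∁F≤a)))))
               (sym (×1-homo-* (b ! ℕ.* (2 ℕ.+ a) ! ℕ.* c b) ((2 ℕ.+ b) ! ℕ.* a ! ℕ.* c (2 ℕ.+ b)))))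
        (trans (cong (λ z → z * z) (trans (bil-mat (dirs a b) σ p q) (trans (sum-cong-≗ (λ k → cong (p k *_) (Φ-q-last a b (act k σ))))
                             (value (1 ℕ.+ a) (1 ℕ.+ b) (ℕ.m≤n⇒m≤1+n ∁F≤a)))))
               (sym (×1-homo-* ((1 ℕ.+ b) ! ℕ.* (1 ℕ.+ a) ! ℕ.* c (1 ℕ.+ b)) ((1 ℕ.+ b) ! ℕ.* (1 ℕ.+ a) ! ℕ.* c (1 ℕ.+ b)))))
        (lorentzian total total-act N base (dirs-nonneg a b) σ (ℕ.≤-reflexive (trans N≡ (cong (2 ℕ.+_) lengths))) p q q-nonneg))
      where
      σ : ℕ × Vec ℕ N
      σ = 0 , y₀
      lengths : a ℕ.+ b ≡ List.length (dirs a b) ℕ.+ Vec.sum y₀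
      lengths = sym (trans (cong₂ ℕ._+_ (trans (List.length-++ (List.replicate a p)) (cong₂ ℕ._+_ (List.length-replicate a) (List.length-replicate b)))
        (sum-replicate-0 N)) (ℕ.+-identityʳ _))

  c-vanishes : ∀ k → ∣ F ∣ ℕ.< k → c k ≡ 0
  c-vanishes k F<k = count-none (λ B → cong (_∧ Ind B) (≢⇒≡ᵇ-false _ k (ℕ.<⇒≢ (ℕ.≤-<-trans (∣p∩q∣≤∣q∣ B F) F<k))))
    where
    ≢⇒≡ᵇ-false : ∀ m n → m ≢ n → (m ≡ᵇ n) ≡ false
    ≢⇒≡ᵇ-false zero    zero    m≢n = contradiction refl m≢n
    ≢⇒≡ᵇ-false zero    (suc n) m≢n = refl
    ≢⇒≡ᵇ-false (suc m) zero    m≢n = refl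
    ≢⇒≡ᵇ-false (suc m) (suc n) m≢n = ≢⇒≡ᵇ-false m n (m≢n ∘ cong suc)

  -- If 2 + k exceeds `∣ F ∣`, the left side vanishes. Otherwise a = N - (2 + k) is at least N - ∣F∣
  -- = ∣∁F∣, the room that `normalised` demands.
  relative-mason : ∀ k → c k ℕ.* c (2 ℕ.+ k) ℕ.* (N C (1 ℕ.+ k)) ℕ.* (N C (1 ℕ.+ k))
                   ℕ.≤ c (1 ℕ.+ k) ℕ.* c (1 ℕ.+ k) ℕ.* (N C k) ℕ.* (N C (2 ℕ.+ k))
  relative-mason k with 2 ℕ.+ k ℕ.≤? ∣ F ∣
  ... | no F<k rewrite c-vanishes (2 ℕ.+ k) (ℕ.≰⇒> F<k) | ℕ.*-zeroʳ (c k) = z≤n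
  ... | yes k≤F = clear-binomials {c k} {c (1 ℕ.+ k)} {c (2 ℕ.+ k)}
      (ℕ.*-mono-< (!>0 k) (!>0 (2 ℕ.+ a))) (ℕ.*-mono-< (!>0 (1 ℕ.+ k)) (!>0 (1 ℕ.+ a))) (ℕ.*-mono-< (!>0 (2 ℕ.+ k)) (!>0 a))
      (C-factorials N k (2 ℕ.+ a) (trans N≡ (trans (cong (2 ℕ.+_) (ℕ.+-comm a k)) (sym (trans (ℕ.+-suc k (suc a)) (cong suc (ℕ.+-suc k a)))))))
      (C-factorials N (1 ℕ.+ k) (1 ℕ.+ a) (trans N≡ (cong suc (trans (cong suc (ℕ.+-comm a k)) (sym (ℕ.+-suc k a))))))
      (C-factorials N (2 ℕ.+ k) a (trans N≡ (cong (2 ℕ.+_) (ℕ.+-comm a k))))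
      (normalised a k N≡ (subst (ℕ._≤ a) (sym (∣∁p∣≡n∸∣p∣ F)) (ℕ.∸-monoʳ-≤ N k≤F)))
    where
    a : ℕ
    a = N ℕ.∸ (2 ℕ.+ k)
    N≡ : N ≡ 2 ℕ.+ (a ℕ.+ k)
    N≡ = trans (sym (ℕ.m∸n+n≡m (ℕ.≤-trans k≤F (∣p∣≤n F)))) (trans (ℕ.+-suc a (suc k)) (cong suc (ℕ.+-suc a k)))

open import Data.Fin.Subset using (_-_)

-- Matroids from basis exchange

∪⁅⁆≡[]≔ : ∀ {n} (p : Subset n) x → p ∪ ⁅ x ⁆ ≡ p [ x ]≔ true
∪⁅⁆≡[]≔ (false ∷ p) zero = cong (true ∷_) (∪-identityʳ p)
∪⁅⁆≡[]≔ (true  ∷ p) zero = cong (true ∷_) (∪-identityʳ p)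
∪⁅⁆≡[]≔ (false ∷ p) (suc x) = cong (false ∷_) (∪⁅⁆≡[]≔ p x)
∪⁅⁆≡[]≔ (true  ∷ p) (suc x) = cong (true ∷_) (∪⁅⁆≡[]≔ p x)

-≡[]≔ : ∀ {n} (p : Subset n) x → p - x ≡ p [ x ]≔ false
-≡[]≔ (s ∷ p)     zero    = cong (false ∷_) (p─⊥≡p p)
-≡[]≔ (false ∷ p) (suc x) = cong (false ∷_) (-≡[]≔ p x)
-≡[]≔ (true  ∷ p) (suc x) = cong (true ∷_) (-≡[]≔ p x)

↔≡[]≔ : ∀ {n} (p : Subset n) x y → p [ x ↔ y ] ≡ p [ x ]≔ false [ y ]≔ true
↔≡[]≔ p x y = trans (∪⁅⁆≡[]≔ (p - x) y) (cong (_[ y ]≔ true) (-≡[]≔ p x))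

∉⇒∈≢ : ∀ {n} {p : Subset n} {x y} → x ∈ p → y ∉ p → x ≢ y
∉⇒∈≢ x∈p y∉p refl = y∉p x∈p

∈-↔⁺ : ∀ {n} {p : Subset n} {x y z} → z ∈ p → z ≢ x → z ∈ p [ x ↔ y ]
∈-↔⁺ z∈p z≢x = x∈p∪q⁺ (inj₁ (x∈p∧x≢y⇒x∈p-y z∈p z≢x))

∈-↔-new : ∀ {n} (p : Subset n) x y → y ∈ p [ x ↔ y ]
∈-↔-new p x y = x∈p∪q⁺ {p = p - x} (inj₂ (x∈⁅x⁆ y))

-⊆ : ∀ {n} (p : Subset n) x → p - x ⊆ p
-⊆ p x = p─q⊆p p ⁅ x ⁆

∈-↔⁻ : ∀ {n} (p : Subset n) x y {z} → z ∈ p [ x ↔ y ] → z ∈ p ⊎ z ≡ y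
∈-↔⁻ p x y z∈ with x∈p∪q⁻ (p - x) ⁅ y ⁆ z∈
... | inj₁ z∈p-x = inj₁ (-⊆ p x z∈p-x)
... | inj₂ z∈⁅y⁆ = inj₂ (x∈⁅y⁆⇒x≡y y z∈⁅y⁆)

x∉p-x : ∀ {n} (p : Subset n) x → x ∉ p - x
x∉p-x p x rewrite -≡[]≔ p x = λ x∈ → true≢false (trans (sym ([]=⇒lookup x∈)) ([]=⇒lookup ([]≔-updates p x)))
  where
  true≢false : true ≢ false
  true≢false ()

x∉p[x↔y] : ∀ {n} (p : Subset n) x y → x ≢ y → x ∉ p [ x ↔ y ]
x∉p[x↔y] p x y x≢y x∈ with x∈p∪q⁻ (p - x) ⁅ y ⁆ x∈
... | inj₁ x∈p-x = x∉p-x p x x∈p-x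
... | inj₂ x∈⁅y⁆ = x≢y (x∈⁅y⁆⇒x≡y y x∈⁅y⁆)

∣p∣≤1+∣p-x∣ : ∀ {n} (p : Subset n) x → ∣ p ∣ ℕ.≤ suc ∣ p - x ∣
∣p∣≤1+∣p-x∣ p x rewrite -≡[]≔ p x = go p x
  where
  go : ∀ {n} (p : Subset n) x → ∣ p ∣ ℕ.≤ suc ∣ p [ x ]≔ false ∣
  go (false ∷ p) zero    = ℕ.n≤1+n _
  go (true  ∷ p) zero    = ℕ.≤-refl
  go (false ∷ p) (suc x) = go p x
  go (true  ∷ p) (suc x) = s≤s (go p x)

insert-⊆ : ∀ {n} {A B : Subset n} {x} → A ⊆ B → x ∈ B → A [ x ]≔ true ⊆ B
insert-⊆ {A = A} {x = x} A⊆B x∈B z∈ with x∈p∪q⁻ A ⁅ x ⁆ (subst (_ ∈_) (sym (∪⁅⁆≡[]≔ A x)) z∈)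
... | inj₁ z∈A = A⊆B z∈A
... | inj₂ z∈⁅x⁆ rewrite x∈⁅y⁆⇒x≡y x z∈⁅x⁆ = x∈B

⊆-insert : ∀ {n} {A B : Subset n} x → A [ x ]≔ true ⊆ B → A ⊆ B
⊆-insert {A = A} x p {z} z∈A with z ≟ x
... | yes refl = p ([]≔-updates A x)
... | no z≢x   = p ([]≔-minimal A z x z≢x z∈A)

module Bases {N} (Basis : Subset N → Set) (r : ℕ) (size : ∀ {B} → Basis B → ∣ B ∣ ≡ r)
  (exch : ∀ {B B′} → Basis B → Basis B′ → ∀ x → x ∈ B → x ∉ B′ →
          ∃[ y ] (y ∈ B′ × y ∉ B × Basis (B [ x ↔ y ])))
  where

  Independent CoIndependent : Subset N → Set
  Independent   A = ∃[ B ] (Basis B × A ⊆ B)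
  CoIndependent A = ∃[ B ] (Basis B × A ⊆ ∁ B)

  private
    -- Exchanging elements of B′ against B preserves A and j; B has two elements outside A + j, so this
    -- cannot stop before B′ has acquired i or k.
    absorb : ∀ f {A B B′ i j k} → Basis B → Basis B′ → A ⊆ B → i ∈ B → k ∈ B → i ≢ k → j ∉ B →
             A ⊆ B′ → j ∈ B′ → N ℕ.< f ℕ.+ ∣ B ∩ B′ ∣ →
             ∃[ B″ ] (Basis B″ × A ⊆ B″ × j ∈ B″ × (i ∈ B″ ⊎ k ∈ B″))
    -- The number f is fuel: the intersection of B and B′ grows with each exchange and has at most N
    -- elements.
    absorb zero    {B = B} {B′} _ _ _ _ _ _ _ _ _ N< = contradiction (ℕ.<-≤-trans N< (∣p∣≤n (B ∩ B′))) (ℕ.<-irrefl refl)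
    absorb (suc f) {A} {B} {B′} {i} {j} {k} b b′ A⊆B i∈B k∈B i≢k j∉B A⊆B′ j∈B′ N<
      with i ∈? B′ | k ∈? B′ | any? (λ x → x ∈? B′ ×-dec ¬? (x ∈? B) ×-dec ¬? (x ≟ j))
    ... | yes i∈B′ | _        | _ = B′ , b′ , A⊆B′ , j∈B′ , inj₁ i∈B′
    ... | no _     | yes k∈B′ | _ = B′ , b′ , A⊆B′ , j∈B′ , inj₂ k∈B′
    ... | no i∉B′  | no k∉B′  | no none = contradiction sizes (ℕ.<-irrefl refl)
      where
      B′-j⊆ : B′ - j ⊆ B - i - k
      B′-j⊆ {z} z∈ = x∈p∧x≢y⇒x∈p-y (x∈p∧x≢y⇒x∈p-y z∈B (∉⇒∈≢ z∈B′ i∉B′)) (∉⇒∈≢ z∈B′ k∉B′)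
        where
        z∈B′ : z ∈ B′
        z∈B′ = -⊆ B′ j z∈
        z∈B : z ∈ B
        z∈B with z ∈? B
        ... | yes p = p
        ... | no ¬p = contradiction (z , z∈B′ , ¬p , λ { refl → x∉p-x B′ j z∈ }) none
      sizes : r ℕ.< r
      sizes = begin-strict
        r                    ≡⟨ size b′ ⟨
        ∣ B′ ∣               ≤⟨ ∣p∣≤1+∣p-x∣ B′ j ⟩
        suc ∣ B′ - j ∣       ≤⟨ s≤s (p⊆q⇒∣p∣≤∣q∣ B′-j⊆) ⟩
        suc ∣ B - i - k ∣    ≤⟨ x∈p⇒∣p-x∣<∣p∣ (x∈p∧x≢y⇒x∈p-y k∈B (i≢k ∘ sym)) ⟩
        ∣ B - i ∣            <⟨ x∈p⇒∣p-x∣<∣p∣ i∈B ⟩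
        ∣ B ∣                ≡⟨ size b ⟩
        r                    ∎
        where open ℕ.≤-Reasoning
    ... | no _     | no _     | yes (x , x∈B′ , x∉B , x≢j) with exch b′ b x x∈B′ x∉B
    ...   | y , y∈B , y∉B′ , b″ = absorb f b b″ A⊆B i∈B k∈B i≢k j∉B
        (λ z∈A → ∈-↔⁺ (A⊆B′ z∈A) (∉⇒∈≢ (A⊆B z∈A) x∉B)) (∈-↔⁺ j∈B′ (x≢j ∘ sym))
        (ℕ.<-≤-trans N< (subst (ℕ._≤ f ℕ.+ ∣ B ∩ (B′ [ x ↔ y ]) ∣) (ℕ.+-suc f ∣ B ∩ B′ ∣) (ℕ.+-monoʳ-≤ f (p⊂q⇒∣p∣<∣q∣ grows))))
      where
      grows : (B ∩ B′) ⊂ (B ∩ (B′ [ x ↔ y ]))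
      grows = (λ {z} z∈ → let (z∈B , z∈B′) = x∈p∩q⁻ B B′ z∈ in x∈p∩q⁺ (z∈B , ∈-↔⁺ z∈B′ (∉⇒∈≢ z∈B x∉B)))
            , y , x∈p∩q⁺ (y∈B , ∈-↔-new B′ x y) , λ y∈ → y∉B′ (proj₂ (x∈p∩q⁻ B B′ y∈))

  independent-down : ∀ {A A′} → A ⊆ A′ → Independent A′ → Independent A
  independent-down A⊆A′ (B , b , A′⊆B) = B , b , A′⊆B ∘ A⊆A′

  coindependent-down : ∀ {A A′} → A ⊆ A′ → CoIndependent A′ → CoIndependent A
  coindependent-down A⊆A′ (B , b , A′⊆B) = B , b , A′⊆B ∘ A⊆A′

  -- If j lies in the basis B of A + k + i, then B contains A + j + i. Otherwise a basis containing
  -- A + j is moved towards B until it contains i or k.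
  independent-augment : ∀ i j k A → i ≢ k → Independent (A [ k ]≔ true [ i ]≔ true) → Independent (A [ j ]≔ true) →
    Independent (A [ j ]≔ true [ i ]≔ true) ⊎ Independent (A [ k ]≔ true [ j ]≔ true)
  independent-augment i j k A i≢k (B , b , Aki⊆B) (B′ , b′ , Aj⊆B′) with j ∈? B
  ... | yes j∈B = inj₁ (B , b , insert-⊆ (insert-⊆ A⊆B j∈B) (Aki⊆B ([]≔-updates _ i)))
    where
    A⊆B : A ⊆ B
    A⊆B = ⊆-insert {A = A} k (⊆-insert {A = A [ k ]≔ true} i Aki⊆B)
  ... | no j∉B with absorb (suc N) b b′ (⊆-insert {A = A} k Ak⊆B) (Aki⊆B ([]≔-updates (A [ k ]≔ true) i)) (Ak⊆B ([]≔-updates A k))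
                     i≢k j∉B (⊆-insert {A = A} j Aj⊆B′) (Aj⊆B′ ([]≔-updates A j)) (ℕ.m≤m+n (suc N) _)
    where
    Ak⊆B : A [ k ]≔ true ⊆ B
    Ak⊆B = ⊆-insert {A = A [ k ]≔ true} i Aki⊆B
  ...   | B″ , b″ , A⊆B″ , j∈B″ , inj₁ i∈B″ = inj₁ (B″ , b″ , insert-⊆ (insert-⊆ A⊆B″ j∈B″) i∈B″)
  ...   | B″ , b″ , A⊆B″ , j∈B″ , inj₂ k∈B″ = inj₂ (B″ , b″ , insert-⊆ (insert-⊆ A⊆B″ k∈B″) j∈B″)

  -- In the dual a single exchange suffices: replacing j in B brings in one element y of B′, which
  -- avoids A because B′ does, and which cannot be both i and k.
  coindependent-augment : ∀ i j k A → i ≢ k → CoIndependent (A [ k ]≔ true [ i ]≔ true) → CoIndependent (A [ j ]≔ true) →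
    CoIndependent (A [ j ]≔ true [ i ]≔ true) ⊎ CoIndependent (A [ k ]≔ true [ j ]≔ true)
  coindependent-augment i j k A i≢k (B , b , Aki⊆) (B′ , b′ , Aj⊆) with j ∈? B
  ... | no j∉B = inj₁ (B , b , insert-⊆ (insert-⊆ A⊆ (x∉p⇒x∈∁p j∉B)) (Aki⊆ ([]≔-updates (A [ k ]≔ true) i)))
    where
    A⊆ : A ⊆ ∁ B
    A⊆ = ⊆-insert {A = A} k (⊆-insert {A = A [ k ]≔ true} i Aki⊆)
  ... | yes j∈B with exch b b′ j j∈B (x∈∁p⇒x∉p (Aj⊆ ([]≔-updates A j)))
  ...   | y , y∈B′ , y∉B , b″ = decide (y ≟ i)
    where
    B″ : Subset N
    B″ = B [ j ↔ y ]
    Ak⊆ : A [ k ]≔ true ⊆ ∁ B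
    Ak⊆ = ⊆-insert {A = A [ k ]≔ true} i Aki⊆
    avoids : ∀ {z} → z ∈ ∁ B → z ≢ y → z ∈ ∁ B″
    avoids z∈ z≢y = x∉p⇒x∈∁p (λ z∈B″ → Sum.[ x∈∁p⇒x∉p z∈ , z≢y ] (∈-↔⁻ B j y z∈B″))
    A⊆ : A ⊆ ∁ B″
    A⊆ z∈A = avoids (⊆-insert {A = A} k Ak⊆ z∈A) (λ { refl → x∈∁p⇒x∉p (⊆-insert {A = A} j Aj⊆ z∈A) y∈B′ })
    j∈ : j ∈ ∁ B″
    j∈ = x∉p⇒x∈∁p (x∉p[x↔y] B j y (∉⇒∈≢ j∈B y∉B))
    decide : Dec (y ≡ i) → CoIndependent (A [ j ]≔ true [ i ]≔ true) ⊎ CoIndependent (A [ k ]≔ true [ j ]≔ true)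
    decide (no y≢i) = inj₁ (B″ , b″ , insert-⊆ (insert-⊆ A⊆ j∈) (avoids (Aki⊆ ([]≔-updates (A [ k ]≔ true) i)) (y≢i ∘ sym)))
    decide (yes refl) = inj₂ (B″ , b″ , insert-⊆ (insert-⊆ A⊆ (avoids (Ak⊆ ([]≔-updates A k)) (i≢k ∘ sym))) j∈)

-- Boolean inclusion, maxima over lists, and concatenation of subsets

∧-true⁻ : ∀ {a b} → a ∧ b ≡ true → a ≡ true × b ≡ true
∧-true⁻ {true} {true} _ = refl , refl

⊆ᵇ⇒⊆ : ∀ {n} (p q : Subset n) → (p ⊆ᵇ q) ≡ true → p ⊆ q
⊆ᵇ⇒⊆ (false ∷ p) (y ∷ q)    e (there x∈) = there (⊆ᵇ⇒⊆ p q e x∈)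
⊆ᵇ⇒⊆ (true ∷ p)  (true ∷ q) e here       = here
⊆ᵇ⇒⊆ (true ∷ p)  (true ∷ q) e (there x∈) = there (⊆ᵇ⇒⊆ p q e x∈)

⊆⇒⊆ᵇ : ∀ {n} (p q : Subset n) → p ⊆ q → (p ⊆ᵇ q) ≡ true
⊆⇒⊆ᵇ []          []          s = refl
⊆⇒⊆ᵇ (false ∷ p) (y ∷ q)     s = ⊆⇒⊆ᵇ p q (drop-∷-⊆ s)
⊆⇒⊆ᵇ (true ∷ p)  (true ∷ q)  s = ⊆⇒⊆ᵇ p q (drop-∷-⊆ s)
⊆⇒⊆ᵇ (true ∷ p)  (false ∷ q) s with s here
... | ()

∈-allSubsets : ∀ {n} (p : Subset n) → p List.∈ allSubsets n
∈-allSubsets []          = here refl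
∈-allSubsets (false ∷ p) = ∈-concatMap⁺ _ (Any.map (λ { refl → here refl }) (∈-allSubsets p))
∈-allSubsets (true ∷ p)  = ∈-concatMap⁺ _ (Any.map (λ { refl → there (here refl) }) (∈-allSubsets p))

⊆-by-size : ∀ {n} {p q : Subset n} → p ⊆ q → ∣ q ∣ ℕ.≤ ∣ p ∣ → p ≡ q
⊆-by-size {p = p} {q} p⊆q ∣q∣≤∣p∣ = ⊆-antisym p⊆q q⊆p
  where
  q⊆p : q ⊆ p
  q⊆p {x} x∈q with x ∈? p
  ... | yes x∈p = x∈p
  ... | no x∉p  = contradiction (ℕ.<-≤-trans (p⊂q⇒∣p∣<∣q∣ (p⊆q , x , x∈q , x∉p)) ∣q∣≤∣p∣) (ℕ.<-irrefl refl)

∁-involutive : ∀ {n} (p : Subset n) → ∁ (∁ p) ≡ p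
∁-involutive []      = refl
∁-involutive (x ∷ p) = cong₂ _∷_ (not-involutive x) (∁-involutive p)

max-attained : ∀ {A : Set} (f : A → ℕ) xs → List.foldr (λ p acc → f p ⊔ acc) 0 xs ≡ 0
               ⊎ ∃[ p ] (f p ≡ List.foldr (λ p acc → f p ⊔ acc) 0 xs)
max-attained f []       = inj₁ refl
max-attained f (x ∷ xs) with ℕ.⊔-sel (f x) (List.foldr (λ p acc → f p ⊔ acc) 0 xs)
... | inj₁ eq = inj₂ (x , sym eq)
... | inj₂ eq rewrite eq = max-attained f xs

≤-max : ∀ {A : Set} (f : A → ℕ) {xs x} → x List.∈ xs → f x ℕ.≤ List.foldr (λ p acc → f p ⊔ acc) 0 xs
≤-max f {y ∷ xs} (here refl) = ℕ.m≤m⊔n (f y) _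
≤-max f {y ∷ xs} (there x∈)  = ℕ.≤-trans (≤-max f x∈) (ℕ.m≤n⊔m (f y) _)

∈-++⁺ˡ : ∀ {m n} {p : Subset m} {q : Subset n} {i} → i ∈ p → i ↑ˡ n ∈ p ++ q
∈-++⁺ˡ {p = p} {q} {i} i∈ = lookup⇒[]= _ _ (trans (lookup-++ˡ p q i) ([]=⇒lookup i∈))

∈-++⁻ˡ : ∀ {m n} {p : Subset m} {q : Subset n} {i} → i ↑ˡ n ∈ p ++ q → i ∈ p
∈-++⁻ˡ {p = p} {q} {i} i∈ = lookup⇒[]= _ _ (trans (sym (lookup-++ˡ p q i)) ([]=⇒lookup i∈))

∈-++⁺ʳ : ∀ {m n} {p : Subset m} {q : Subset n} {j} → j ∈ q → m ↑ʳ j ∈ p ++ q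
∈-++⁺ʳ {p = p} {q} {j} j∈ = lookup⇒[]= _ _ (trans (lookup-++ʳ p q j) ([]=⇒lookup j∈))

∈-++⁻ʳ : ∀ {m n} {p : Subset m} {q : Subset n} {j} → m ↑ʳ j ∈ p ++ q → j ∈ q
∈-++⁻ʳ {p = p} {q} {j} j∈ = lookup⇒[]= _ _ (trans (sym (lookup-++ʳ p q j)) ([]=⇒lookup j∈))

++-⊆⁺ : ∀ {m n} {p p′ : Subset m} {q q′ : Subset n} → p ⊆ p′ → q ⊆ q′ → p ++ q ⊆ p′ ++ q′
++-⊆⁺ {m} p⊆ q⊆ {x} x∈ with splitAt m x in eq
... | inj₁ i rewrite sym (splitAt⁻¹-↑ˡ eq)         = ∈-++⁺ˡ (p⊆ (∈-++⁻ˡ x∈))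
... | inj₂ j rewrite sym (splitAt⁻¹-↑ʳ {m} eq)     = ∈-++⁺ʳ (q⊆ (∈-++⁻ʳ x∈))

∣++∣ : ∀ {m n} (p : Subset m) (q : Subset n) → ∣ p ++ q ∣ ≡ ∣ p ∣ ℕ.+ ∣ q ∣
∣++∣ []          q = refl
∣++∣ (false ∷ p) q = ∣++∣ p q
∣++∣ (true  ∷ p) q = cong suc (∣++∣ p q)

-- The matroid of a bimatroid and its regular rectangles

module BimatroidBases {m n : ℕ} (R : Subset m → Subset n → Bool) (bim : IsBimatroid R) where

  open IsBimatroid bim

  -- The bases (E − I) ∪ J turn the two exchange axioms of a bimatroid into basis exchange.
  Basis : Subset (m ℕ.+ n) → Set
  Basis B = ∃[ I ] ∃[ J ] (B ≡ ∁ I ++ J × R I J ≡ true)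

  basis-size : ∀ {B} → Basis B → ∣ B ∣ ≡ m
  basis-size (I , J , refl , reg) = begin
    ∣ ∁ I ++ J ∣            ≡⟨ ∣++∣ (∁ I) J ⟩
    ∣ ∁ I ∣ ℕ.+ ∣ J ∣       ≡⟨ cong₂ ℕ._+_ (∣∁p∣≡n∸∣p∣ I) (sym (square I J reg)) ⟩
    m ℕ.∸ ∣ I ∣ ℕ.+ ∣ I ∣   ≡⟨ ℕ.m∸n+n≡m (∣p∣≤n I) ⟩
    m                       ∎
    where open ≡-Reasoning

  -- An element of B outside B′ is a row in I′ - I, handled by `exchA`, or a column in J - J′,
  -- handled by `exchB`. The alternatives of either axiom supply y as a row in I - I′ or a column in
  -- J′ - J.
  basis-exchange : ∀ {B B′} → Basis B → Basis B′ → ∀ x → x ∈ B → x ∉ B′ →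
                   ∃[ y ] (y ∈ B′ × y ∉ B × Basis (B [ x ↔ y ]))
  basis-exchange (I , J , refl , reg) (I′ , J′ , refl , reg′) x x∈B x∉B′ with splitAt m x in eq
  ... | inj₁ i rewrite sym (splitAt⁻¹-↑ˡ eq)
        with exchA I J I′ J′ reg reg′ i (x∉∁p⇒x∈p (x∉B′ ∘ ∈-++⁺ˡ)) (x∈∁p⇒x∉p (∈-++⁻ˡ x∈B))
  ...   | inj₁ (e , e∈I , e∉I′ , reg″) = e ↑ˡ n , ∈-++⁺ˡ (x∉p⇒x∈∁p e∉I′) , (λ e∈ → x∈∁p⇒x∉p (∈-++⁻ˡ e∈) e∈I)
          , I [ e ↔ i ] , J , (begin
            (∁ I ++ J) [ i ↑ˡ n ↔ e ↑ˡ n ]                 ≡⟨ ↔≡[]≔ (∁ I ++ J) (i ↑ˡ n) (e ↑ˡ n) ⟩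
            (∁ I ++ J) [ i ↑ˡ n ]≔ false [ e ↑ˡ n ]≔ true  ≡⟨ cong (_[ e ↑ˡ n ]≔ true) ([]≔-++-↑ˡ (∁ I) J i) ⟩
            ((∁ I [ i ]≔ false) ++ J) [ e ↑ˡ n ]≔ true     ≡⟨ []≔-++-↑ˡ (∁ I [ i ]≔ false) J e ⟩
            (∁ I [ i ]≔ false [ e ]≔ true) ++ J            ≡⟨ cong (_++ J) ([]≔-commutes (∁ I) i e i≢e) ⟩
            (∁ I [ e ]≔ true [ i ]≔ false) ++ J            ≡⟨ cong (λ p → (p [ i ]≔ false) ++ J) (map-[]≔ not I e) ⟨
            (∁ (I [ e ]≔ false) [ i ]≔ false) ++ J         ≡⟨ cong (_++ J) (map-[]≔ not (I [ e ]≔ false) i) ⟨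
            ∁ (I [ e ]≔ false [ i ]≔ true) ++ J            ≡⟨ cong (λ p → ∁ p ++ J) (↔≡[]≔ I e i) ⟨
            ∁ (I [ e ↔ i ]) ++ J                           ∎) , reg″
        where
        open ≡-Reasoning
        i≢e : i ≢ e
        i≢e refl = x∈∁p⇒x∉p (∈-++⁻ˡ x∈B) e∈I
  ...   | inj₂ (f , f∈J′ , f∉J , reg″) = m ↑ʳ f , ∈-++⁺ʳ {p = ∁ I′} f∈J′ , (λ f∈ → f∉J (∈-++⁻ʳ {p = ∁ I} f∈))
          , I ∪ ⁅ i ⁆ , J ∪ ⁅ f ⁆ , (begin
            (∁ I ++ J) [ i ↑ˡ n ↔ m ↑ʳ f ]                 ≡⟨ ↔≡[]≔ (∁ I ++ J) (i ↑ˡ n) (m ↑ʳ f) ⟩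
            (∁ I ++ J) [ i ↑ˡ n ]≔ false [ m ↑ʳ f ]≔ true  ≡⟨ cong (_[ m ↑ʳ f ]≔ true) ([]≔-++-↑ˡ (∁ I) J i) ⟩
            ((∁ I [ i ]≔ false) ++ J) [ m ↑ʳ f ]≔ true     ≡⟨ []≔-++-↑ʳ (∁ I [ i ]≔ false) J f ⟩
            (∁ I [ i ]≔ false) ++ (J [ f ]≔ true)          ≡⟨ cong₂ _++_ (sym (map-[]≔ not I i)) (sym (∪⁅⁆≡[]≔ J f)) ⟩
            ∁ (I [ i ]≔ true) ++ (J ∪ ⁅ f ⁆)               ≡⟨ cong (λ p → ∁ p ++ (J ∪ ⁅ f ⁆)) (∪⁅⁆≡[]≔ I i) ⟨
            ∁ (I ∪ ⁅ i ⁆) ++ (J ∪ ⁅ f ⁆)                   ∎) , reg″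
        where open ≡-Reasoning
  basis-exchange (I , J , refl , reg) (I′ , J′ , refl , reg′) x x∈B x∉B′ | inj₂ j rewrite sym (splitAt⁻¹-↑ʳ {m} eq)
        with exchB I J I′ J′ reg reg′ j (∈-++⁻ʳ {p = ∁ I} x∈B) (x∉B′ ∘ ∈-++⁺ʳ {p = ∁ I′})
  ...   | inj₁ (f , f∈J′ , f∉J , reg″) = m ↑ʳ f , ∈-++⁺ʳ {p = ∁ I′} f∈J′ , (λ f∈ → f∉J (∈-++⁻ʳ {p = ∁ I} f∈))
          , I , J [ j ↔ f ] , (begin
            (∁ I ++ J) [ m ↑ʳ j ↔ m ↑ʳ f ]                 ≡⟨ ↔≡[]≔ (∁ I ++ J) (m ↑ʳ j) (m ↑ʳ f) ⟩
            (∁ I ++ J) [ m ↑ʳ j ]≔ false [ m ↑ʳ f ]≔ true  ≡⟨ cong (_[ m ↑ʳ f ]≔ true) ([]≔-++-↑ʳ (∁ I) J j) ⟩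
            (∁ I ++ (J [ j ]≔ false)) [ m ↑ʳ f ]≔ true     ≡⟨ []≔-++-↑ʳ (∁ I) (J [ j ]≔ false) f ⟩
            ∁ I ++ (J [ j ]≔ false [ f ]≔ true)            ≡⟨ cong (∁ I ++_) (↔≡[]≔ J j f) ⟨
            ∁ I ++ (J [ j ↔ f ])                           ∎) , reg″
        where open ≡-Reasoning
  ...   | inj₂ (i , i∈I , i∉I′ , reg″) = i ↑ˡ n , ∈-++⁺ˡ (x∉p⇒x∈∁p i∉I′) , (λ i∈ → x∈∁p⇒x∉p (∈-++⁻ˡ i∈) i∈I)
          , I - i , J - j , (begin
            (∁ I ++ J) [ m ↑ʳ j ↔ i ↑ˡ n ]                 ≡⟨ ↔≡[]≔ (∁ I ++ J) (m ↑ʳ j) (i ↑ˡ n) ⟩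
            (∁ I ++ J) [ m ↑ʳ j ]≔ false [ i ↑ˡ n ]≔ true  ≡⟨ cong (_[ i ↑ˡ n ]≔ true) ([]≔-++-↑ʳ (∁ I) J j) ⟩
            (∁ I ++ (J [ j ]≔ false)) [ i ↑ˡ n ]≔ true     ≡⟨ []≔-++-↑ˡ (∁ I) (J [ j ]≔ false) i ⟩
            (∁ I [ i ]≔ true) ++ (J [ j ]≔ false)          ≡⟨ cong₂ _++_ (sym (map-[]≔ not I i)) (sym (-≡[]≔ J j)) ⟩
            ∁ (I [ i ]≔ false) ++ (J - j)                  ≡⟨ cong (λ p → ∁ p ++ (J - j)) (-≡[]≔ I i) ⟨
            ∁ (I - i) ++ (J - j)                           ∎) , reg″
        where open ≡-Reasoning

  open Bases Basis m basis-size basis-exchange public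

  -- Against (∅, ∅) only the second alternative of `exchB` is possible, so the columns outside T are
  -- removed one by one, each with a row; d is fuel. It applies to a basis `∁ I ++ J` containing
  -- `∁ S ++ T`, which means I ⊆ S and T ⊆ J.
  shrink : ∀ d {I J S T} → R I J ≡ true → I ⊆ S → T ⊆ J → ∣ J ∣ ℕ.≤ d ℕ.+ ∣ T ∣ → ∃[ I′ ] (I′ ⊆ S × R I′ T ≡ true)
  shrink d {I} {J} {S} {T} reg I⊆S T⊆J J≤ with any? (λ j → j ∈? J ×-dec ¬? (j ∈? T))
  shrink zero reg I⊆S T⊆J J≤ | yes (j , j∈J , j∉T) =
    contradiction (ℕ.<-≤-trans (p⊂q⇒∣p∣<∣q∣ (T⊆J , j , j∈J , j∉T)) J≤) (ℕ.<-irrefl refl)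
  shrink (suc d) {I} {J} {S} {T} reg I⊆S T⊆J J≤ | yes (j , j∈J , j∉T) with exchB I J ⊥ ⊥ reg empty j j∈J ∉⊥
  ... | inj₁ (j′ , j′∈⊥ , _) = contradiction j′∈⊥ ∉⊥
  ... | inj₂ (i , i∈I , _ , reg′) = shrink d reg′ (I⊆S ∘ -⊆ I i) (λ z∈T → x∈p∧x≢y⇒x∈p-y (T⊆J z∈T) (∉⇒∈≢ z∈T j∉T))
        (ℕ.≤-pred (ℕ.≤-trans (x∈p⇒∣p-x∣<∣p∣ j∈J) J≤))
  shrink d {I} {J} {S} {T} reg I⊆S T⊆J J≤ | no none = I , I⊆S , subst (λ K → R I K ≡ true) (⊆-antisym J⊆T T⊆J) reg
    where
    J⊆T : J ⊆ T
    J⊆T {j} j∈J with j ∈? T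
    ... | yes p = p
    ... | no ¬p = contradiction (j , j∈J , ¬p) none

  -- (K, L) is enlarged by exchange against (I, J). Since K ⊆ S ⊆ I, the first alternative of
  -- `exchA` is impossible, so each missing row of S enters together with a column of J ⊆ T. The
  -- inclusions S ⊆ I and J ⊆ T say that `S ++ ∁ T` avoids the basis `∁ I ++ J`.
  grow : ∀ d {I J K L S T} → R I J ≡ true → S ⊆ I → J ⊆ T → R K L ≡ true → K ⊆ S → L ⊆ T → ∣ S ∣ ℕ.≤ d ℕ.+ ∣ K ∣ →
         ∃[ L′ ] (L′ ⊆ T × R S L′ ≡ true)
  grow d {K = K} {S = S} reg S⊆I J⊆T regK K⊆S L⊆T S≤ with any? (λ i → i ∈? S ×-dec ¬? (i ∈? K))
  grow zero reg S⊆I J⊆T regK K⊆S L⊆T S≤ | yes (i , i∈S , i∉K) =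
    contradiction (ℕ.<-≤-trans (p⊂q⇒∣p∣<∣q∣ (K⊆S , i , i∈S , i∉K)) S≤) (ℕ.<-irrefl refl)
  grow (suc d) {I} {J} {K} {L} {S} {T} reg S⊆I J⊆T regK K⊆S L⊆T S≤ | yes (i , i∈S , i∉K)
    with exchA K L I J regK reg i (S⊆I i∈S) i∉K
  ... | inj₁ (k , k∈K , k∉I , _) = contradiction (S⊆I (K⊆S k∈K)) k∉I
  ... | inj₂ (j , j∈J , _ , reg′) = grow d reg S⊆I J⊆T reg′
        (λ z∈ → ∪⁅⁆-⊆ K⊆S i∈S z∈) (λ z∈ → ∪⁅⁆-⊆ L⊆T (J⊆T j∈J) z∈)
        (ℕ.≤-trans S≤ (subst (ℕ._≤ d ℕ.+ ∣ K ∪ ⁅ i ⁆ ∣) (ℕ.+-suc d ∣ K ∣) (ℕ.+-monoʳ-≤ d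
          (p⊂q⇒∣p∣<∣q∣ (p⊆p∪q ⁅ i ⁆ , i , x∈p∪q⁺ {p = K} (inj₂ (x∈⁅x⁆ i)) , i∉K)))))
    where
    ∪⁅⁆-⊆ : ∀ {n} {p q : Subset n} {x} → p ⊆ q → x ∈ q → p ∪ ⁅ x ⁆ ⊆ q
    ∪⁅⁆-⊆ {p = p} {q} {x} p⊆q x∈q = subst (_⊆ q) (sym (∪⁅⁆≡[]≔ p x)) (insert-⊆ {A = p} p⊆q x∈q)
  grow d {K = K} {L} {S} reg S⊆I J⊆T regK K⊆S L⊆T S≤ | no none = L , L⊆T , subst (λ I → R I L ≡ true) (⊆-antisym K⊆S S⊆K) regK
    where
    S⊆K : S ⊆ K
    S⊆K {i} i∈S with i ∈? K
    ... | yes p = p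
    ... | no ¬p = contradiction (i , i∈S , ¬p) none

  Vertical Horizontal : Subset m → Subset n → Set
  Vertical   S T = ∃[ I ] (I ⊆ S × R I T ≡ true)
  Horizontal S T = ∃[ J ] (J ⊆ T × R S J ≡ true)

  vertical⇒independent : ∀ {S T} → Vertical S T → Independent (∁ S ++ T)
  vertical⇒independent {S} {T} (I , I⊆S , reg) = ∁ I ++ T , (I , T , refl , reg) , ++-⊆⁺ {p = ∁ S} {q = T} (p⊆q⇒∁p⊇∁q I⊆S) ⊆-refl

  independent⇒vertical : ∀ {S T} → Independent (∁ S ++ T) → Vertical S T
  independent⇒vertical {S} {T} (_ , (I , J , refl , reg) , A⊆B) = shrink ∣ J ∣ reg
    (∁p⊆∁q⇒p⊇q (λ i∈ → ∈-++⁻ˡ {p = ∁ I} (A⊆B (∈-++⁺ˡ {p = ∁ S} i∈)))) (λ j∈ → ∈-++⁻ʳ {p = ∁ I} (A⊆B (∈-++⁺ʳ {p = ∁ S} j∈))) (ℕ.m≤m+n ∣ J ∣ ∣ T ∣)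

  horizontal⇒coindependent : ∀ {S T} → Horizontal S T → CoIndependent (S ++ ∁ T)
  horizontal⇒coindependent {S} {T} (J , J⊆T , reg) = ∁ S ++ J , (S , J , refl , reg) ,
    subst (S ++ ∁ T ⊆_) (sym (trans (map-++ not (∁ S) J) (cong (_++ ∁ J) (∁-involutive S)))) (++-⊆⁺ {p = S} {q = ∁ T} ⊆-refl (p⊆q⇒∁p⊇∁q J⊆T))

  coindependent⇒horizontal : ∀ {S T} → CoIndependent (S ++ ∁ T) → Horizontal S T
  coindependent⇒horizontal {S} {T} (_ , (I , J , refl , reg) , A⊆) = grow ∣ S ∣ reg
    (λ i∈ → ∈-++⁻ˡ {p = I} (A⊆′ (∈-++⁺ˡ {p = S} i∈)))
    (∁p⊆∁q⇒p⊇q (λ j∈ → ∈-++⁻ʳ {p = I} (A⊆′ (∈-++⁺ʳ {p = S} j∈))))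
    empty (⊥-elim ∘ ∉⊥) (⊥-elim ∘ ∉⊥) (ℕ.m≤m+n ∣ S ∣ ∣ ⊥ {m} ∣)
    where
    A⊆′ : S ++ ∁ T ⊆ I ++ ∁ J
    A⊆′ = subst (S ++ ∁ T ⊆_) (trans (map-++ not (∁ I) J) (cong (_++ ∁ J) (∁-involutive I))) A⊆

  rank-attained : ∀ S T → rank R S T ≡ 0 ⊎ ∃[ I ] ∃[ J ] (R I J ≡ true × I ⊆ S × J ⊆ T × ∣ I ∣ ≡ rank R S T)
  rank-attained S T with max-attained _ (allPairs R)
  ... | inj₁ rank≡0 = inj₁ rank≡0
  ... | inj₂ ((I , J) , eq) = split (R I J ∧ (I ⊆ᵇ S) ∧ (J ⊆ᵇ T)) refl eq
    where
    split : ∀ b → R I J ∧ (I ⊆ᵇ S) ∧ (J ⊆ᵇ T) ≡ b → (if b then ∣ I ∣ else 0) ≡ rank R S T →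
            rank R S T ≡ 0 ⊎ ∃[ I ] ∃[ J ] (R I J ≡ true × I ⊆ S × J ⊆ T × ∣ I ∣ ≡ rank R S T)
    split false _ e = inj₁ (sym e)
    split true  c e with ∧-true⁻ c
    ... | reg , c′ with ∧-true⁻ c′
    ...   | I⊆S , J⊆T = inj₂ (I , J , reg , ⊆ᵇ⇒⊆ I S I⊆S , ⊆ᵇ⇒⊆ J T J⊆T , e)

  ≤-rank : ∀ {S T} I J → R I J ≡ true → I ⊆ S → J ⊆ T → ∣ I ∣ ℕ.≤ rank R S T
  ≤-rank {S} {T} I J reg I⊆S J⊆T = subst (ℕ._≤ rank R S T)
    (cong (if_then ∣ I ∣ else 0) (trans (cong (_∧ _) reg) (trans (cong (_∧ (J ⊆ᵇ T)) (⊆⇒⊆ᵇ I S I⊆S)) (⊆⇒⊆ᵇ J T J⊆T))))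
    (≤-max _ (∈-concatMap⁺ _ (Any.map (λ { refl → ∈-map⁺ (I ,_) (∈-allSubsets J) }) (∈-allSubsets I))))

  rank-≤ : ∀ S T → rank R S T ℕ.≤ ∣ S ∣ × rank R S T ℕ.≤ ∣ T ∣
  rank-≤ S T with rank-attained S T
  ... | inj₁ r≡0 rewrite r≡0 = z≤n , z≤n
  ... | inj₂ (I , J , reg , I⊆S , J⊆T , eq) rewrite sym eq =
    p⊆q⇒∣p∣≤∣q∣ I⊆S , subst (ℕ._≤ ∣ T ∣) (sym (square I J reg)) (p⊆q⇒∣p∣≤∣q∣ J⊆T)

  -- also when the rank is 0, by the axiom (∅, ∅) ∈ R
  rank-witness : ∀ S T → ∃[ I ] ∃[ J ] (R I J ≡ true × I ⊆ S × J ⊆ T × ∣ I ∣ ≡ rank R S T)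
  rank-witness S T with rank-attained S T
  ... | inj₂ w   = w
  ... | inj₁ r≡0 = ⊥ , ⊥ , empty , (⊥-elim ∘ ∉⊥) , (⊥-elim ∘ ∉⊥) , trans (∣⊥∣≡0 m) (sym r≡0)

  ≡ᵇ-true⁻ : ∀ a b → (a ≡ᵇ b) ≡ true → a ≡ b
  ≡ᵇ-true⁻ a b e = ℕ.≡ᵇ⇒≡ a b (Equivalence.from T-≡ e)

  ≡ᵇ-true⁺ : ∀ {a b} → a ≡ b → (a ≡ᵇ b) ≡ true
  ≡ᵇ-true⁺ {a} {b} e = Equivalence.to T-≡ (ℕ.≡⇒≡ᵇ a b e)

  ≤ᵇ-true⁺ : ∀ {a b} → a ℕ.≤ b → (a ≤ᵇ b) ≡ true
  ≤ᵇ-true⁺ e = Equivalence.to T-≡ (ℕ.≤⇒≤ᵇ e)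

  isVertRR⇒ : ∀ {S T} → isVertRR R (S , T) ≡ true → Vertical S T
  isVertRR⇒ {S} {T} e with rank-witness S T
  ... | I , J , reg , I⊆S , J⊆T , ∣I∣≡ = I , I⊆S , subst (λ K → R I K ≡ true)
    (⊆-by-size J⊆T (ℕ.≤-reflexive (trans (sym (≡ᵇ-true⁻ _ _ (proj₁ (∧-true⁻ e)))) (trans (sym ∣I∣≡) (square I J reg))))) reg

  isVertRR⇐ : ∀ {S T} → Vertical S T → isVertRR R (S , T) ≡ true
  isVertRR⇐ {S} {T} (I , I⊆S , reg) = cong₂ _∧_
    (≡ᵇ-true⁺ (ℕ.≤-antisym (proj₂ (rank-≤ S T)) T≤rank)) (≤ᵇ-true⁺ (ℕ.≤-trans T≤rank (proj₁ (rank-≤ S T))))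
    where
    T≤rank : ∣ T ∣ ℕ.≤ rank R S T
    T≤rank = subst (ℕ._≤ rank R S T) (square I T reg) (≤-rank I T reg I⊆S ⊆-refl)

  isHorRR⇒ : ∀ {S T} → isHorRR R (S , T) ≡ true → Horizontal S T
  isHorRR⇒ {S} {T} e with rank-witness S T
  ... | I , J , reg , I⊆S , J⊆T , ∣I∣≡ = J , J⊆T , subst (λ K → R K J ≡ true)
    (⊆-by-size I⊆S (ℕ.≤-reflexive (trans (sym (≡ᵇ-true⁻ _ _ (proj₁ (∧-true⁻ e)))) (sym ∣I∣≡)))) reg

  isHorRR⇐ : ∀ {S T} → Horizontal S T → isHorRR R (S , T) ≡ true
  isHorRR⇐ {S} {T} (J , J⊆T , reg) = cong₂ _∧_
    (≡ᵇ-true⁺ (ℕ.≤-antisym (proj₁ (rank-≤ S T)) S≤rank)) (≤ᵇ-true⁺ (ℕ.≤-trans S≤rank (proj₂ (rank-≤ S T))))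
    where
    S≤rank : ∣ S ∣ ℕ.≤ rank R S T
    S≤rank = ≤-rank S J reg ⊆-refl J⊆T

  vertical horizontal : Subset (m ℕ.+ n) → Bool
  vertical   A = isVertRR R (∁ (take m A) , drop m A)
  horizontal A = isHorRR R (take m A , ∁ (drop m A))

  vertical⇒ : ∀ A → vertical A ≡ true → Independent A
  vertical⇒ A e = subst Independent (trans (cong (_++ drop m A) (∁-involutive (take m A))) (take++drop≡id m A))
    (vertical⇒independent (isVertRR⇒ e))

  vertical⇐ : ∀ A → Independent A → vertical A ≡ true
  vertical⇐ A ind = isVertRR⇐ (independent⇒vertical
    (subst Independent (sym (trans (cong (_++ drop m A) (∁-involutive (take m A))) (take++drop≡id m A))) ind))

  horizontal⇒ : ∀ A → horizontal A ≡ true → CoIndependent A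
  horizontal⇒ A e = subst CoIndependent (trans (cong (take m A ++_) (∁-involutive (drop m A))) (take++drop≡id m A))
    (horizontal⇒coindependent (isHorRR⇒ e))

  horizontal⇐ : ∀ A → CoIndependent A → horizontal A ≡ true
  horizontal⇐ A ind = isHorRR⇐ (coindependent⇒horizontal
    (subst CoIndependent (sym (trans (cong (take m A ++_) (∁-involutive (drop m A))) (take++drop≡id m A))) ind))

  vertical-down : DownClosed vertical
  vertical-down A B A⊆B e = vertical⇐ A (independent-down A⊆B (vertical⇒ B e))

  horizontal-down : DownClosed horizontal
  horizontal-down A B A⊆B e = horizontal⇐ A (coindependent-down A⊆B (horizontal⇒ B e))

  vertical-augments : Augments vertical
  vertical-augments i j k A _ _ i≢k p q = Sum.map (vertical⇐ _) (vertical⇐ _)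
    (independent-augment i j k A i≢k (vertical⇒ _ p) (vertical⇒ _ q))

  horizontal-augments : Augments horizontal
  horizontal-augments i j k A _ _ i≢k p q = Sum.map (horizontal⇐ _) (horizontal⇐ _)
    (coindependent-augment i j k A i≢k (horizontal⇒ _ p) (horizontal⇒ _ q))

-- Counting rectangles

module RationalField where

  open Algebra.Properties.Semiring.Mult (CommutativeRing.semiring ℚ.+-*-commutativeRing)
    using (×-assoc-*; ×-congʳ) renaming (_×_ to _·_)

  _⁻¹ : ℚ → ℚ
  x ⁻¹ with x ℚ.≟ 0ℚ
  ... | yes _  = 0ℚ
  ... | no x≢0 = (1/ x) {{ℚ.≢-nonZero x≢0}}

  ⁻¹-inverse : ∀ {x} → ¬ x ≡ 0ℚ → x ℚ.* (x ⁻¹) ≡ 1ℚ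
  ⁻¹-inverse {x} x≢0 with x ℚ.≟ 0ℚ
  ... | yes x≡0 = contradiction x≡0 x≢0
  ... | no x≢0′ = ℚ.*-inverseʳ x {{ℚ.≢-nonZero x≢0′}}

  *-nonneg : ∀ {x y} → 0ℚ ℚ.≤ x → 0ℚ ℚ.≤ y → 0ℚ ℚ.≤ x ℚ.* y
  *-nonneg {x} {y} 0≤x 0≤y = subst (ℚ._≤ x ℚ.* y) (ℚ.*-zeroʳ x) (ℚ.*-monoˡ-≤-nonNeg x {{ℚ.nonNegative 0≤x}} 0≤y)

  toℚᵘ-·1 : ∀ n → ℚ.toℚᵘ (n · 1ℚ) ℚᵘ.≃ mkℚᵘ (ℤ.+ n) 0
  toℚᵘ-·1 zero    = ℚᵘ.≃-refl
  toℚᵘ-·1 (suc n) = ℚᵘ.≃-trans (ℚ.toℚᵘ-homo-+ 1ℚ (n · 1ℚ))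
    (ℚᵘ.≃-trans (ℚᵘ.+-congʳ (ℚ.toℚᵘ 1ℚ) (toℚᵘ-·1 n)) (*≡* (cong (ℤ._* ℤ.+ 1) (cong (λ i → ℤ.+ 1 ℤ.+ i) (ℤ.*-identityʳ (ℤ.+ n))))))

  -- The denominator is at least 1, so the absolute value of the numerator is an explicit upper
  -- bound; applied to y/x it yields the witness for `archimedean`.
  ≤-numerator : ∀ z → z ℚ.≤ ℤ.∣ ℚ.↥ z ∣ · 1ℚ
  ≤-numerator (ℚ.mkℚ i d _) = ℚ.toℚᵘ-cancel-≤ (ℚᵘ.≤-respʳ-≃ (ℚᵘ.≃-sym (toℚᵘ-·1 ℤ.∣ i ∣)) (ℚᵘ.*≤* (bound i d)))
    where
    bound : ∀ i d → i ℤ.* ℤ.+ 1 ℤ.≤ ℤ.+ ℤ.∣ i ∣ ℤ.* ℤ.+ suc d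
    bound (ℤ.+ n)     d = subst₂ ℤ._≤_ (sym (ℤ.*-identityʳ (ℤ.+ n))) (ℤ.pos-* n (suc d)) (ℤ.+≤+ (ℕ.m≤m*n n (suc d)))
    bound ℤ.-[1+ n ] d = subst (ℤ._≤ ℤ.+ suc n ℤ.* ℤ.+ suc d) (sym (ℤ.*-identityʳ ℤ.-[1+ n ])) ℤ.-≤+

  archimedean : ∀ x y → ¬ x ℚ.≤ 0ℚ → ∃[ n ] y ℚ.≤ n · x
  archimedean x y x≰0 = n , (begin
    y                    ≡⟨ ℚ.*-identityʳ y ⟨
    y ℚ.* 1ℚ             ≡⟨ cong (y ℚ.*_) (trans (ℚ.*-comm (x ⁻¹) x) (⁻¹-inverse x≢0)) ⟨
    y ℚ.* (x ⁻¹ ℚ.* x)   ≡⟨ ℚ.*-assoc y (x ⁻¹) x ⟨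
    y ℚ.* x ⁻¹ ℚ.* x     ≤⟨ ℚ.*-monoʳ-≤-nonNeg x {{ℚ.nonNegative (ℚ.<⇒≤ (ℚ.≰⇒> x≰0))}} (≤-numerator (y ℚ.* x ⁻¹)) ⟩
    (n · 1ℚ) ℚ.* x       ≡⟨ ×-assoc-* n 1ℚ x ⟩
    n · (1ℚ ℚ.* x)       ≡⟨ ×-congʳ n (ℚ.*-identityˡ x) ⟩
    n · x                ∎)
    where
    open ℚ.≤-Reasoning
    n : ℕ
    n = ℤ.∣ ℚ.↥ (y ℚ.* x ⁻¹) ∣
    x≢0 : ¬ x ≡ 0ℚ
    x≢0 x≡0 = x≰0 (ℚ.≤-reflexive x≡0)

  ℚ-field : ArchimedeanField
  ℚ-field = record
    { K = ℚ ; _+_ = ℚ._+_ ; _*_ = ℚ._*_ ; -_ = ℚ.-_ ; 0# = 0ℚ ; 1# = 1ℚ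
    ; isCommutativeRing = ℚ.+-*-isCommutativeRing
    ; _⁻¹ = _⁻¹
    ; _≤_ = ℚ._≤_
    ; _≤?_ = ℚ._≤?_
    ; *-inverse = ⁻¹-inverse
    ; ≤-refl = ℚ.≤-refl
    ; ≤-trans = ℚ.≤-trans
    ; ≤-antisym = ℚ.≤-antisym
    ; ≰⇒≥ = λ p → ℚ.<⇒≤ (ℚ.≰⇒> p)
    ; +-monoʳ-≤ = λ z p → ℚ.+-monoʳ-≤ z p
    ; *-nonneg = *-nonneg
    ; 0≢1 = λ ()
    ; archimedean = archimedean
    }

open RationalField using (ℚ-field)

open import Data.Nat using (_+_; _*_; _≥_)

-- Rectangles counted as subsets of the disjoint union

sumOver-+ : ∀ {n} (f g : Subset n → ℕ) → sumOver (λ B → f B + g B) ≡ sumOver f + sumOver g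
sumOver-+ {zero}  f g = refl
sumOver-+ {suc n} f g = trans (cong₂ _+_ (sumOver-+ (f ∘ (false ∷_)) (g ∘ (false ∷_))) (sumOver-+ (f ∘ (true ∷_)) (g ∘ (true ∷_))))
  (interchange (sumOver (f ∘ (false ∷_))) _ _ _)
  where open import Algebra.Properties.CommutativeSemigroup ℕ.+-commutativeSemigroup using (interchange)

sumOver-++ : ∀ m {n} (f : Subset (m + n) → ℕ) → sumOver f ≡ sumOver {m} (λ S → sumOver {n} (λ T → f (S ++ T)))
sumOver-++ zero    f = refl
sumOver-++ (suc m) f = cong₂ _+_ (sumOver-++ m (f ∘ (false ∷_))) (sumOver-++ m (f ∘ (true ∷_)))

sumOver-∁ : ∀ {n} (f : Subset n → ℕ) → sumOver (f ∘ ∁) ≡ sumOver f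
sumOver-∁ {zero}  f = refl
sumOver-∁ {suc n} f = trans (cong₂ _+_ (sumOver-∁ (f ∘ (true ∷_))) (sumOver-∁ (f ∘ (false ∷_)))) (ℕ.+-comm _ (sumOver (f ∘ (false ∷_))))

sum-concatMap : ∀ {A B : Set} (f : B → ℕ) (g : A → List B) xs → ListAction.sum (map f (concatMap g xs)) ≡ ListAction.sum (map (λ x → ListAction.sum (map f (g x))) xs)
sum-concatMap f g []       = refl
sum-concatMap f g (x ∷ xs) = trans (cong ListAction.sum (List.map-++ f (g x) (concatMap g xs)))
  (trans (ListAction.sum-++ (map f (g x)) (map f (concatMap g xs))) (cong (ListAction.sum (map f (g x)) +_) (sum-concatMap f g xs)))

sum-allSubsets : ∀ n (f : Subset n → ℕ) → ListAction.sum (map f (allSubsets n)) ≡ sumOver f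
sum-allSubsets zero    f = ℕ.+-identityʳ (f [])
sum-allSubsets (suc n) f = begin
  ListAction.sum (map f (allSubsets (suc n)))
    ≡⟨ sum-concatMap f (λ s → (false ∷ s) ∷ (true ∷ s) ∷ []) (allSubsets n) ⟩
  ListAction.sum (map (λ s → f (false ∷ s) + (f (true ∷ s) + 0)) (allSubsets n))
    ≡⟨ sum-allSubsets n (λ s → f (false ∷ s) + (f (true ∷ s) + 0)) ⟩
  sumOver (λ s → f (false ∷ s) + (f (true ∷ s) + 0))
    ≡⟨ sumOver-cong (λ s → cong (f (false ∷ s) +_) (ℕ.+-identityʳ _)) ⟩
  sumOver (λ s → f (false ∷ s) + f (true ∷ s))
    ≡⟨ sumOver-+ (f ∘ (false ∷_)) (f ∘ (true ∷_)) ⟩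
  sumOver f ∎
  where open ≡-Reasoning

length-filter : ∀ {A : Set} (g : A → Bool) xs → length (filter (λ x → T? (g x)) xs) ≡ ListAction.sum (map (bit ∘ g) xs)
length-filter g []       = refl
length-filter g (x ∷ xs) with g x
... | true  = cong suc (length-filter g xs)
... | false = length-filter g xs

module _ {m n : ℕ} (R : Subset m → Subset n → Bool) where

  length-filter-pairs : ∀ g → length (filter (λ p → T? (g p)) (allPairs R)) ≡ sumOver (λ S → sumOver (λ T → bit (g (S , T))))
  length-filter-pairs g = begin
    length (filter (λ p → T? (g p)) (allPairs R))
      ≡⟨ length-filter g (allPairs R) ⟩
    ListAction.sum (map (bit ∘ g) (allPairs R))
      ≡⟨ sum-concatMap (bit ∘ g) (λ S → map (S ,_) (allSubsets n)) (allSubsets m) ⟩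
    ListAction.sum (map (λ S → ListAction.sum (map (bit ∘ g) (map (S ,_) (allSubsets n)))) (allSubsets m))
      ≡⟨ sum-allSubsets m _ ⟩
    sumOver (λ S → ListAction.sum (map (bit ∘ g) (map (S ,_) (allSubsets n))))
      ≡⟨ sumOver-cong (λ S → trans (cong ListAction.sum (sym (List.map-∘ (allSubsets n)))) (sum-allSubsets n (λ T → bit (g (S , T))))) ⟩
    sumOver (λ S → sumOver (λ T → bit (g (S , T)))) ∎
    where open ≡-Reasoning

take-++ : ∀ {A : Set} {m n} (xs : Vec A m) (ys : Vec A n) → take m (xs ++ ys) ≡ xs
take-++ []       ys = refl
take-++ (x ∷ xs) ys = cong (x ∷_) (take-++ xs ys)

drop-++ : ∀ {A : Set} {m n} (xs : Vec A m) (ys : Vec A n) → drop m (xs ++ ys) ≡ ys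
drop-++ []       ys = refl
drop-++ (x ∷ xs) ys = drop-++ xs ys

∣∩columns∣ : ∀ {m n} (S : Subset m) (T : Subset n) → ∣ (S ++ T) ∩ (⊥ {m} ++ ⊤ {n}) ∣ ≡ ∣ T ∣
∣∩columns∣ []          T = cong ∣_∣ (∩-identityʳ T)
∣∩columns∣ (false ∷ S) T = ∣∩columns∣ S T
∣∩columns∣ (true  ∷ S) T = ∣∩columns∣ S T

∣∩rows∣ : ∀ {m n} (S : Subset m) (T : Subset n) → ∣ (S ++ T) ∩ (⊤ {m} ++ ⊥ {n}) ∣ ≡ ∣ S ∣
∣∩rows∣ {n = n} [] T = trans (cong ∣_∣ (∩-zeroʳ T)) (∣⊥∣≡0 n)
∣∩rows∣ (false ∷ S) T = ∣∩rows∣ S T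
∣∩rows∣ (true  ∷ S) T = cong suc (∣∩rows∣ S T)

module _ {m n : ℕ} (R : Subset m → Subset n → Bool) (bim : IsBimatroid R) where

  open BimatroidBases R bim

  -- Reindexing by A = ∁ S ++ T: complementation permutes the row sets, and A meets the columns in
  -- T.
  RRv≡count : ∀ k → RRv R k ≡ count (λ A → (∣ A ∩ (⊥ {m} ++ ⊤ {n}) ∣ ≡ᵇ k) ∧ vertical A)
  RRv≡count k = begin
    RRv R k
      ≡⟨ length-filter-pairs R _ ⟩
    sumOver (λ S → sumOver (λ T → bit (isVertRR R (S , T) ∧ (∣ T ∣ ≡ᵇ k))))
      ≡⟨ sumOver-∁ (λ S → sumOver (λ T → bit (isVertRR R (S , T) ∧ (∣ T ∣ ≡ᵇ k)))) ⟨
    sumOver (λ S → sumOver (λ T → bit (isVertRR R (∁ S , T) ∧ (∣ T ∣ ≡ᵇ k))))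
      ≡⟨ sumOver-cong (λ S → sumOver-cong (λ T → cong bit (trans (∧-comm _ (∣ T ∣ ≡ᵇ k)) (cong₂ _∧_
           (cong (_≡ᵇ k) (sym (∣∩columns∣ S T))) (cong₂ (λ S T → isVertRR R (∁ S , T)) (sym (take-++ S T)) (sym (drop-++ S T))))))) ⟩
    sumOver {m} (λ S → sumOver {n} (λ T → bit ((∣ (S ++ T) ∩ (⊥ {m} ++ ⊤ {n}) ∣ ≡ᵇ k) ∧ vertical (S ++ T))))
      ≡⟨ sumOver-++ m {n} _ ⟨
    count (λ A → (∣ A ∩ (⊥ {m} ++ ⊤ {n}) ∣ ≡ᵇ k) ∧ vertical A) ∎
    where open ≡-Reasoning

  -- Here the column sets are complemented, A = S ++ ∁ T, and the distinguished subset consists of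
  -- the rows.
  RRh≡count : ∀ k → RRh R k ≡ count (λ A → (∣ A ∩ (⊤ {m} ++ ⊥ {n}) ∣ ≡ᵇ k) ∧ horizontal A)
  RRh≡count k = begin
    RRh R k
      ≡⟨ length-filter-pairs R _ ⟩
    sumOver (λ S → sumOver (λ T → bit (isHorRR R (S , T) ∧ (∣ S ∣ ≡ᵇ k))))
      ≡⟨ sumOver-cong (λ S → sumOver-∁ (λ T → bit (isHorRR R (S , T) ∧ (∣ S ∣ ≡ᵇ k)))) ⟨
    sumOver (λ S → sumOver (λ T → bit (isHorRR R (S , ∁ T) ∧ (∣ S ∣ ≡ᵇ k))))
      ≡⟨ sumOver-cong (λ S → sumOver-cong (λ T → cong bit (trans (∧-comm _ (∣ S ∣ ≡ᵇ k)) (cong₂ _∧_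
           (cong (_≡ᵇ k) (sym (∣∩rows∣ S T))) (cong₂ (λ S T → isHorRR R (S , ∁ T)) (sym (take-++ S T)) (sym (drop-++ S T))))))) ⟩
    sumOver {m} (λ S → sumOver {n} (λ T → bit ((∣ (S ++ T) ∩ (⊤ {m} ++ ⊥ {n}) ∣ ≡ᵇ k) ∧ horizontal (S ++ T))))
      ≡⟨ sumOver-++ m {n} _ ⟨
    count (λ A → (∣ A ∩ (⊤ {m} ++ ⊥ {n}) ∣ ≡ᵇ k) ∧ horizontal A) ∎
    where open ≡-Reasoning

-- The middle index is `suc k`, which encodes k ≥ 1, and the denominators are cleared, so that
-- indices with vanishing binomial coefficients are covered as well.
theoremB : (m n : ℕ) (R : Subset m → Subset n → Bool) → IsBimatroid R →
    (k : ℕ) →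
    (RRv R (suc k) * RRv R (suc k) * ((m + n) C k) * ((m + n) C suc (suc k))
    ≥ RRv R k * RRv R (suc (suc k)) * ((m + n) C suc k) * ((m + n) C suc k))
    × (RRh R (suc k) * RRh R (suc k) * ((m + n) C k) * ((m + n) C suc (suc k))
    ≥ RRh R k * RRh R (suc (suc k)) * ((m + n) C suc k) * ((m + n) C suc k))
theoremB m n R bim k = vert , hor
  where
  open BimatroidBases R bim
  module V = RelativeMason ℚ-field vertical vertical-down vertical-augments (⊥ {m} ++ ⊤ {n})
  module H = RelativeMason ℚ-field horizontal horizontal-down horizontal-augments (⊤ {m} ++ ⊥ {n})
  vert : RRv R (suc k) * RRv R (suc k) * ((m + n) C k) * ((m + n) C suc (suc k))
         ≥ RRv R k * RRv R (suc (suc k)) * ((m + n) C suc k) * ((m + n) C suc k)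
  vert rewrite RRv≡count R bim k | RRv≡count R bim (suc k) | RRv≡count R bim (suc (suc k)) = V.relative-mason k
  hor : RRh R (suc k) * RRh R (suc k) * ((m + n) C k) * ((m + n) C suc (suc k))
        ≥ RRh R k * RRh R (suc (suc k)) * ((m + n) C suc k) * ((m + n) C suc k)
  hor rewrite RRh≡count R bim k | RRh≡count R bim (suc k) | RRh≡count R bim (suc (suc k)) = H.relative-mason k
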